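{- Let $F$ be any subfield of $\mathbb{R}$ and $\varepsilon\in F$. Then $T[F]$ proves $\forall x\,(x^2-2x+1\ge\varepsilon)$ if and only if $\varepsilon<0$. In particular, $T[F]$ does not prove $\forall x\,(x^2-2x+1\ge0)$.
   Context: For $a\in F$, $f_a$ is a unary function symbol interpreted as $f_a(x)=ax$; a constant $c\in F$ is denoted by the term $f_c(1)$. $x^2$ denotes $x\times x$ and $2x$ denotes $f_2(x)$. $T_{\mathrm{add}}[F]$ is the set of sentences true in $(\mathbb{R},0,1,+,-,<,(f_a)_{a\in F})$, $T_{\mathrm{mult}}[F]$ the set of sentences true in $(\mathbb{R},0,1,\times,\div,<,(f_a)_{a\in F})$ with $x\div0=0$, and $T[F]=T_{\mathrm{add}}[F]\cup T_{\mathrm{mult}}[F]$, a theory in the union of the two languages. -}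

module Defs where

open import Level using (0ℓ)
open import Algebra.Bundles using (CommutativeRing)
open import Axiom.ExcludedMiddle using (ExcludedMiddle)
open import Data.Empty using (⊥)
open import Data.Fin.Base using (Fin; zero; suc)
open import Data.List.Base as List using (List; []; _∷_)
open import Data.List.Membership.Propositional using () renaming (_∈_ to _∈ˡ_)
open import Data.Nat.Base using (ℕ; suc)
open import Data.Product.Base using (Σ; ∃; _×_; _,_; proj₁; proj₂)
open import Data.Sum.Base as Sum using (_⊎_; inj₁; inj₂)
open import Data.Vec.Base as Vec using (Vec; []; _∷_)
open import Data.Vec.Relation.Binary.Pointwise.Inductive using (Pointwise; []; _∷_)
open import Function.Base using (id; _∘_; case_of_)
open import Relation.Binary.Bundles using (Setoid)
open import Relation.Binary.Core using (Rel)
open import Relation.Binary.Definitions using (tri<; tri≈; tri>)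
open import Relation.Binary.PropositionalEquality.Core using (_≡_)
open import Relation.Binary.Structures using (IsStrictTotalOrder)
open import Relation.Nullary using (¬_; Dec; yes; no; contradiction)
open import Relation.Unary using (Pred; _∈_; Satisfiable)

import Relation.Binary.Reasoning.Setoid as SetoidReasoning

------------------------------------------------------------------------
-- The real numbers

-- ℝ is given by its classical characterisation as the Dedekind-complete
-- ordered field, unique up to isomorphism.  Equality of reals is the setoid
-- equality _≈_ of the underlying ring.

record CompleteOrderedField : Set₁ where
  infix 4 _<_
  infixl 7 _÷_

  field
    commutativeRing : CommutativeRing 0ℓ 0ℓ

  open CommutativeRing commutativeRing public

  field
    _<_                : Rel Carrier 0ℓ
    isStrictTotalOrder : IsStrictTotalOrder _≈_ _<_
    0<1                : 0# < 1#
    +-monoˡ-<          : ∀ z {x y} → x < y → x + z < y + z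
    *-pos              : ∀ {x y} → 0# < x → 0# < y → 0# < x * y
    inverse            : ∀ x → ¬ (x ≈ 0#) → ∃ λ y → x * y ≈ 1#

  open IsStrictTotalOrder isStrictTotalOrder public
    using (compare; _≟_; _<?_; <-respˡ-≈; <-respʳ-≈)
    renaming (irrefl to <-irrefl; trans to <-trans; asym to <-asym)

  IsUpperBound : Pred Carrier 0ℓ → Carrier → Set
  IsUpperBound P b = ∀ {x} → x ∈ P → ¬ (b < x)

  -- "No y < s is an upper bound", stated positively.  In this form the
  -- completeness axiom and trichotomy make the metatheory classical, as it
  -- has to be for the usual notion of truth in ℝ: see excludedMiddle below.
  IsSupremum : Pred Carrier 0ℓ → Carrier → Set
  IsSupremum P s =
    IsUpperBound P s × (∀ {y} → y < s → ∃ λ x → x ∈ P × y < x)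

  field
    complete : (P : Pred Carrier 0ℓ) →
               Satisfiable P → ∃ (IsUpperBound P) → ∃ (IsSupremum P)

  divide : (x y : Carrier) → Dec (y ≈ 0#) → Carrier
  divide x y (yes _)   = 0#
  divide x y (no  y≉0) = x * proj₁ (inverse y y≉0)

  inverse-unique : ∀ {y y′ i i′} → y ≈ y′ → y * i ≈ 1# → y′ * i′ ≈ 1# → i ≈ i′
  inverse-unique {y} {y′} {i} {i′} y≈y′ yi≈1 y′i′≈1 = begin
    i               ≈⟨ sym (*-identityʳ i) ⟩
    i * 1#          ≈⟨ *-congˡ (sym y′i′≈1) ⟩
    i * (y′ * i′)   ≈⟨ sym (*-assoc i y′ i′) ⟩
    (i * y′) * i′   ≈⟨ *-congʳ (*-congˡ (sym y≈y′)) ⟩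
    (i * y) * i′    ≈⟨ *-congʳ (*-comm i y) ⟩
    (y * i) * i′    ≈⟨ *-congʳ yi≈1 ⟩
    1# * i′         ≈⟨ *-identityˡ i′ ⟩
    i′              ∎
    where open SetoidReasoning setoid

  divide-cong : ∀ {x x′ y y′} → x ≈ x′ → y ≈ y′ →
                (d : Dec (y ≈ 0#)) (d′ : Dec (y′ ≈ 0#)) →
                divide x y d ≈ divide x′ y′ d′
  divide-cong x≈x′ y≈y′ (yes _)   (yes _)    = refl
  divide-cong x≈x′ y≈y′ (yes y≈0) (no  y′≉0) = contradiction (trans (sym y≈y′) y≈0) y′≉0
  divide-cong x≈x′ y≈y′ (no  y≉0) (yes y′≈0) = contradiction (trans y≈y′ y′≈0) y≉0
  divide-cong {y = y} {y′} x≈x′ y≈y′ (no y≉0) (no y′≉0) =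
    *-cong x≈x′ (inverse-unique y≈y′ (proj₂ (inverse y y≉0)) (proj₂ (inverse y′ y′≉0)))

  _÷_ : Carrier → Carrier → Carrier
  x ÷ y = divide x y (y ≟ 0#)

  ÷-cong : ∀ {x x′ y y′} → x ≈ x′ → y ≈ y′ → x ÷ y ≈ x′ ÷ y′
  ÷-cong {y = y} {y′} x≈x′ y≈y′ = divide-cong x≈x′ y≈y′ (y ≟ 0#) (y′ ≟ 0#)

  -- A is decided by the supremum of {0} ∪ {1 | A}.
  excludedMiddle : ExcludedMiddle 0ℓ
  excludedMiddle {A} = decide (complete P (0# , inj₁ refl) (1# , bound))
    where
    P : Pred Carrier 0ℓ
    P y = y ≈ 0# ⊎ (y ≈ 1# × A)

    bound : IsUpperBound P 1#
    bound (inj₁ x≈0)       1<x = <-asym 0<1 (<-respʳ-≈ x≈0 1<x)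
    bound (inj₂ (x≈1 , _)) 1<x = <-irrefl (sym x≈1) 1<x

    positive : (∃ λ x → x ∈ P × 0# < x) → A
    positive (x , inj₁ x≈0 , 0<x)     = contradiction 0<x (<-irrefl (sym x≈0))
    positive (x , inj₂ (_ , a) , 0<x) = a

    decide : ∃ (IsSupremum P) → Dec A
    decide (s , s-bound , s-least) with 0# <? s
    ... | yes 0<s = yes (positive (s-least 0<s))
    ... | no  0≮s = no λ a → case compare 1# s of λ where
      (tri< 1<s _ _) → 0≮s (<-trans 0<1 1<s)
      (tri≈ _ 1≈s _) → 0≮s (<-respʳ-≈ 1≈s 0<1)
      (tri> _ _ s<1) → s-bound (inj₂ (refl , a)) s<1

record Subfield (ℝ : CompleteOrderedField) : Set₁ where
  open CompleteOrderedField ℝ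
  field
    member     : Pred Carrier 0ℓ
    resp-≈     : ∀ {x y} → x ≈ y → x ∈ member → y ∈ member
    0-closed   : 0# ∈ member
    1-closed   : 1# ∈ member
    +-closed   : ∀ {x y} → x ∈ member → y ∈ member → x + y ∈ member
    neg-closed : ∀ {x} → x ∈ member → - x ∈ member
    *-closed   : ∀ {x y} → x ∈ member → y ∈ member → x * y ∈ member
    inv-closed : ∀ {x y} → x ∈ member → x * y ≈ 1# → y ∈ member

  Element : Set
  Element = Σ Carrier member

  value : Element → Carrier
  value = proj₁

  two : Element
  two = 1# + 1# , +-closed 1-closed 1-closed

------------------------------------------------------------------------
-- Classical first-order logic with equality

record Signature : Set₁ where
  field
    Func : ℕ → Set
    Pr   : ℕ → Set

open Signature

infix  8 _≐_
infixr 6 _⇒_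

data Term (S : Signature) (n : ℕ) : Set where
  var : Fin n → Term S n
  fn  : ∀ {k} → Func S k → Vec (Term S n) k → Term S n

-- Formulas with free variables among n de Bruijn indices.  The other
-- connectives are the usual classical abbreviations.
data Formula (S : Signature) (n : ℕ) : Set where
  ⊥̇    : Formula S n
  _≐_  : Term S n → Term S n → Formula S n
  pr   : ∀ {k} → Pr S k → Vec (Term S n) k → Formula S n
  _⇒_  : Formula S n → Formula S n → Formula S n
  all̇  : Formula S (suc n) → Formula S n

Sentence : Signature → Set
Sentence S = Formula S 0

Theory : Signature → Set₁
Theory S = Pred (Sentence S) 0ℓ

infixr 7 _∨̇_
infix  8 ¬̇_

¬̇_ : ∀ {S n} → Formula S n → Formula S n
¬̇ φ = φ ⇒ ⊥̇

_∨̇_ : ∀ {S n} → Formula S n → Formula S n → Formula S n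
φ ∨̇ ψ = ¬̇ φ ⇒ ψ

module _ {S : Signature} where

  Substitution : ℕ → ℕ → Set
  Substitution m n = Fin m → Term S n

  mutual
    substTerm : ∀ {m n} → Substitution m n → Term S m → Term S n
    substTerm σ (var i)   = σ i
    substTerm σ (fn f ts) = fn f (substTerms σ ts)

    substTerms : ∀ {m n k} → Substitution m n → Vec (Term S m) k → Vec (Term S n) k
    substTerms σ []       = []
    substTerms σ (t ∷ ts) = substTerm σ t ∷ substTerms σ ts

  lift : ∀ {m n} → Substitution m n → Substitution (suc m) (suc n)
  lift σ zero    = var zero
  lift σ (suc i) = substTerm (var ∘ suc) (σ i)

  substFormula : ∀ {m n} → Substitution m n → Formula S m → Formula S n
  substFormula σ ⊥̇         = ⊥̇
  substFormula σ (s ≐ t)   = substTerm σ s ≐ substTerm σ t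
  substFormula σ (pr r ts) = pr r (substTerms σ ts)
  substFormula σ (φ ⇒ ψ)   = substFormula σ φ ⇒ substFormula σ ψ
  substFormula σ (all̇ φ)   = all̇ (substFormula (lift σ) φ)

  weaken : ∀ {n} → Formula S n → Formula S (suc n)
  weaken = substFormula (var ∘ suc)

  closed : ∀ {n} → Sentence S → Formula S n
  closed = substFormula λ ()

  instantiate : ∀ {n} → Term S n → Substitution (suc n) n
  instantiate t zero    = t
  instantiate t (suc i) = var i

  infix 9 _[_]

  _[_] : ∀ {n} → Formula S (suc n) → Term S n → Formula S n
  φ [ t ] = substFormula (instantiate t) φ

-- Natural deduction from the axioms T and the hypotheses Γ.
module _ {S : Signature} (T : Theory S) where

  data Derivation {n : ℕ} (Γ : List (Formula S n)) : Formula S n → Set where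
    axiom   : ∀ {φ} → φ ∈ T → Derivation Γ (closed φ)
    hyp     : ∀ {φ} → φ ∈ˡ Γ → Derivation Γ φ
    ⇒-intro : ∀ {φ ψ} → Derivation (φ ∷ Γ) ψ → Derivation Γ (φ ⇒ ψ)
    ⇒-elim  : ∀ {φ ψ} → Derivation Γ (φ ⇒ ψ) → Derivation Γ φ → Derivation Γ ψ
    raa     : ∀ {φ} → Derivation (¬̇ φ ∷ Γ) ⊥̇ → Derivation Γ φ
    ∀-intro : ∀ {φ} → Derivation (List.map weaken Γ) φ → Derivation Γ (all̇ φ)
    ∀-elim  : ∀ {φ} → Derivation Γ (all̇ φ) → (t : Term S n) → Derivation Γ (φ [ t ])
    ≐-refl  : (t : Term S n) → Derivation Γ (t ≐ t)
    ≐-subst : ∀ {s t} (φ : Formula S (suc n)) →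
              Derivation Γ (s ≐ t) → Derivation Γ (φ [ s ]) → Derivation Γ (φ [ t ])

infix 3 _⊢_

_⊢_ : ∀ {S} → Theory S → Sentence S → Set
T ⊢ φ = Derivation T [] φ

-- The symbol ≐ is interpreted by the setoid equality, which all the other
-- symbols have to respect.
record Structure (S : Signature) : Set₁ where
  field
    domain : Setoid 0ℓ 0ℓ

  open Setoid domain public using (Carrier; _≈_)

  field
    ⟦_⟧ᶠ   : ∀ {k} → Func S k → Vec Carrier k → Carrier
    ⟦_⟧ᵖ   : ∀ {k} → Pr S k → Vec Carrier k → Set
    ᶠ-cong : ∀ {k} (f : Func S k) {xs ys} →
             Pointwise _≈_ xs ys → ⟦ f ⟧ᶠ xs ≈ ⟦ f ⟧ᶠ ys
    ᵖ-resp : ∀ {k} (r : Pr S k) {xs ys} →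
             Pointwise _≈_ xs ys → ⟦ r ⟧ᵖ xs → ⟦ r ⟧ᵖ ys

module _ {S : Signature} (M : Structure S) where
  open Structure M

  mutual
    evalTerm : ∀ {n} → Vec Carrier n → Term S n → Carrier
    evalTerm ρ (var i)   = Vec.lookup ρ i
    evalTerm ρ (fn f ts) = ⟦ f ⟧ᶠ (evalTerms ρ ts)

    evalTerms : ∀ {n k} → Vec Carrier n → Vec (Term S n) k → Vec Carrier k
    evalTerms ρ []       = []
    evalTerms ρ (t ∷ ts) = evalTerm ρ t ∷ evalTerms ρ ts

  Satisfies : ∀ {n} → Vec Carrier n → Formula S n → Set
  Satisfies ρ ⊥̇         = ⊥
  Satisfies ρ (s ≐ t)   = evalTerm ρ s ≈ evalTerm ρ t
  Satisfies ρ (pr r ts) = ⟦ r ⟧ᵖ (evalTerms ρ ts)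
  Satisfies ρ (φ ⇒ ψ)   = Satisfies ρ φ → Satisfies ρ ψ
  Satisfies ρ (all̇ φ)   = ∀ x → Satisfies (x ∷ ρ) φ

  Th : Theory S
  Th φ = Satisfies [] φ

-- Inclusion of one language in another.
record _↪_ (S S′ : Signature) : Set where
  field
    func : ∀ {k} → Func S k → Func S′ k
    pred : ∀ {k} → Pr S k → Pr S′ k

module _ {S S′ : Signature} (ι : S ↪ S′) where
  open _↪_ ι

  mutual
    translateTerm : ∀ {n} → Term S n → Term S′ n
    translateTerm (var i)   = var i
    translateTerm (fn f ts) = fn (func f) (translateTerms ts)

    translateTerms : ∀ {n k} → Vec (Term S n) k → Vec (Term S′ n) k
    translateTerms []       = []
    translateTerms (t ∷ ts) = translateTerm t ∷ translateTerms ts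

  translate : ∀ {n} → Formula S n → Formula S′ n
  translate ⊥̇         = ⊥̇
  translate (s ≐ t)   = translateTerm s ≐ translateTerm t
  translate (pr r ts) = pr (pred r) (translateTerms ts)
  translate (φ ⇒ ψ)   = translate φ ⇒ translate ψ
  translate (all̇ φ)   = all̇ (translate φ)

  image : Theory S → Theory S′
  image T φ = ∃ λ ψ → ψ ∈ T × φ ≡ translate ψ

------------------------------------------------------------------------
-- The theories T_add[F], T_mult[F] and T[F]

module _ {ℝ : CompleteOrderedField} (F : Subfield ℝ) where
  open CompleteOrderedField ℝ
  open Subfield F

  -- Elements a ≈ b of F give two symbols with the same interpretation, so
  -- that scale a x ≐ scale b x belongs to both theories.
  data CommonFunc : ℕ → Set where
    zero′ one′ : CommonFunc 0
    scale      : Element → CommonFunc 1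

  data AddFunc : ℕ → Set where
    plus minus : AddFunc 2

  data MultFunc : ℕ → Set where
    times div : MultFunc 2

  data Order : ℕ → Set where
    less : Order 2

  L-add L-mult L : Signature
  L-add  = record { Func = λ k → CommonFunc k ⊎ AddFunc k ; Pr = Order }
  L-mult = record { Func = λ k → CommonFunc k ⊎ MultFunc k ; Pr = Order }
  L      = record { Func = λ k → CommonFunc k ⊎ (AddFunc k ⊎ MultFunc k) ; Pr = Order }

  add↪ : L-add ↪ L
  add↪ = record { func = Sum.map₂ inj₁ ; pred = id }

  mult↪ : L-mult ↪ L
  mult↪ = record { func = Sum.map₂ inj₂ ; pred = id }

  common : ∀ {k} → CommonFunc k → Vec Carrier k → Carrier
  common zero′     []       = 0#
  common one′      []       = 1#
  common (scale a) (x ∷ []) = value a * x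

  common-cong : ∀ {k} (f : CommonFunc k) {xs ys} →
                Pointwise _≈_ xs ys → common f xs ≈ common f ys
  common-cong zero′     []        = refl
  common-cong one′      []        = refl
  common-cong (scale a) (eq ∷ []) = *-congˡ eq

  additive : ∀ {k} → AddFunc k → Vec Carrier k → Carrier
  additive plus  (x ∷ y ∷ []) = x + y
  additive minus (x ∷ y ∷ []) = x - y

  additive-cong : ∀ {k} (f : AddFunc k) {xs ys} →
                  Pointwise _≈_ xs ys → additive f xs ≈ additive f ys
  additive-cong plus  (p ∷ q ∷ []) = +-cong p q
  additive-cong minus (p ∷ q ∷ []) = +-cong p (-‿cong q)

  multiplicative : ∀ {k} → MultFunc k → Vec Carrier k → Carrier
  multiplicative times (x ∷ y ∷ []) = x * y
  multiplicative div   (x ∷ y ∷ []) = x ÷ y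

  multiplicative-cong : ∀ {k} (f : MultFunc k) {xs ys} →
                        Pointwise _≈_ xs ys → multiplicative f xs ≈ multiplicative f ys
  multiplicative-cong times (p ∷ q ∷ []) = *-cong p q
  multiplicative-cong div   (p ∷ q ∷ []) = ÷-cong p q

  order : ∀ {k} → Order k → Vec Carrier k → Set
  order less (x ∷ y ∷ []) = x < y

  order-resp : ∀ {k} (r : Order k) {xs ys} →
               Pointwise _≈_ xs ys → order r xs → order r ys
  order-resp less (p ∷ q ∷ []) x<y = <-respˡ-≈ p (<-respʳ-≈ q x<y)

  ℝ-add : Structure L-add
  ℝ-add = record
    { domain = setoid
    ; ⟦_⟧ᶠ   = λ { (inj₁ f) → common f ; (inj₂ f) → additive f }
    ; ⟦_⟧ᵖ   = order
    ; ᶠ-cong = λ { (inj₁ f) → common-cong f ; (inj₂ f) → additive-cong f }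
    ; ᵖ-resp = order-resp
    }

  ℝ-mult : Structure L-mult
  ℝ-mult = record
    { domain = setoid
    ; ⟦_⟧ᶠ   = λ { (inj₁ f) → common f ; (inj₂ f) → multiplicative f }
    ; ⟦_⟧ᵖ   = order
    ; ᶠ-cong = λ { (inj₁ f) → common-cong f ; (inj₂ f) → multiplicative-cong f }
    ; ᵖ-resp = order-resp
    }

  T-add : Theory L-add
  T-add = Th ℝ-add

  T-mult : Theory L-mult
  T-mult = Th ℝ-mult

  T[_] : Theory L
  T[_] φ = φ ∈ image add↪ T-add ⊎ φ ∈ image mult↪ T-mult

module _ {ℝ : CompleteOrderedField} {F : Subfield ℝ} where
  open Subfield F

  infixl 10 _ẋ_
  infixl 9 _+̇_ _-̇_
  infix  8 _<̇_ _≥̇_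

  0̇ 1̇ : ∀ {n} → Term (L F) n
  0̇ = fn (inj₁ zero′) []
  1̇ = fn (inj₁ one′) []

  f : ∀ {n} → Element → Term (L F) n → Term (L F) n
  f a t = fn (inj₁ (scale a)) (t ∷ [])

  _+̇_ _-̇_ _ẋ_ : ∀ {n} → Term (L F) n → Term (L F) n → Term (L F) n
  s +̇ t = fn (inj₂ (inj₁ plus)) (s ∷ t ∷ [])
  s -̇ t = fn (inj₂ (inj₁ minus)) (s ∷ t ∷ [])
  s ẋ t = fn (inj₂ (inj₂ times)) (s ∷ t ∷ [])

  const : ∀ {n} → Element → Term (L F) n
  const c = f c 1̇

  _<̇_ _≥̇_ : ∀ {n} → Term (L F) n → Term (L F) n → Formula (L F) n
  s <̇ t = pr less (s ∷ t ∷ [])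
  s ≥̇ t = t <̇ s ∨̇ t ≐ s

{-# OPTIONS --safe #-}
module Submission where

-- If ε < 0, put δ = −ε/2 ∈ F.  Assume x² − 2x + 1 < ε.  From n δ < x the
-- multiplicative theory gives n δ x < x², and then linear arithmetic gives
-- (n + 1) δ < x.  Iterating up to 2 ≤ n δ yields 2 x < x², a contradiction.
--
-- For ε ≥ 0 there is a model of T[F] in which x² − 2x + 1 < 0 for some x
-- infinitely close to 1.  Its additive structure is the lexicographically
-- ordered space of finite sums Σ aᵢ t^γᵢ with real exponents, t infinitely
-- large.  A positive element is a t^γ (1 + w) with w infinitesimal, and it is
-- multiplied as the element (γ , a , w) of ℝ × ℝ>0 × W, the addition of W
-- having first been distorted by an order automorphism.  This commutes with
-- the scalings by F, so that only the truth of T_add and T_mult remains to be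
-- shown: up to signs both reducts are divisible ordered modules, in which every
-- formula is decided by the signs of finitely many linear forms.

open import Defs
open import Level using (0ℓ)
open import Algebra.Bundles using (AbelianGroup)
open import Axiom.ExcludedMiddle using (ExcludedMiddle)
open import Data.Bool.Base using (Bool; true; T; _∧_)
open import Data.Bool.Properties using (T-∧)
open import Data.Empty using (⊥; ⊥-elim)
open import Data.Fin.Base using (Fin; zero; suc)
open import Data.Integer.Base as ℤ using (ℤ; +_; -[1+_])
import Data.Integer.Properties as ℤ
open import Data.Integer.Solver using (module +-*-Solver)
open import Data.List.Base as List
  using (List; []; _∷_; _++_; concatMap; cartesianProductWith; filter)
open import Data.List.Membership.Propositional using () renaming (_∈_ to _∈ˡ_)
open import Data.List.Membership.Propositional.Properties
  using (∈-filter⁺; ∈-filter⁻; ∈-++⁺ˡ; ∈-++⁺ʳ; ∈-concatMap⁺; ∈-map⁺; ∈-cartesianProductWith⁺)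
open import Data.List.Relation.Unary.All as All using (All; []; _∷_)
import Data.List.Relation.Unary.All.Properties as All
open import Data.List.Relation.Unary.Any as Any using (here; there)
open import Data.Maybe.Base using (Maybe; just; nothing)
open import Data.Nat.Base as ℕ using (ℕ; zero; suc)
import Data.Nat.Properties as ℕ
open import Data.Product.Base using (Σ; ∃; _×_; _,_; proj₁; proj₂)
open import Data.Sum.Base using (_⊎_; inj₁; inj₂)
open import Data.Unit.Base using (⊤; tt)
open import Data.Vec.Base as Vec using (Vec; []; _∷_)
open import Data.Vec.Relation.Binary.Pointwise.Inductive using (Pointwise; []; _∷_)
open import Function.Base using (id; _∘_)
open import Function.Bundles using (_⇔_; mk⇔; Equivalence)
open import Relation.Binary.Bundles using (Setoid)
open import Relation.Binary.Definitions using (Tri; tri<; tri≈; tri>)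
open import Relation.Binary.PropositionalEquality as ≡ using (_≡_)
open import Relation.Nullary using (¬_; Dec; yes; no; contradiction)
open import Relation.Unary using (_∈_)
import Algebra.Construct.DirectProduct as DirectProduct
import Algebra.Properties.AbelianGroup as AbelianGroupProperties
import Algebra.Properties.CommutativeMonoid.Mult as Mult
import Algebra.Properties.CommutativeSemigroup as CommutativeSemigroupProperties
import Algebra.Properties.Ring as RingProperties
import Algebra.Solver.Ring as RingSolver
import Algebra.Solver.Ring.AlmostCommutativeRing as ACR
import Relation.Binary.Reasoning.Setoid as SetoidReasoning

-- Linear forms

-- The two theories share only 0, 1, the order and the symbols f_a, so in a model of their union the
-- product need not distribute over the sum. The positive elements of an additive model may carry
-- any product that makes them a suitable divisible ordered group and in which each f_a with a > 0
-- is multiplication by a constant. Transporting the addition of W along w ↦ 1 + w gives (1 + w)² =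
-- 1 + 2 w, so that x² - 2 x + 1 vanishes at every such x, which does not refute ε = 0. Hence the
-- distortion: with a concave map β that has a kink at d, the element x = 1 + β(d) has square 1 +
-- β(2 d) < 1 + 2 β(d), and the quadratic becomes negative at x. It is infinitesimal there, in
-- accordance with the provability for ε < 0. The same restriction explains the shape of the
-- derivation: linear arithmetic learns about x² only through lines c x < x² with c in F. A fixed
-- error δ > 0 is what lets finitely many such lines enclose the parabola closely enough.

record Coefficients : Set₁ where
  infixl 6 _⊕_
  infixl 7 _⊗_
  infix  9 ⊖_
  field
    K             : Set
    _⊕_ _⊗_       : K → K → K
    ⊖_            : K → K
    𝟘 𝟙           : K
    Null Positive : K → Set
    null-𝟘        : Null 𝟘
    positive-𝟙⊕𝟙  : Positive (𝟙 ⊕ 𝟙)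
    sign?         : ∀ k → Positive k ⊎ Null k ⊎ Positive (⊖ k)

-- No laws are imposed on K itself; its operations get their meaning from the action. This admits
-- the unreduced pairs of naturals as coefficients, and makes `·-comm` a separate field, since
-- crossing two thresholds exchanges their factors.
record Action (R : Coefficients) (A : AbelianGroup 0ℓ 0ℓ) : Set₁ where
  open Coefficients R
  open AbelianGroup A
  infixr 8 _·_
  field
    _·_        : K → Carrier → Carrier
    ·-congˡ    : ∀ {k x y} → x ≈ y → k · x ≈ k · y
    ·-distribˡ : ∀ k x y → k · (x ∙ y) ≈ k · x ∙ k · y
    ·-distribʳ : ∀ k l x → (k ⊕ l) · x ≈ k · x ∙ l · x
    ·-assoc    : ∀ k l x → (k ⊗ l) · x ≈ k · l · x
    ·-comm     : ∀ k l x → k · l · x ≈ l · k · x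
    ⊖-·        : ∀ k x → (⊖ k) · x ≈ (k · x) ⁻¹
    𝟙-·        : ∀ x → 𝟙 · x ≈ x
    null-·     : ∀ {k} → Null k → ∀ x → k · x ≈ ε

  open AbelianGroupProperties A
  open SetoidReasoning setoid

  ·-ε : ∀ k → k · ε ≈ ε
  ·-ε k = identityˡ-unique (k · ε) (k · ε) (begin
    k · ε ∙ k · ε ≈⟨ ·-distribˡ k ε ε ⟨
    k · (ε ∙ ε)   ≈⟨ ·-congˡ (identityˡ ε) ⟩
    k · ε         ∎)

  ·-⁻¹ : ∀ k x → k · (x ⁻¹) ≈ (k · x) ⁻¹
  ·-⁻¹ k x = inverseˡ-unique (k · (x ⁻¹)) (k · x) (begin
    k · (x ⁻¹) ∙ k · x ≈⟨ ·-distribˡ k (x ⁻¹) x ⟨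
    k · (x ⁻¹ ∙ x)     ≈⟨ ·-congˡ (inverseˡ x) ⟩
    k · ε              ≈⟨ ·-ε k ⟩
    ε                  ∎)

infixl 6 _⊞_

-- Forms stay syntactic so that one and the same form can be evaluated in two modules; C names the
-- parameters that both modules interpret.
data Form (K C : Set) (n : ℕ) : Set where
  null  : Form K C n
  constant : C → Form K C n
  arg   : Fin n → Form K C n
  _⊞_   : Form K C n → Form K C n → Form K C n
  neg   : Form K C n → Form K C n
  scale : K → Form K C n → Form K C n

module _ {R : Coefficients} {A : AbelianGroup 0ℓ 0ℓ} (act : Action R A)
         {C : Set} (ι : C → AbelianGroup.Carrier A) where
  open Coefficients R
  open AbelianGroup A
  open Action act

  eval : ∀ {n} → Form K C n → Vec Carrier n → Carrier
  eval null        ρ = ε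
  eval (constant c)   ρ = ι c
  eval (arg i)     ρ = Vec.lookup ρ i
  eval (s ⊞ t)     ρ = eval s ρ ∙ eval t ρ
  eval (neg t)     ρ = eval t ρ ⁻¹
  eval (scale k t) ρ = k · eval t ρ

module _ (R : Coefficients) {C : Set} where
  open Coefficients R

  lead : ∀ {n} → Form K C (suc n) → K
  lead null          = 𝟘
  lead (constant c)     = 𝟘
  lead (arg zero)    = 𝟙
  lead (arg (suc i)) = 𝟘
  lead (s ⊞ t)       = lead s ⊕ lead t
  lead (neg t)       = ⊖ lead t
  lead (scale k t)   = k ⊗ lead t

  rest : ∀ {n} → Form K C (suc n) → Form K C n
  rest null          = null
  rest (constant c)     = constant c
  rest (arg zero)    = null
  rest (arg (suc i)) = arg i
  rest (s ⊞ t)       = rest s ⊞ rest t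
  rest (neg t)       = neg (rest t)
  rest (scale k t)   = scale k (rest t)

module _ {R : Coefficients} {A : AbelianGroup 0ℓ 0ℓ} (act : Action R A)
         {C : Set} (ι : C → AbelianGroup.Carrier A) where
  open Coefficients R
  open AbelianGroup A
  open Action act
  open AbelianGroupProperties A
  open CommutativeSemigroupProperties commutativeSemigroup using (interchange)
  open SetoidReasoning setoid

  private
    ⟦_⟧ : ∀ {n} → Form K C n → Vec Carrier n → Carrier
    ⟦_⟧ = eval act ι

    constantIn : ∀ x a → a ≈ 𝟘 · x ∙ a
    constantIn x a = sym (trans (∙-congʳ (null-· null-𝟘 x)) (identityˡ a))

  lead-rest : ∀ {n} (t : Form K C (suc n)) x ρ →
              ⟦ t ⟧ (x ∷ ρ) ≈ lead R t · x ∙ ⟦ rest R t ⟧ ρ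
  lead-rest null          x ρ = constantIn x ε
  lead-rest (constant c)     x ρ = constantIn x (ι c)
  lead-rest (arg zero)    x ρ = sym (trans (identityʳ _) (𝟙-· x))
  lead-rest (arg (suc i)) x ρ = constantIn x (Vec.lookup ρ i)
  lead-rest (s ⊞ t)       x ρ = begin
    ⟦ s ⟧ (x ∷ ρ) ∙ ⟦ t ⟧ (x ∷ ρ)
      ≈⟨ ∙-cong (lead-rest s x ρ) (lead-rest t x ρ) ⟩
    (lead R s · x ∙ ⟦ rest R s ⟧ ρ) ∙ (lead R t · x ∙ ⟦ rest R t ⟧ ρ)
      ≈⟨ interchange _ _ _ _ ⟩
    (lead R s · x ∙ lead R t · x) ∙ (⟦ rest R s ⟧ ρ ∙ ⟦ rest R t ⟧ ρ)
      ≈⟨ ∙-congʳ (·-distribʳ (lead R s) (lead R t) x) ⟨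
    (lead R s ⊕ lead R t) · x ∙ (⟦ rest R s ⟧ ρ ∙ ⟦ rest R t ⟧ ρ) ∎
  lead-rest (neg t)       x ρ = begin
    ⟦ t ⟧ (x ∷ ρ) ⁻¹                        ≈⟨ ⁻¹-cong (lead-rest t x ρ) ⟩
    (lead R t · x ∙ ⟦ rest R t ⟧ ρ) ⁻¹      ≈⟨ ⁻¹-∙-comm _ _ ⟨
    (lead R t · x) ⁻¹ ∙ ⟦ rest R t ⟧ ρ ⁻¹   ≈⟨ ∙-congʳ (⊖-· (lead R t) x) ⟨
    (⊖ lead R t) · x ∙ ⟦ rest R t ⟧ ρ ⁻¹    ∎
  lead-rest (scale k t)   x ρ = begin
    k · ⟦ t ⟧ (x ∷ ρ)                       ≈⟨ ·-congˡ (lead-rest t x ρ) ⟩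
    k · (lead R t · x ∙ ⟦ rest R t ⟧ ρ)     ≈⟨ ·-distribˡ k _ _ ⟩
    k · lead R t · x ∙ k · ⟦ rest R t ⟧ ρ   ≈⟨ ∙-congʳ (·-assoc k (lead R t) x) ⟨
    (k ⊗ lead R t) · x ∙ k · ⟦ rest R t ⟧ ρ ∎

-- The integers, (m , n) standing for m − n.
integers : Coefficients
integers = record
  { K            = ℕ × ℕ
  ; _⊕_          = λ (m , n) (m′ , n′) → m ℕ.+ m′ , n ℕ.+ n′
  ; _⊗_          = λ (m , n) (m′ , n′) → m ℕ.* m′ ℕ.+ n ℕ.* n′ , m ℕ.* n′ ℕ.+ n ℕ.* m′
  ; ⊖_           = λ (m , n) → n , m
  ; 𝟘            = 0 , 0
  ; 𝟙            = 1 , 0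
  ; Null         = λ (m , n) → m ≡ n
  ; Positive     = λ (m , n) → n ℕ.< m
  ; null-𝟘       = ≡.refl
  ; positive-𝟙⊕𝟙 = ℕ.s≤s ℕ.z≤n
  ; sign?        = sign?
  }
  where
  sign? : ∀ ((m , n) : ℕ × ℕ) → n ℕ.< m ⊎ m ≡ n ⊎ m ℕ.< n
  sign? (m , n) with ℕ.<-cmp m n
  ... | tri< m<n _ _ = inj₂ (inj₂ m<n)
  ... | tri≈ _ m≡n _ = inj₂ (inj₁ m≡n)
  ... | tri> _ _ n<m = inj₁ n<m

module _ (A : AbelianGroup 0ℓ 0ℓ) where
  open AbelianGroup A
  open AbelianGroupProperties A
  open Mult commutativeMonoid renaming (_×_ to _×ᴹ_)
  open CommutativeSemigroupProperties commutativeSemigroup using (interchange)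
  open SetoidReasoning setoid

  ×-⁻¹ : ∀ n x → n ×ᴹ (x ⁻¹) ≈ (n ×ᴹ x) ⁻¹
  ×-⁻¹ zero    x = sym ε⁻¹≈ε
  ×-⁻¹ (suc n) x = trans (∙-congˡ (×-⁻¹ n x)) (⁻¹-∙-comm x (n ×ᴹ x))

  ×-distrib-- : ∀ n x y → n ×ᴹ (x - y) ≈ n ×ᴹ x - n ×ᴹ y
  ×-distrib-- n x y = trans (×-distrib-+ x (y ⁻¹) n) (∙-congˡ (×-⁻¹ n y))

  private
    -‿cong : ∀ {x x′ y y′} → x ≈ x′ → y ≈ y′ → x - y ≈ x′ - y′
    -‿cong p q = ∙-cong p (⁻¹-cong q)

    -‿interchange : ∀ a b c d → (a ∙ b) - (c ∙ d) ≈ (a - c) ∙ (b - d)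
    -‿interchange a b c d = trans (∙-congˡ (sym (⁻¹-∙-comm c d))) (interchange a b (c ⁻¹) (d ⁻¹))

    action : ℕ × ℕ → Carrier → Carrier
    action (m , n) x = m ×ᴹ x - n ×ᴹ x

    action-assoc : ∀ k l x → action (Coefficients._⊗_ integers k l) x ≈ action k (action l x)
    action-assoc (m , n) (m′ , n′) x = begin
      (m ℕ.* m′ ℕ.+ n ℕ.* n′) ×ᴹ x - (m ℕ.* n′ ℕ.+ n ℕ.* m′) ×ᴹ x
        ≈⟨ -‿cong (×-homo-+ x (m ℕ.* m′) (n ℕ.* n′)) (×-homo-+ x (m ℕ.* n′) (n ℕ.* m′)) ⟩
      ((m ℕ.* m′) ×ᴹ x ∙ (n ℕ.* n′) ×ᴹ x) - ((m ℕ.* n′) ×ᴹ x ∙ (n ℕ.* m′) ×ᴹ x)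
        ≈⟨ -‿cong (∙-cong (×-assocˡ x m m′) (×-assocˡ x n n′)) (∙-cong (×-assocˡ x m n′) (×-assocˡ x n m′)) ⟨
      (m ×ᴹ m′ ×ᴹ x ∙ n ×ᴹ n′ ×ᴹ x) - (m ×ᴹ n′ ×ᴹ x ∙ n ×ᴹ m′ ×ᴹ x)
        ≈⟨ -‿interchange _ _ _ _ ⟩
      (m ×ᴹ m′ ×ᴹ x - m ×ᴹ n′ ×ᴹ x) ∙ (n ×ᴹ n′ ×ᴹ x - n ×ᴹ m′ ×ᴹ x)
        ≈⟨ ∙-cong (×-distrib-- m _ _) (⁻¹-anti-homo‿- _ _) ⟨
      m ×ᴹ (m′ ×ᴹ x - n′ ×ᴹ x) ∙ (n ×ᴹ m′ ×ᴹ x - n ×ᴹ n′ ×ᴹ x) ⁻¹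
        ≈⟨ ∙-congˡ (⁻¹-cong (×-distrib-- n _ _)) ⟨
      m ×ᴹ (m′ ×ᴹ x - n′ ×ᴹ x) - n ×ᴹ (m′ ×ᴹ x - n′ ×ᴹ x) ∎

    ⊗-comm : ∀ k l → Coefficients._⊗_ integers k l ≡ Coefficients._⊗_ integers l k
    ⊗-comm (m , n) (m′ , n′) = ≡.cong₂ _,_
      (≡.cong₂ ℕ._+_ (ℕ.*-comm m m′) (ℕ.*-comm n n′))
      (≡.trans (ℕ.+-comm (m ℕ.* n′) (n ℕ.* m′)) (≡.cong₂ ℕ._+_ (ℕ.*-comm n m′) (ℕ.*-comm m n′)))

  integerAction : Action integers A
  integerAction = record
    { _·_        = action
    ; ·-congˡ    = λ {(m , n)} x≈y → -‿cong (×-congʳ m x≈y) (×-congʳ n x≈y)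
    ; ·-distribˡ = λ (m , n) x y →
        trans (-‿cong (×-distrib-+ x y m) (×-distrib-+ x y n)) (-‿interchange _ _ _ _)
    ; ·-distribʳ = λ (m , n) (m′ , n′) x →
        trans (-‿cong (×-homo-+ x m m′) (×-homo-+ x n n′)) (-‿interchange _ _ _ _)
    ; ·-assoc    = action-assoc
    ; ·-comm     = λ k l x → begin
        action k (action l x)                      ≈⟨ action-assoc k l x ⟨
        action (Coefficients._⊗_ integers k l) x   ≡⟨ ≡.cong (λ m → action m x) (⊗-comm k l) ⟩
        action (Coefficients._⊗_ integers l k) x   ≈⟨ action-assoc l k x ⟩
        action l (action k x)                      ∎
    ; ⊖-·        = λ (m , n) x → sym (⁻¹-anti-homo‿- (m ×ᴹ x) (n ×ᴹ x))
    ; 𝟙-·        = λ x → trans (∙-cong (identityʳ x) ε⁻¹≈ε) (identityʳ x)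
    ; null-·     = λ { {m , n} ≡.refl x → inverseʳ (m ×ᴹ x) }
    }

  -- Reduces positivity and divisibility for pairs to those for positive natural multiples.
  action-positive : ∀ {m n} → n ℕ.< m → ∀ x → action (m , n) x ≈ (m ℕ.∸ n) ×ᴹ x
  action-positive {m} {n} n<m x = begin
    m ×ᴹ x - n ×ᴹ x                          ≡⟨ ≡.cong (λ k → k ×ᴹ x - n ×ᴹ x) (ℕ.m∸n+n≡m (ℕ.<⇒≤ n<m)) ⟨
    (m ℕ.∸ n ℕ.+ n) ×ᴹ x - n ×ᴹ x            ≈⟨ ∙-congʳ (×-homo-+ x (m ℕ.∸ n) n) ⟩
    ((m ℕ.∸ n) ×ᴹ x ∙ n ×ᴹ x) - n ×ᴹ x       ≈⟨ //-rightDividesʳ (n ×ᴹ x) ((m ℕ.∸ n) ×ᴹ x) ⟩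
    (m ℕ.∸ n) ×ᴹ x                           ∎

module GroupHomomorphism
  (A B : AbelianGroup 0ℓ 0ℓ)
  (e : AbelianGroup.Carrier A → AbelianGroup.Carrier B)
  (e-cong : ∀ {x y} → AbelianGroup._≈_ A x y → AbelianGroup._≈_ B (e x) (e y))
  (e-∙ : ∀ x y → AbelianGroup._≈_ B (e (AbelianGroup._∙_ A x y)) (AbelianGroup._∙_ B (e x) (e y)))
  where
  private
    module A where
      open AbelianGroup A public
      open Mult commutativeMonoid public renaming (_×_ to _×ᴹ_)
      open Action (integerAction A) public
    module B where
      open AbelianGroup B public
      open AbelianGroupProperties B public
      open Mult commutativeMonoid public renaming (_×_ to _×ᴹ_)
      open Action (integerAction B) public

  e-ε : e A.ε B.≈ B.ε
  e-ε = B.identityˡ-unique _ _ (B.trans (B.sym (e-∙ _ _)) (e-cong (A.identityˡ A.ε)))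

  e-⁻¹ : ∀ x → e (x A.⁻¹) B.≈ e x B.⁻¹
  e-⁻¹ x = B.inverseˡ-unique _ _ (B.trans (B.sym (e-∙ _ _)) (B.trans (e-cong (A.inverseˡ x)) e-ε))

  e-× : ∀ n x → e (n A.×ᴹ x) B.≈ n B.×ᴹ e x
  e-× zero    x = e-ε
  e-× (suc n) x = B.trans (e-∙ _ _) (B.∙-congˡ (e-× n x))

  e-· : ∀ k x → e (k A.· x) B.≈ k B.· e x
  e-· (m , n) x = B.trans (e-∙ _ _) (B.∙-cong (e-× m x) (B.trans (e-⁻¹ _) (B.⁻¹-cong (e-× n x))))

-- A solver for identities in abelian groups

Expr : ℕ → Set
Expr = Form (ℕ × ℕ) ⊥

sameCoefficient : ℕ × ℕ → ℕ × ℕ → Bool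
sameCoefficient (m , n) (m′ , n′) = (m ℕ.+ n′) ℕ.≡ᵇ (m′ ℕ.+ n)

sameForm : ∀ {n} → Expr n → Expr n → Bool
-- A form without variables and without constants is zero, so nothing is left to compare.
sameForm {zero}  s t = true
sameForm {suc n} s t = sameCoefficient (lead integers s) (lead integers t)
                     ∧ sameForm (rest integers s) (rest integers t)

pattern v₀ = arg zero
pattern v₁ = arg (suc zero)
pattern v₂ = arg (suc (suc zero))
pattern v₃ = arg (suc (suc (suc zero)))

module AbelianSolver (A : AbelianGroup 0ℓ 0ℓ) where
  open AbelianGroup A
  open AbelianGroupProperties A
  open Mult commutativeMonoid renaming (_×_ to _×ᴹ_)
  open Action (integerAction A)
  open SetoidReasoning setoid

  ⟦_⟧ : ∀ {n} → Expr n → Vec Carrier n → Carrier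
  ⟦_⟧ = eval (integerAction A) ⊥-elim

  private
    closed≈ε : (t : Expr 0) → ⟦ t ⟧ [] ≈ ε
    closed≈ε null        = refl
    closed≈ε (s ⊞ t)     = trans (∙-cong (closed≈ε s) (closed≈ε t)) (identityˡ ε)
    closed≈ε (neg t)     = trans (⁻¹-cong (closed≈ε t)) ε⁻¹≈ε
    closed≈ε (scale k t) = trans (·-congˡ {k} (closed≈ε t)) (·-ε k)

    swap : ∀ a b c d → a ∙ d ≈ c ∙ b → a - b ≈ c - d
    swap a b c d eq = x≈z//y (a - b) d c lemma
      where
      lemma : (a - b) ∙ d ≈ c
      lemma = begin
        (a - b) ∙ d       ≈⟨ assoc a (b ⁻¹) d ⟩
        a ∙ (b ⁻¹ ∙ d)    ≈⟨ ∙-congˡ (comm (b ⁻¹) d) ⟩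
        a ∙ (d - b)       ≈⟨ assoc a d (b ⁻¹) ⟨
        (a ∙ d) - b       ≈⟨ ∙-congʳ eq ⟩
        (c ∙ b) - b       ≈⟨ //-rightDividesʳ b c ⟩
        c                 ∎

  same-· : ∀ k l x → T (sameCoefficient k l) → k · x ≈ l · x
  same-· (m , n) (m′ , n′) x same = swap _ _ _ _ (begin
    m ×ᴹ x ∙ n′ ×ᴹ x    ≈⟨ ×-homo-+ x m n′ ⟨
    (m ℕ.+ n′) ×ᴹ x     ≡⟨ ≡.cong (_×ᴹ x) (ℕ.≡ᵇ⇒≡ (m ℕ.+ n′) (m′ ℕ.+ n) same) ⟩
    (m′ ℕ.+ n) ×ᴹ x     ≈⟨ ×-homo-+ x m′ n ⟩
    m′ ×ᴹ x ∙ n ×ᴹ x    ∎)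

  abel : ∀ {n} (ρ : Vec Carrier n) (s t : Expr n) {_ : T (sameForm s t)} → ⟦ s ⟧ ρ ≈ ⟦ t ⟧ ρ
  abel []      s t = trans (closed≈ε s) (sym (closed≈ε t))
  abel (x ∷ ρ) s t {p} = begin
    ⟦ s ⟧ (x ∷ ρ)
      ≈⟨ lead-rest (integerAction A) ⊥-elim s x ρ ⟩
    lead integers s · x ∙ ⟦ rest integers s ⟧ ρ
      ≈⟨ ∙-cong (same-· (lead integers s) (lead integers t) x (proj₁ parts)) (abel ρ _ _ {proj₂ parts}) ⟩
    lead integers t · x ∙ ⟦ rest integers t ⟧ ρ
      ≈⟨ lead-rest (integerAction A) ⊥-elim t x ρ ⟨
    ⟦ t ⟧ (x ∷ ρ) ∎
    where
    parts : T (sameCoefficient (lead integers s) (lead integers t))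
          × T (sameForm (rest integers s) (rest integers t))
    parts = Equivalence.to T-∧ p

-- Ordered groups and modules

data Sign : Set where
  neg zer pos : Sign

-- The order is given by its positive cone. Trichotomy makes order and equality decidable, and
-- `nontrivial` excludes endpoints.
record OrderedGroup : Set₁ where
  field
    abelianGroup : AbelianGroup 0ℓ 0ℓ
  open AbelianGroup abelianGroup public
  field
    Pos        : Carrier → Set
    Pos-resp   : ∀ {x y} → x ≈ y → Pos x → Pos y
    Pos-∙      : ∀ {x y} → Pos x → Pos y → Pos (x ∙ y)
    ¬Pos-ε     : ¬ Pos ε
    pos?       : ∀ x → Pos x ⊎ x ≈ ε ⊎ Pos (x ⁻¹)
    nontrivial : ∃ Pos

  open AbelianGroupProperties abelianGroup public
  open AbelianSolver abelianGroup public using (abel)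

  infix 4 _<_

  _<_ : Carrier → Carrier → Set
  x < y = Pos (y - x)

  <-trans : ∀ {x y z} → x < y → y < z → x < z
  <-trans {x} {y} {z} x<y y<z =
    Pos-resp (abel (x ∷ y ∷ z ∷ []) ((v₁ ⊞ neg v₀) ⊞ (v₂ ⊞ neg v₁)) (v₂ ⊞ neg v₀)) (Pos-∙ x<y y<z)

  <-resp : ∀ {x x′ y y′} → x ≈ x′ → y ≈ y′ → x < y → x′ < y′
  <-resp x≈ y≈ = Pos-resp (∙-cong y≈ (⁻¹-cong x≈))

  ≮-<-trans : ∀ {x y z} → ¬ (y < x) → y < z → x < z
  ≮-<-trans {x} {y} y≮x y<z with pos? (x - y)
  ... | inj₁ y<x        = contradiction y<x y≮x
  ... | inj₂ (inj₁ x≈y) = <-resp (sym (x∙y⁻¹≈ε⇒x≈y x y x≈y)) refl y<z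
  ... | inj₂ (inj₂ x<y) = <-trans (Pos-resp (⁻¹-anti-homo‿- x y) x<y) y<z

  <-≮-trans : ∀ {x y z} → x < y → ¬ (z < y) → x < z
  <-≮-trans {x} {y} {z} x<y z≮y with pos? (y - z)
  ... | inj₁ z<y        = contradiction z<y z≮y
  ... | inj₂ (inj₁ y≈z) = <-resp refl (x∙y⁻¹≈ε⇒x≈y y z y≈z) x<y
  ... | inj₂ (inj₂ y<z) = <-trans x<y (Pos-resp (⁻¹-anti-homo‿- y z) y<z)

  HasSign : Sign → Carrier → Set
  HasSign neg x = Pos (x ⁻¹)
  HasSign zer x = x ≈ ε
  HasSign pos x = Pos x

  sign : ∀ x → ∃ λ σ → HasSign σ x
  sign x with pos? x
  ... | inj₁ p        = pos , p
  ... | inj₂ (inj₁ z) = zer , z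
  ... | inj₂ (inj₂ n) = neg , n

  HasSign-resp : ∀ σ {x y} → x ≈ y → HasSign σ x → HasSign σ y
  HasSign-resp neg eq = Pos-resp (⁻¹-cong eq)
  HasSign-resp zer eq = trans (sym eq)
  HasSign-resp pos eq = Pos-resp eq

  pos≉ε : ∀ {x} → Pos x → ¬ (x ≈ ε)
  pos≉ε p x≈ε = ¬Pos-ε (Pos-resp x≈ε p)

  neg≉ε : ∀ {x} → Pos (x ⁻¹) → ¬ (x ≈ ε)
  neg≉ε n x≈ε = ¬Pos-ε (Pos-resp (trans (⁻¹-cong x≈ε) ε⁻¹≈ε) n)

  Pos-asym : ∀ {x} → Pos x → ¬ Pos (x ⁻¹)
  Pos-asym {x} p n = ¬Pos-ε (Pos-resp (inverseʳ x) (Pos-∙ p n))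

  HasSign-unique : ∀ σ τ {x} → HasSign σ x → HasSign τ x → σ ≡ τ
  HasSign-unique neg neg p q = ≡.refl
  HasSign-unique neg zer p q = contradiction q (neg≉ε p)
  HasSign-unique neg pos p q = contradiction p (Pos-asym q)
  HasSign-unique zer neg p q = contradiction p (neg≉ε q)
  HasSign-unique zer zer p q = ≡.refl
  HasSign-unique zer pos p q = contradiction p (pos≉ε q)
  HasSign-unique pos neg p q = contradiction q (Pos-asym p)
  HasSign-unique pos zer p q = contradiction q (pos≉ε p)
  HasSign-unique pos pos p q = ≡.refl

  Pos-dec : ∀ x → Dec (Pos x)
  Pos-dec x with pos? x
  ... | inj₁ p        = yes p
  ... | inj₂ (inj₁ z) = no λ p → pos≉ε p z
  ... | inj₂ (inj₂ n) = no λ p → Pos-asym p n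

  ≈ε-dec : ∀ x → Dec (x ≈ ε)
  ≈ε-dec x with pos? x
  ... | inj₁ p        = no (pos≉ε p)
  ... | inj₂ (inj₁ z) = yes z
  ... | inj₂ (inj₂ n) = no (neg≉ε n)

record OrderedAction (R : Coefficients) (G : OrderedGroup) : Set₁ where
  open Coefficients R
  open OrderedGroup G
  field
    action    : Action R abelianGroup
  open Action action public
  field
    ·-Pos     : ∀ {k x} → Positive k → Pos x → Pos (k · x)
    divisible : ∀ {k} → Positive k → ∀ x → ∃ λ y → k · y ≈ x

  HasSign-· : ∀ {k} → Positive k → ∀ σ {x} → HasSign σ x → HasSign σ (k · x)
  HasSign-· {k} k>0 neg {x} p = Pos-resp (·-⁻¹ k x) (·-Pos k>0 p)
  HasSign-· {k} k>0 zer     p = trans (·-congˡ p) (·-ε k)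
  HasSign-· {k} k>0 pos     p = ·-Pos k>0 p

  HasSign-·⁻¹ : ∀ {k} → Positive k → ∀ σ {x} → HasSign σ (k · x) → HasSign σ x
  HasSign-·⁻¹ k>0 σ {x} p with sign x
  ... | τ , q with HasSign-unique σ τ p (HasSign-· k>0 τ q)
  ... | ≡.refl = q

  ·-distrib-- : ∀ k x y → k · (x - y) ≈ k · x - k · y
  ·-distrib-- k x y = trans (·-distribˡ k x (y ⁻¹)) (∙-congˡ (·-⁻¹ k y))

  -- The witness is the midpoint, the solution z of 2 z = x + y; this is why `Coefficients` asks for
  -- a positive 𝟙 ⊕ 𝟙.
  dense : ∀ {x y} → x < y → ∃ λ z → x < z × z < y
  dense {x} {y} x<y with divisible positive-𝟙⊕𝟙 (x ∙ y)
  ... | z , 2z≈x∙y = z , half lower x<y , half upper x<y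
    where
    half : ∀ {a} → (𝟙 ⊕ 𝟙) · a ≈ y - x → x < y → Pos a
    half eq p = HasSign-·⁻¹ positive-𝟙⊕𝟙 pos (Pos-resp (sym eq) p)

    twice : ∀ a → (𝟙 ⊕ 𝟙) · a ≈ a ∙ a
    twice a = trans (·-distribʳ 𝟙 𝟙 a) (∙-cong (𝟙-· a) (𝟙-· a))

    lower : (𝟙 ⊕ 𝟙) · (z - x) ≈ y - x
    lower = trans (·-distrib-- _ z x) (trans (∙-cong 2z≈x∙y (⁻¹-cong (twice x)))
      (abel (x ∷ y ∷ []) ((v₀ ⊞ v₁) ⊞ neg (v₀ ⊞ v₀)) (v₁ ⊞ neg v₀)))

    upper : (𝟙 ⊕ 𝟙) · (y - z) ≈ y - x
    upper = trans (·-distrib-- _ y z) (trans (∙-cong (twice y) (⁻¹-cong 2z≈x∙y))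
      (abel (x ∷ y ∷ []) ((v₁ ⊞ v₁) ⊞ neg (v₀ ⊞ v₁)) (v₁ ⊞ neg v₀)))

  above : ∀ x → ∃ λ z → x < z
  above x = let g , g>0 = nontrivial in
    x ∙ g , Pos-resp (abel (x ∷ g ∷ []) v₁ ((v₀ ⊞ v₁) ⊞ neg v₀)) g>0

  below : ∀ x → ∃ λ z → z < x
  below x = let g , g>0 = nontrivial in
    x - g , Pos-resp (abel (x ∷ g ∷ []) v₁ (v₀ ⊞ neg (v₀ ⊞ neg v₁))) g>0

  module _ {I : Set} (b : I → Carrier) where

    belowAll : ∀ us → ∃ λ z → ∀ {u} → u ∈ˡ us → z < b u
    belowAll []       = ε , λ ()
    belowAll (u ∷ us) with belowAll us
    ... | z , z< with Pos-dec (b u - z)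
    ...   | yes z<u = z , λ { (here ≡.refl) → z<u ; (there i) → z< i }
    ...   | no  z≮u with below (b u)
    ...     | w , w<u = w , λ { (here ≡.refl) → w<u ; (there i) → <-trans w<u (≮-<-trans z≮u (z< i)) }

    betweenAll : ∀ x us → (∀ {u} → u ∈ˡ us → x < b u) →
                 ∃ λ z → x < z × (∀ {u} → u ∈ˡ us → z < b u)
    betweenAll x []       x< = let z , x<z = above x in z , x<z , λ ()
    betweenAll x (u ∷ us) x< with betweenAll x us (λ i → x< (there i))
    ... | z , x<z , z< with Pos-dec (b u - z)
    ...   | yes z<u = z , x<z , λ { (here ≡.refl) → z<u ; (there i) → z< i }
    ...   | no  z≮u with dense (x< (here ≡.refl))
    ...     | w , x<w , w<u = w , x<w , λ { (here ≡.refl) → w<u ; (there i) → <-trans w<u (≮-<-trans z≮u (z< i)) }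

    -- The lower bounds are met one at a time. A point z that fails to exceed b l is replaced by
    -- some w between b l and all upper bounds; the earlier lower bounds stay below w because they
    -- were below z, which is at most b l.
    separate : ∀ ls us → (∀ {l u} → l ∈ˡ ls → u ∈ˡ us → b l < b u) →
               ∃ λ z → (∀ {l} → l ∈ˡ ls → b l < z) × (∀ {u} → u ∈ˡ us → z < b u)
    separate []       us l<u = let z , z< = belowAll us in z , (λ ()) , z<
    separate (l ∷ ls) us l<u with separate ls us (λ i → l<u (there i))
    ... | z , <z , z< with Pos-dec (z - b l)
    ...   | yes l<z = z , (λ { (here ≡.refl) → l<z ; (there i) → <z i }) , z<
    ...   | no  l≮z with betweenAll (b l) us (l<u (here ≡.refl))
    ...     | w , l<w , w< = w , (λ { (here ≡.refl) → l<w ; (there i) → <-trans (<-≮-trans (<z i) l≮z) l<w }) , w<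

-- By divisibility each form k x + ℓ has a threshold where it vanishes, and a
-- point is moved to the other module by choosing it in the same position
-- relative to the thresholds there.
module Extension {R : Coefficients} {G H : OrderedGroup}
                 (R-G : OrderedAction R G) (R-H : OrderedAction R H) where
  open Coefficients R
  private
    module G where
      open OrderedGroup G public
      open OrderedAction R-G public
    module H where
      open OrderedGroup H public
      open OrderedAction R-H public

  SameSign : G.Carrier → H.Carrier → Set
  SameSign x y = ∃ λ σ → G.HasSign σ x × H.HasSign σ y

  SameSign-resp : ∀ {x x′ y y′} → x G.≈ x′ → y H.≈ y′ → SameSign x y → SameSign x′ y′
  SameSign-resp x≈ y≈ (σ , p , q) = σ , G.HasSign-resp σ x≈ p , H.HasSign-resp σ y≈ q

  SameSign-· : ∀ {k x y} → Positive k → SameSign x y → SameSign (k G.· x) (k H.· y)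
  SameSign-· k>0 (σ , p , q) = σ , G.HasSign-· k>0 σ p , H.HasSign-· k>0 σ q

  SameSign-·⁻¹ : ∀ {k x y} → Positive k → SameSign (k G.· x) (k H.· y) → SameSign x y
  SameSign-·⁻¹ k>0 (σ , p , q) = σ , G.HasSign-·⁻¹ k>0 σ p , H.HasSign-·⁻¹ k>0 σ q

  SameSign-⁻¹ : ∀ {x y} → SameSign x y → SameSign (x G.⁻¹) (y H.⁻¹)
  SameSign-⁻¹ (neg , p , q) = pos , p , q
  SameSign-⁻¹ (zer , p , q) = zer , G.trans (G.⁻¹-cong p) G.ε⁻¹≈ε , H.trans (H.⁻¹-cong q) H.ε⁻¹≈ε
  SameSign-⁻¹ {x} {y} (pos , p , q) =
    neg , G.Pos-resp (G.sym (G.⁻¹-involutive x)) p , H.Pos-resp (H.sym (H.⁻¹-involutive y)) q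

  SameSign-Pos : ∀ {x y} → SameSign x y → G.Pos x → H.Pos y
  SameSign-Pos (σ , p , q) x>0 with G.HasSign-unique σ pos p x>0
  ... | ≡.refl = q

  -- If x equals some a i, the answer is b i. Otherwise x cuts the a i into those below and those
  -- above, and the hypothesis says that the corresponding b i are separated in the same way, so a
  -- point fits into the gap.
  extendOrder : ∀ {I : Set} (a : I → G.Carrier) (b : I → H.Carrier) (ps : List I) →
                (∀ {i j} → i ∈ˡ ps → j ∈ˡ ps → SameSign (a i G.- a j) (b i H.- b j)) →
                ∀ x → ∃ λ y → ∀ {i} → i ∈ˡ ps → SameSign (x G.- a i) (y H.- b i)
  extendOrder a b ps same x with List.filter (λ i → G.≈ε-dec (x G.- a i)) ps in eq
  ... | i ∷ _ = b i , λ j∈ → SameSign-resp (G.∙-congʳ (G.sym x≈ai)) H.refl (same (proj₁ i∈) j∈)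
    where
    i∈ = ∈-filter⁻ (λ i → G.≈ε-dec (x G.- a i)) (≡.subst (i ∈ˡ_) (≡.sym eq) (here ≡.refl))
    x≈ai = G.x∙y⁻¹≈ε⇒x≈y x (a i) (proj₂ i∈)
  ... | [] = y , λ i∈ → position i∈ (G.pos? _)
    where
    lower? = λ i → G.Pos-dec (x G.- a i)
    upper? = λ i → G.Pos-dec (a i G.- x)
    gap = H.separate b (filter lower? ps) (filter upper? ps) λ i∈ j∈ →
      let i∈ps , ai<x = ∈-filter⁻ lower? i∈
          j∈ps , x<aj = ∈-filter⁻ upper? j∈
      in SameSign-Pos (same j∈ps i∈ps) (G.<-trans ai<x x<aj)
    y = proj₁ gap

    position : ∀ {i} → i ∈ˡ ps → G.Pos (x G.- a i) ⊎ x G.- a i G.≈ G.ε ⊎ G.Pos ((x G.- a i) G.⁻¹) →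
               SameSign (x G.- a i) (y H.- b i)
    position i∈ (inj₁ p) = pos , p , proj₁ (proj₂ gap) (∈-filter⁺ lower? i∈ p)
    position {i} i∈ (inj₂ (inj₂ n)) =
      neg , n , H.Pos-resp (H.sym (H.⁻¹-anti-homo‿- y (b i)))
        (proj₂ (proj₂ gap) (∈-filter⁺ upper? i∈ (G.Pos-resp (G.⁻¹-anti-homo‿- x (a i)) n)))
    position {i} i∈ (inj₂ (inj₁ z))
      with () ← ≡.subst (i ∈ˡ_) eq (∈-filter⁺ (λ i → G.≈ε-dec (x G.- a i)) i∈ z)

-- Eliminating a variable from finitely many linear forms

module Thresholds (R : Coefficients) {C : Set} where
  open Coefficients R

  private
    F : ℕ → Set
    F = Form K C

  -- The solution of k x + ℓ = 0, kept as the pair of k and ℓ.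
  Threshold : ℕ → Set
  Threshold n = Σ K Positive × F n

  thresholds : ∀ {n} → F (suc n) → List (Threshold n)
  thresholds t with sign? (lead R t)
  ... | inj₁ k>0        = ((lead R t , k>0) , rest R t) ∷ []
  ... | inj₂ (inj₁ _)   = []
  ... | inj₂ (inj₂ k<0) = ((⊖ lead R t , k<0) , neg (rest R t)) ∷ []

  -- Its sign is that of the difference of the two thresholds.
  cross : ∀ {n} → Threshold n → Threshold n → F n
  cross ((k , _) , s) ((l , _) , t) = scale k t ⊞ neg (scale l s)

  -- The cross forms decide the order of the thresholds, hence the positions that are open to the
  -- eliminated variable; the remainders settle the forms whose leading coefficient vanishes.
  eliminate : ∀ {n} → List (F (suc n)) → List (F n)
  eliminate Λ = List.map (rest R) Λ ++ cartesianProductWith cross (concatMap thresholds Λ) (concatMap thresholds Λ)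

module ThresholdValues {R : Coefficients} {C : Set} {G : OrderedGroup}
                       (R-G : OrderedAction R G) (ι : C → OrderedGroup.Carrier G) where
  open Coefficients R
  open OrderedGroup G
  open OrderedAction R-G
  open Thresholds R {C}
  open SetoidReasoning setoid

  ⟦_⟧ : ∀ {n} → Form K C n → Vec Carrier n → Carrier
  ⟦_⟧ = eval action ι

  value : ∀ {n} → Vec Carrier n → Threshold n → Carrier
  value ρ ((k , k>0) , t) = proj₁ (divisible k>0 (⟦ t ⟧ ρ ⁻¹))

  value-root : ∀ {n} (ρ : Vec Carrier n) (p@((k , _) , t) : Threshold n) → k · value ρ p ≈ ⟦ t ⟧ ρ ⁻¹
  value-root ρ ((k , k>0) , t) = proj₂ (divisible k>0 (⟦ t ⟧ ρ ⁻¹))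

  cross-difference : ∀ {n} (ρ : Vec Carrier n) (p@((k , _) , _) q@((l , _) , _) : Threshold n) →
                     ⟦ cross p q ⟧ ρ ≈ k · l · (value ρ p - value ρ q)
  cross-difference ρ p@((k , _) , s) q@((l , _) , t) = begin
    k · v - l · u                         ≈⟨ abel (k · v ∷ l · u ∷ []) (v₀ ⊞ neg v₁) (neg v₁ ⊞ neg (neg v₀)) ⟩
    (l · u) ⁻¹ - (k · v) ⁻¹               ≈⟨ ∙-cong (·-⁻¹ l u) (⁻¹-cong (·-⁻¹ k v)) ⟨
    l · (u ⁻¹) - k · (v ⁻¹)               ≈⟨ ∙-cong (·-congˡ (value-root ρ p)) (⁻¹-cong (·-congˡ (value-root ρ q))) ⟨
    l · k · value ρ p - k · l · value ρ q ≈⟨ ∙-congʳ (·-comm l k (value ρ p)) ⟩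
    k · l · value ρ p - k · l · value ρ q ≈⟨ ·-distrib-- k _ _ ⟨
    k · (l · value ρ p - l · value ρ q)   ≈⟨ ·-congˡ (·-distrib-- l _ _) ⟨
    k · l · (value ρ p - value ρ q)       ∎
    where
    u = ⟦ s ⟧ ρ
    v = ⟦ t ⟧ ρ

  positive-lead : ∀ {n} (t : Form K C (suc n)) (k>0 : Positive (lead R t)) x ρ →
                  ⟦ t ⟧ (x ∷ ρ) ≈ lead R t · (x - value ρ ((lead R t , k>0) , rest R t))
  positive-lead t k>0 x ρ = begin
    ⟦ t ⟧ (x ∷ ρ)                               ≈⟨ lead-rest action ι t x ρ ⟩
    lead R t · x ∙ ⟦ rest R t ⟧ ρ               ≈⟨ ∙-congˡ (⁻¹-involutive _) ⟨
    lead R t · x - ⟦ rest R t ⟧ ρ ⁻¹            ≈⟨ ∙-congˡ (⁻¹-cong (value-root ρ p)) ⟨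
    lead R t · x - lead R t · value ρ p         ≈⟨ ·-distrib-- (lead R t) x (value ρ p) ⟨
    lead R t · (x - value ρ p)                  ∎
    where p = (lead R t , k>0) , rest R t

  negative-lead : ∀ {n} (t : Form K C (suc n)) (k<0 : Positive (⊖ lead R t)) x ρ →
                  ⟦ t ⟧ (x ∷ ρ) ≈ ((⊖ lead R t) · (x - value ρ ((⊖ lead R t , k<0) , neg (rest R t)))) ⁻¹
  negative-lead t k<0 x ρ = begin
    ⟦ t ⟧ (x ∷ ρ)                                       ≈⟨ lead-rest action ι t x ρ ⟩
    lead R t · x ∙ ⟦ rest R t ⟧ ρ                       ≈⟨ abel (lead R t · x ∷ ⟦ rest R t ⟧ ρ ∷ []) (v₀ ⊞ v₁)
                                                             (neg (neg v₀ ⊞ neg (neg (neg v₁)))) ⟩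
    ((lead R t · x) ⁻¹ - (⟦ rest R t ⟧ ρ ⁻¹) ⁻¹) ⁻¹     ≈⟨ ⁻¹-cong (∙-cong (⊖-· (lead R t) x) (⁻¹-cong (value-root ρ p))) ⟨
    ((⊖ lead R t) · x - (⊖ lead R t) · value ρ p) ⁻¹    ≈⟨ ⁻¹-cong (·-distrib-- (⊖ lead R t) x (value ρ p)) ⟨
    ((⊖ lead R t) · (x - value ρ p)) ⁻¹                 ∎
    where p = (⊖ lead R t , k<0) , neg (rest R t)

  null-lead : ∀ {n} (t : Form K C (suc n)) → Null (lead R t) → ∀ x ρ → ⟦ t ⟧ (x ∷ ρ) ≈ ⟦ rest R t ⟧ ρ
  null-lead t k≡0 x ρ =
    trans (lead-rest action ι t x ρ) (trans (∙-congʳ (null-· k≡0 x)) (identityˡ _))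

module Elimination {R : Coefficients} {C : Set} {G H : OrderedGroup}
                   (R-G : OrderedAction R G) (R-H : OrderedAction R H)
                   (ι : C → OrderedGroup.Carrier G) (κ : C → OrderedGroup.Carrier H) where
  open Coefficients R
  open Extension R-G R-H
  open Thresholds R {C}
  private
    module G where
      open OrderedGroup G public
      open ThresholdValues R-G ι public
    module H where
      open OrderedGroup H public
      open ThresholdValues R-H κ public

  Agree : ∀ {n} → List (Form K C n) → Vec G.Carrier n → Vec H.Carrier n → Set
  Agree Λ ρ ρ′ = ∀ {t} → t ∈ˡ Λ → SameSign (G.⟦ t ⟧ ρ) (H.⟦ t ⟧ ρ′)

  -- One round of back-and-forth. Agreement on the cross forms puts the thresholds of both sides in
  -- the same order, so x has a counterpart y in the same position. Each form of Λ is then plus or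
  -- minus a positive multiple of the variable minus its threshold, or else equal to its remainder.
  extend : ∀ {n} (Λ : List (Form K C (suc n))) {ρ ρ′} → Agree (eliminate Λ) ρ ρ′ →
           ∀ x → ∃ λ y → Agree Λ (x ∷ ρ) (y ∷ ρ′)
  extend Λ {ρ} {ρ′} agree x =
    let y , position = extendOrder (G.value ρ) (H.value ρ′) ps consistent x
    in y , λ {t} t∈ → sameSign y t (agree (∈-++⁺ˡ (∈-map⁺ (rest R) t∈)))
                         (λ p∈ → position (∈-concatMap⁺ thresholds (Any.map (λ { ≡.refl → p∈ }) t∈)))
    where
    ps = concatMap thresholds Λ

    consistent : ∀ {p q} → p ∈ˡ ps → q ∈ˡ ps →
                 SameSign (G.value ρ p G.- G.value ρ q) (H.value ρ′ p H.- H.value ρ′ q)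
    consistent {p@((_ , k>0) , _)} {q@((_ , l>0) , _)} p∈ q∈ =
      SameSign-·⁻¹ l>0 (SameSign-·⁻¹ k>0
        (SameSign-resp (G.cross-difference ρ p q) (H.cross-difference ρ′ p q)
          (agree (∈-++⁺ʳ _ (∈-cartesianProductWith⁺ cross p∈ q∈)))))

    sameSign : ∀ y t → SameSign (G.⟦ rest R t ⟧ ρ) (H.⟦ rest R t ⟧ ρ′) →
               (∀ {p} → p ∈ˡ thresholds t → SameSign (x G.- G.value ρ p) (y H.- H.value ρ′ p)) →
               SameSign (G.⟦ t ⟧ (x ∷ ρ)) (H.⟦ t ⟧ (y ∷ ρ′))
    sameSign y t same position with sign? (lead R t)
    ... | inj₁ k>0        = SameSign-resp (G.sym (G.positive-lead t k>0 x ρ)) (H.sym (H.positive-lead t k>0 y ρ′))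
                              (SameSign-· k>0 (position (here ≡.refl)))
    ... | inj₂ (inj₁ k≡0) = SameSign-resp (G.sym (G.null-lead t k≡0 x ρ)) (H.sym (H.null-lead t k≡0 y ρ′)) same
    ... | inj₂ (inj₂ k<0) = SameSign-resp (G.sym (G.negative-lead t k<0 x ρ)) (H.sym (H.negative-lead t k<0 y ρ′))
                              (SameSign-⁻¹ (SameSign-· k<0 (position (here ≡.refl))))

-- Transfer of formulas between two structures

-- A structure is coordinatised by X × G when each operation acts on the
-- X-part by a table and on the G-part by a linear form, and the atomic
-- formulas only depend on the X-parts and on the order of the G-parts.
record Scheme {ℝ : CompleteOrderedField} (F : Subfield ℝ) : Set₁ where
  field
    Fn    : ℕ → Set
    R     : Coefficients
    C X   : Set
    opX   : ∀ {k} → Fn k → Vec X k → X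
    opG   : ∀ {k n} → Fn k → Vec (Form (Coefficients.K R) C n) k → Form (Coefficients.K R) C n
    EQ LT : X → X → Sign → Set

  open Coefficients R public

  sig : Signature
  sig = record { Func = Fn ; Pr = Order F }

  mutual
    form : ∀ {n} → Term sig n → Form K C n
    form (var i)   = arg i
    form (fn f ts) = opG f (forms ts)

    forms : ∀ {n k} → Vec (Term sig n) k → Vec (Form K C n) k
    forms []       = []
    forms (t ∷ ts) = form t ∷ forms ts

  mutual
    discrete : ∀ {n} → Vec X n → Term sig n → X
    discrete xs (var i)   = Vec.lookup xs i
    discrete xs (fn f ts) = opX f (discretes xs ts)

    discretes : ∀ {n k} → Vec X n → Vec (Term sig n) k → Vec X k
    discretes xs []       = []
    discretes xs (t ∷ ts) = discrete xs t ∷ discretes xs ts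

  -- Quantifier elimination without an equivalent quantifier-free formula: together with the
  -- X-parts, the signs of these forms decide φ, and that is all that the transfer needs.
  tests : ∀ {n} → Formula sig n → List (Form K C n)
  tests ⊥̇                         = []
  tests (s ≐ t)                   = form s ⊞ neg (form t) ∷ []
  tests (pr less (s ∷ t ∷ []))    = form s ⊞ neg (form t) ∷ []
  tests (φ ⇒ ψ)                   = tests φ ++ tests ψ
  tests (all̇ φ)                   = Thresholds.eliminate R (tests φ)

-- `point` may fail to be injective: `EQ` says when two coordinates name one element. This leaves
-- room for a zero whose G-part is arbitrary.
record Coordinates {ℝ : CompleteOrderedField} {F : Subfield ℝ} (𝒮 : Scheme F)
                   (M : Structure (Scheme.sig 𝒮)) : Set₁ where
  open Scheme 𝒮
  open Structure M using (⟦_⟧ᶠ; ⟦_⟧ᵖ; _≈_; Carrier)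
  field
    {G}     : OrderedGroup
    ordered : OrderedAction R G
    ι       : C → OrderedGroup.Carrier G

  module G = OrderedGroup G
  open G using (HasSign; _-_)
  open ThresholdValues ordered ι using (⟦_⟧)

  field
    point      : X → G.Carrier → Carrier
    surjective : ∀ d → ∃ λ x → ∃ λ g → point x g ≈ d
    hom        : ∀ {k n} (f : Fn k) (xs : Vec X k) (ts : Vec (Form K C n) k) ρ →
                 ⟦ f ⟧ᶠ (Vec.zipWith point xs (Vec.map (λ t → ⟦ t ⟧ ρ) ts)) ≈ point (opX f xs) (⟦ opG f ts ⟧ ρ)
    EQ⁺        : ∀ {x y g h σ} → HasSign σ (g - h) → point x g ≈ point y h → EQ x y σ
    EQ⁻        : ∀ {x y g h σ} → HasSign σ (g - h) → EQ x y σ → point x g ≈ point y h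
    LT⁺        : ∀ {x y g h σ} → HasSign σ (g - h) → ⟦ less ⟧ᵖ (point x g ∷ point y h ∷ []) → LT x y σ
    LT⁻        : ∀ {x y g h σ} → HasSign σ (g - h) → LT x y σ → ⟦ less ⟧ᵖ (point x g ∷ point y h ∷ [])

  private
    module M where
      open Structure M public
      open Setoid domain public using (refl; sym; trans)

  record Represents {n} (xs : Vec X n) (gs : Vec G.Carrier n) (ρ : Vec Carrier n) : Set where
    constructor pointwise
    field at : ∀ i → point (Vec.lookup xs i) (Vec.lookup gs i) ≈ Vec.lookup ρ i

  extendRepresents : ∀ {n} {xs : Vec X n} {gs ρ} x g {d} → point x g ≈ d →
                     Represents xs gs ρ → Represents (x ∷ xs) (g ∷ gs) (d ∷ ρ)
  extendRepresents x g eq rep = pointwise λ { zero → eq ; (suc i) → Represents.at rep i }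

  module _ {n} {xs : Vec X n} {gs ρ} (rep : Represents xs gs ρ) where
    mutual
      represents : ∀ t → point (discrete xs t) (⟦ form t ⟧ gs) ≈ evalTerm M ρ t
      represents (var i)   = Represents.at rep i
      represents (fn f ts) =
        M.trans (M.sym (hom f (discretes xs ts) (forms ts) gs)) (M.ᶠ-cong f (representss ts))

      representss : ∀ {k} (ts : Vec (Term sig n) k) →
                    Pointwise _≈_ (Vec.zipWith point (discretes xs ts) (Vec.map (λ t → ⟦ t ⟧ gs) (forms ts)))
                                  (evalTerms M ρ ts)
      representss []       = []
      representss (t ∷ ts) = represents t ∷ representss ts

    ≐-test : ∀ {σ} s t → HasSign σ (⟦ form s ⊞ neg (form t) ⟧ gs) →
             (Satisfies M ρ (s ≐ t) → EQ (discrete xs s) (discrete xs t) σ)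
           × (EQ (discrete xs s) (discrete xs t) σ → Satisfies M ρ (s ≐ t))
    ≐-test s t h =
      (λ eq → EQ⁺ h (trans (represents s) (trans eq (sym (represents t))))) ,
      (λ E → trans (sym (represents s)) (trans (EQ⁻ h E) (represents t)))
      where open M using (trans; sym)

    less-test : ∀ {σ} s t → HasSign σ (⟦ form s ⊞ neg (form t) ⟧ gs) →
                (Satisfies M ρ (pr less (s ∷ t ∷ [])) → LT (discrete xs s) (discrete xs t) σ)
              × (LT (discrete xs s) (discrete xs t) σ → Satisfies M ρ (pr less (s ∷ t ∷ [])))
    less-test s t h =
      (λ s<t → LT⁺ h (M.ᵖ-resp less (sym (represents s) ∷ sym (represents t) ∷ []) s<t)) ,
      (λ L → M.ᵖ-resp less (represents s ∷ represents t ∷ []) (LT⁻ h L))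
      where open M using (sym)

module Transfer {ℝ : CompleteOrderedField} {F : Subfield ℝ} {𝒮 : Scheme F}
                {M N : Structure (Scheme.sig 𝒮)}
                (𝒜 : Coordinates 𝒮 M) (ℬ : Coordinates 𝒮 N) where
  open Scheme 𝒮
  private
    module M where
      open Structure M public
      open Setoid domain public using (refl)
    module N where
      open Structure N public
      open Setoid domain public using (refl)
    module A = Coordinates 𝒜
    module B = Coordinates ℬ
    module Forth = Elimination A.ordered B.ordered A.ι B.ι
    module Back  = Elimination B.ordered A.ordered B.ι A.ι

  open Extension A.ordered B.ordered using (SameSign)
  open Forth using (Agree)

  flip-agree : ∀ {n} {Λ : List (Form K C n)} {gs hs} → Agree Λ gs hs → Back.Agree Λ hs gs
  flip-agree agree t∈ = let σ , p , q = agree t∈ in σ , q , p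

  unflip-agree : ∀ {n} {Λ : List (Form K C n)} {gs hs} → Back.Agree Λ hs gs → Agree Λ gs hs
  unflip-agree agree t∈ = let σ , p , q = agree t∈ in σ , q , p

  -- Both sides use the same X-parts, and their G-parts agree on all tested signs. At a quantifier
  -- the X-part of the new element is copied and its G-part is answered by `extend`. The two
  -- directions are proved together because implication reverses them.
  transfer : ∀ {n} (φ : Formula sig n) {xs gs hs ρ ρ′} →
             A.Represents xs gs ρ → B.Represents xs hs ρ′ → Agree (tests φ) gs hs →
             (Satisfies M ρ φ → Satisfies N ρ′ φ) × (Satisfies N ρ′ φ → Satisfies M ρ φ)
  transfer ⊥̇ repA repB agree = id , id
  transfer (s ≐ t) repA repB agree =
    let σ , p , q = agree (here ≡.refl)
        toA , fromA = A.≐-test repA {σ} s t p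
        toB , fromB = B.≐-test repB {σ} s t q
    in (λ e → fromB (toA e)) , (λ e → fromA (toB e))
  transfer (pr less (s ∷ t ∷ [])) repA repB agree =
    let σ , p , q = agree (here ≡.refl)
        toA , fromA = A.less-test repA {σ} s t p
        toB , fromB = B.less-test repB {σ} s t q
    in (λ e → fromB (toA e)) , (λ e → fromA (toB e))
  transfer (φ ⇒ ψ) repA repB agree =
    let φ⁺ , φ⁻ = transfer φ repA repB (λ t∈ → agree (∈-++⁺ˡ t∈))
        ψ⁺ , ψ⁻ = transfer ψ repA repB (λ t∈ → agree (∈-++⁺ʳ (tests φ) t∈))
    in (λ h p → ψ⁺ (h (φ⁻ p))) , (λ h p → ψ⁻ (h (φ⁺ p)))
  transfer (all̇ φ) repA repB agree = forth , back
    where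
    forth : _
    forth all d =
      let x , h , eq = B.surjective d
          g , agree′ = Back.extend (tests φ) (flip-agree agree) h
      in proj₁ (transfer φ (A.extendRepresents x g M.refl repA) (B.extendRepresents x h eq repB)
                 (unflip-agree agree′))
               (all (A.point x g))

    back : _
    back all d =
      let x , g , eq = A.surjective d
          h , agree′ = Forth.extend (tests φ) agree g
      in proj₂ (transfer φ (A.extendRepresents x g eq repA) (B.extendRepresents x h N.refl repB) agree′)
               (all (B.point x h))

  module _ (e : A.G.Carrier → B.G.Carrier)
           (e-cong : ∀ {x y} → x A.G.≈ y → e x B.G.≈ e y)
           (e-∙ : ∀ x y → e (x A.G.∙ y) B.G.≈ e x B.G.∙ e y)
           (e-· : ∀ k x → e (OrderedAction._·_ A.ordered k x) B.G.≈ OrderedAction._·_ B.ordered k (e x))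
           (e-ι : ∀ c → e (A.ι c) B.G.≈ B.ι c)
           (e-Pos : ∀ {x} → A.G.Pos x → B.G.Pos (e x)) where

    private
      open GroupHomomorphism A.G.abelianGroup B.G.abelianGroup e e-cong e-∙ using (e-ε; e-⁻¹)

      e-form : (t : Form K C 0) → e (ThresholdValues.⟦_⟧ A.ordered A.ι t []) B.G.≈ ThresholdValues.⟦_⟧ B.ordered B.ι t []
      e-form null        = e-ε
      e-form (constant c)   = e-ι c
      e-form (s ⊞ t)     = B.G.trans (e-∙ _ _) (B.G.∙-cong (e-form s) (e-form t))
      e-form (neg t)     = B.G.trans (e-⁻¹ _) (B.G.⁻¹-cong (e-form t))
      e-form (scale k t) = B.G.trans (e-· k _) (OrderedAction.·-congˡ B.ordered (e-form t))

      e-sign : ∀ σ {x} → A.G.HasSign σ x → B.G.HasSign σ (e x)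
      e-sign neg p = B.G.Pos-resp (e-⁻¹ _) (e-Pos p)
      e-sign zer p = B.G.trans (e-cong p) e-ε
      e-sign pos p = e-Pos p

    -- The forms tested for a sentence are closed, so their values are built from parameters alone;
    -- `e` carries these values from one group to the other and keeps their signs, which starts the
    -- back-and-forth.
    elementary : (φ : Sentence sig) → Satisfies M [] φ → Satisfies N [] φ
    elementary φ = proj₁ (transfer φ {xs = []} {[]} {[]} (A.pointwise λ ()) (B.pointwise λ ()) λ {t} _ →
      let σ , p = A.G.sign _
      in σ , p , B.G.HasSign-resp σ (e-form t) (e-sign σ p))

-- Soundness and reducts

module Soundness {S : Signature} (em : ExcludedMiddle 0ℓ) (M : Structure S) where
  open Structure M
  open Setoid domain using (refl; sym; trans)

  Realises : ∀ {m n} → Substitution {S} m n → Vec Carrier n → Vec Carrier m → Set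
  Realises σ ρ ρ′ = ∀ i → evalTerm M ρ (σ i) ≈ Vec.lookup ρ′ i

  mutual
    substTerm-eval : ∀ {m n} (σ : Substitution m n) {ρ ρ′} → Realises σ ρ ρ′ → ∀ t →
                     evalTerm M ρ (substTerm σ t) ≈ evalTerm M ρ′ t
    substTerm-eval σ σ≈ (var i)   = σ≈ i
    substTerm-eval σ σ≈ (fn f ts) = ᶠ-cong f (substTerms-eval σ σ≈ ts)

    substTerms-eval : ∀ {m n k} (σ : Substitution m n) {ρ ρ′} → Realises σ ρ ρ′ → (ts : Vec (Term S m) k) →
                      Pointwise _≈_ (evalTerms M ρ (substTerms σ ts)) (evalTerms M ρ′ ts)
    substTerms-eval σ σ≈ []       = []
    substTerms-eval σ σ≈ (t ∷ ts) = substTerm-eval σ σ≈ t ∷ substTerms-eval σ σ≈ ts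

  lift-realises : ∀ {m n} (σ : Substitution m n) {ρ ρ′} → Realises σ ρ ρ′ →
                  ∀ x → Realises (lift σ) (x ∷ ρ) (x ∷ ρ′)
  lift-realises σ σ≈ x zero    = refl
  lift-realises σ σ≈ x (suc i) = trans (substTerm-eval (var ∘ suc) (λ _ → refl) (σ i)) (σ≈ i)

  substFormula-satisfies : ∀ {m n} (σ : Substitution m n) {ρ ρ′} → Realises σ ρ ρ′ → ∀ φ →
    (Satisfies M ρ (substFormula σ φ) → Satisfies M ρ′ φ) × (Satisfies M ρ′ φ → Satisfies M ρ (substFormula σ φ))
  substFormula-satisfies σ σ≈ ⊥̇         = id , id
  substFormula-satisfies σ σ≈ (s ≐ t)   =
    let s≈ = substTerm-eval σ σ≈ s ; t≈ = substTerm-eval σ σ≈ t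
    in (λ eq → trans (sym s≈) (trans eq t≈)) , (λ eq → trans s≈ (trans eq (sym t≈)))
  substFormula-satisfies σ σ≈ (pr r ts) =
    ᵖ-resp r ts≈ , ᵖ-resp r (symmetric ts≈)
    where
    ts≈ = substTerms-eval σ σ≈ ts
    symmetric : ∀ {k} {xs ys : Vec Carrier k} → Pointwise _≈_ xs ys → Pointwise _≈_ ys xs
    symmetric []       = []
    symmetric (p ∷ ps) = sym p ∷ symmetric ps
  substFormula-satisfies σ σ≈ (φ ⇒ ψ)   =
    let φ⁺ , φ⁻ = substFormula-satisfies σ σ≈ φ
        ψ⁺ , ψ⁻ = substFormula-satisfies σ σ≈ ψ
    in (λ h p → ψ⁺ (h (φ⁻ p))) , (λ h p → ψ⁻ (h (φ⁺ p)))
  substFormula-satisfies σ σ≈ (all̇ φ)   =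
    (λ h x → proj₁ (substFormula-satisfies (lift σ) (lift-realises σ σ≈ x) φ) (h x)) ,
    (λ h x → proj₂ (substFormula-satisfies (lift σ) (lift-realises σ σ≈ x) φ) (h x))

  instantiate-realises : ∀ {n} (ρ : Vec Carrier n) {t x} → evalTerm M ρ t ≈ x → Realises (instantiate t) ρ (x ∷ ρ)
  instantiate-realises ρ t≈x zero    = t≈x
  instantiate-realises ρ t≈x (suc i) = refl

  sound : ∀ {T : Theory S} → (∀ {φ} → φ ∈ T → φ ∈ Th M) →
          ∀ {n} {Γ : List (Formula S n)} {φ} → Derivation T Γ φ →
          ∀ ρ → All (Satisfies M ρ) Γ → Satisfies M ρ φ
  sound M⊨T (axiom {φ} φ∈T) ρ Γ = proj₂ (substFormula-satisfies (λ ()) (λ ()) φ) (M⊨T φ∈T)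
  sound M⊨T (hyp φ∈Γ) ρ Γ = All.lookup Γ φ∈Γ
  sound M⊨T (⇒-intro d) ρ Γ = λ p → sound M⊨T d ρ (p ∷ Γ)
  sound M⊨T (⇒-elim d e) ρ Γ = sound M⊨T d ρ Γ (sound M⊨T e ρ Γ)
  sound M⊨T (raa {φ} d) ρ Γ with em {Satisfies M ρ φ}
  ... | yes p = p
  ... | no ¬p = ⊥-elim (sound M⊨T d ρ (¬p ∷ Γ))
  sound M⊨T (∀-intro d) ρ Γ = λ x → sound M⊨T d (x ∷ ρ)
    (All.map⁺ (All.map (λ {φ} → proj₂ (substFormula-satisfies (var ∘ suc) (λ _ → refl) φ)) Γ))
  sound M⊨T (∀-elim {φ} d t) ρ Γ =
    proj₂ (substFormula-satisfies (instantiate t) {ρ′ = evalTerm M ρ t ∷ ρ} (instantiate-realises ρ refl) φ) (sound M⊨T d ρ Γ (evalTerm M ρ t))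
  sound M⊨T (≐-refl t) ρ Γ = refl
  sound M⊨T (≐-subst {s} {t} φ d e) ρ Γ =
    proj₂ (substFormula-satisfies (instantiate t) {ρ′ = evalTerm M ρ s ∷ ρ} (instantiate-realises ρ (sym (sound M⊨T d ρ Γ))) φ)
      (proj₁ (substFormula-satisfies (instantiate s) (instantiate-realises ρ refl) φ) (sound M⊨T e ρ Γ))

reduct : ∀ {S S′} → S ↪ S′ → Structure S′ → Structure S
reduct ι M = record
  { domain = M.domain
  ; ⟦_⟧ᶠ   = λ f → M.⟦ func f ⟧ᶠ
  ; ⟦_⟧ᵖ   = λ r → M.⟦ pred r ⟧ᵖ
  ; ᶠ-cong = λ f → M.ᶠ-cong (func f)
  ; ᵖ-resp = λ r → M.ᵖ-resp (pred r)
  }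
  where
  module M = Structure M
  open _↪_ ι

module _ {S S′ : Signature} (ι : S ↪ S′) (M : Structure S′) where
  open Structure M

  mutual
    translateTerm-eval : ∀ {n} (ρ : Vec Carrier n) t →
                         evalTerm M ρ (translateTerm ι t) ≡ evalTerm (reduct ι M) ρ t
    translateTerm-eval ρ (var i)   = ≡.refl
    translateTerm-eval ρ (fn f ts) = ≡.cong ⟦ _↪_.func ι f ⟧ᶠ (translateTerms-eval ρ ts)

    translateTerms-eval : ∀ {n k} (ρ : Vec Carrier n) (ts : Vec (Term S n) k) →
                          evalTerms M ρ (translateTerms ι ts) ≡ evalTerms (reduct ι M) ρ ts
    translateTerms-eval ρ []       = ≡.refl
    translateTerms-eval ρ (t ∷ ts) = ≡.cong₂ _∷_ (translateTerm-eval ρ t) (translateTerms-eval ρ ts)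

  translate-satisfies : ∀ {n} (ρ : Vec Carrier n) φ →
    (Satisfies M ρ (translate ι φ) → Satisfies (reduct ι M) ρ φ) × (Satisfies (reduct ι M) ρ φ → Satisfies M ρ (translate ι φ))
  translate-satisfies ρ ⊥̇         = id , id
  translate-satisfies ρ (s ≐ t)   =
    ≡.subst₂ _≈_ s≡ t≡ , ≡.subst₂ _≈_ (≡.sym s≡) (≡.sym t≡)
    where
    s≡ = translateTerm-eval ρ s
    t≡ = translateTerm-eval ρ t
  translate-satisfies ρ (pr r ts) =
    ≡.subst ⟦ _↪_.pred ι r ⟧ᵖ ts≡ , ≡.subst ⟦ _↪_.pred ι r ⟧ᵖ (≡.sym ts≡)
    where ts≡ = translateTerms-eval ρ ts
  translate-satisfies ρ (φ ⇒ ψ)   =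
    let φ⁺ , φ⁻ = translate-satisfies ρ φ
        ψ⁺ , ψ⁻ = translate-satisfies ρ ψ
    in (λ h p → ψ⁺ (h (φ⁻ p))) , (λ h p → ψ⁻ (h (φ⁺ p)))
  translate-satisfies ρ (all̇ φ)   =
    (λ h x → proj₁ (translate-satisfies (x ∷ ρ) φ) (h x)) , (λ h x → proj₂ (translate-satisfies (x ∷ ρ) φ) (h x))

-- The ordered groups of the reals

toDifference : ℤ → ℕ × ℕ
toDifference (+ n)    = n , 0
toDifference -[1+ n ] = 0 , suc n

fromDifference : ℕ × ℕ → ℤ
fromDifference (m , n) = + m ℤ.- + n

from-to : ∀ z → fromDifference (toDifference z) ≡ z
from-to (+ n)    = ℤ.+-identityʳ (+ n)
from-to -[1+ n ] = ≡.refl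

sameDifference : ∀ k l → fromDifference k ≡ fromDifference l → T (sameCoefficient k l)
sameDifference (m , n) (m′ , n′) eq = ℕ.≡⇒≡ᵇ _ _ (ℤ.+-injective (begin
  + m ℤ.+ + n′                         ≡⟨ solve 3 (λ m n n′ → m :+ n′ := (m :- n) :+ (n :+ n′)) ≡.refl (+ m) (+ n) (+ n′) ⟩
  (+ m ℤ.- + n) ℤ.+ (+ n ℤ.+ + n′)     ≡⟨ ≡.cong (ℤ._+ (+ n ℤ.+ + n′)) eq ⟩
  (+ m′ ℤ.- + n′) ℤ.+ (+ n ℤ.+ + n′)   ≡⟨ solve 3 (λ m′ n n′ → (m′ :- n′) :+ (n :+ n′) := m′ :+ n) ≡.refl (+ m′) (+ n) (+ n′) ⟩
  + m′ ℤ.+ + n                         ∎))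
  where
  open ≡.≡-Reasoning
  open +-*-Solver

module _ where
  open Coefficients integers
  open +-*-Solver

  from-⊕ : ∀ k l → fromDifference (k ⊕ l) ≡ fromDifference k ℤ.+ fromDifference l
  from-⊕ (m , n) (m′ , n′) = solve 4 (λ m n m′ n′ → (m :+ m′) :- (n :+ n′) := (m :- n) :+ (m′ :- n′)) ≡.refl
    (+ m) (+ n) (+ m′) (+ n′)

  from-⊗ : ∀ k l → fromDifference (k ⊗ l) ≡ fromDifference k ℤ.* fromDifference l
  from-⊗ (m , n) (m′ , n′) = ≡.trans
    (≡.cong₂ ℤ._-_ (≡.cong₂ ℤ._+_ (ℤ.pos-* m m′) (ℤ.pos-* n n′)) (≡.cong₂ ℤ._+_ (ℤ.pos-* m n′) (ℤ.pos-* n m′)))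
    (solve 4 (λ m n m′ n′ → (m :* m′ :+ n :* n′) :- (m :* n′ :+ n :* m′) := (m :- n) :* (m′ :- n′)) ≡.refl
      (+ m) (+ n) (+ m′) (+ n′))

  from-⊖ : ∀ k → fromDifference (⊖ k) ≡ ℤ.- fromDifference k
  from-⊖ (m , n) = solve 2 (λ m n → n :- m := :- (m :- n)) ≡.refl (+ m) (+ n)

-- Ring identities and order arithmetic in the reals

module OrderedField (ℝ : CompleteOrderedField) where
  open CompleteOrderedField ℝ public
  open RingProperties ring public
    using (-‿distribˡ-*; -‿distribʳ-*; -1*x≈-x; x∙y⁻¹≈ε⇒x≈y; x≈y⇒x∙y⁻¹≈ε; -‿involutive; -0#≈0#)

  private
    module ℤ-action = Action (integerAction +-abelianGroup)
    open ℤ-action using (_·_)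
    open SetoidReasoning setoid

    -- The values at 0 and 1 are special so that the solver sees 0# and 1#.
    integer : ℤ → Carrier
    integer (+ 0) = 0#
    integer (+ 1) = 1#
    integer z     = toDifference z · 1#

    integer≈ : ∀ z → integer z ≈ toDifference z · 1#
    integer≈ (+ 0)           = sym (trans (+-identityˡ _) -0#≈0#)
    integer≈ (+ 1)           = sym (ℤ-action.𝟙-· 1#)
    integer≈ (+ suc (suc m)) = refl
    integer≈ -[1+ n ]        = refl

    integer-difference : ∀ z k → z ≡ fromDifference k → integer z ≈ k · 1#
    integer-difference z k eq = trans (integer≈ z)
      (AbelianSolver.same-· +-abelianGroup (toDifference z) k 1#
        (sameDifference (toDifference z) k (≡.trans (from-to z) eq)))

    ·-* : ∀ k x y → k · (x * y) ≈ (k · x) * y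
    ·-* (m , n) x y = begin
      m ×ᴹ (x * y) - n ×ᴹ (x * y)           ≈⟨ +-cong (×-* m) (-‿cong (×-* n)) ⟩
      (m ×ᴹ x) * y - (n ×ᴹ x) * y           ≈⟨ +-congˡ (-‿distribˡ-* (n ×ᴹ x) y) ⟩
      (m ×ᴹ x) * y + (- (n ×ᴹ x)) * y       ≈⟨ distribʳ y _ _ ⟨
      (m ×ᴹ x - n ×ᴹ x) * y                 ∎
      where
      open import Algebra.Definitions.RawMonoid +-rawMonoid renaming (_×_ to _×ᴹ_)
      ×-* : ∀ n → n ×ᴹ (x * y) ≈ (n ×ᴹ x) * y
      ×-* zero    = sym (zeroˡ y)
      ×-* (suc n) = trans (+-congˡ (×-* n)) (sym (distribʳ y _ _))

    open Coefficients integers using (_⊕_; _⊗_; ⊖_)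

    abstract
      integer-+ : ∀ y z → integer (y ℤ.+ z) ≈ integer y + integer z
      integer-+ y z = let k = toDifference y ; l = toDifference z in begin
        integer (y ℤ.+ z)        ≈⟨ integer-difference (y ℤ.+ z) (k ⊕ l)
                                      (≡.trans (≡.sym (≡.cong₂ ℤ._+_ (from-to y) (from-to z))) (≡.sym (from-⊕ k l))) ⟩
        (k ⊕ l) · 1#             ≈⟨ ℤ-action.·-distribʳ k l 1# ⟩
        k · 1# + l · 1#          ≈⟨ +-cong (integer≈ y) (integer≈ z) ⟨
        integer y + integer z    ∎

      integer-* : ∀ y z → integer (y ℤ.* z) ≈ integer y * integer z
      integer-* y z = let k = toDifference y ; l = toDifference z in begin
        integer (y ℤ.* z)        ≈⟨ integer-difference (y ℤ.* z) (k ⊗ l)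
                                      (≡.trans (≡.sym (≡.cong₂ ℤ._*_ (from-to y) (from-to z))) (≡.sym (from-⊗ k l))) ⟩
        (k ⊗ l) · 1#             ≈⟨ ℤ-action.·-assoc k l 1# ⟩
        k · l · 1#               ≈⟨ ℤ-action.·-congˡ {k} (*-identityˡ _) ⟨
        k · (1# * (l · 1#))      ≈⟨ ·-* k 1# (l · 1#) ⟩
        (k · 1#) * (l · 1#)      ≈⟨ *-cong (integer≈ y) (integer≈ z) ⟨
        integer y * integer z    ∎

      integer-neg : ∀ z → integer (ℤ.- z) ≈ - integer z
      integer-neg z = let k = toDifference z in begin
        integer (ℤ.- z)          ≈⟨ integer-difference (ℤ.- z) (⊖ k)
                                      (≡.trans (≡.sym (≡.cong ℤ.-_ (from-to z))) (≡.sym (from-⊖ k))) ⟩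
        (⊖ k) · 1#               ≈⟨ ℤ-action.⊖-· k 1# ⟩
        - (k · 1#)               ≈⟨ -‿cong (integer≈ z) ⟨
        - integer z              ∎

    morphism : ℤ.+-*-rawRing ACR.-Raw-AlmostCommutative⟶ ACR.fromCommutativeRing commutativeRing
    morphism = record
      { ⟦_⟧    = integer
      ; +-homo = integer-+
      ; *-homo = integer-*
      ; -‿homo = integer-neg
      ; 0-homo = refl
      ; 1-homo = refl
      }

    equal? : ∀ y z → Maybe (integer y ≈ integer z)
    equal? y z with y ℤ.≟ z
    ... | yes y≡z = just (reflexive (≡.cong integer y≡z))
    ... | no  _   = nothing

    module Solver = RingSolver ℤ.+-*-rawRing (ACR.fromCommutativeRing commutativeRing) morphism equal?

  open Solver public using (Polynomial; _:+_; _:*_; _:-_; :-_)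

  pattern x₀ = Solver.var zero
  pattern x₁ = Solver.var (suc zero)
  pattern x₂ = Solver.var (suc (suc zero))
  pattern x₃ = Solver.var (suc (suc (suc zero)))
  pattern ‵0 = Solver.con (+ 0)
  pattern ‵1 = Solver.con (+ 1)

  -- Normal forms have integer coefficients and are compared before they are evaluated in ℝ, so that
  -- `refl` settles concrete identities.
  byRing : ∀ {n} (ρ : Vec Carrier n) (s t : Polynomial n) →
           Solver.normalise s ≡ Solver.normalise t → Solver.⟦ s ⟧ ρ ≈ Solver.⟦ t ⟧ ρ
  byRing ρ s t eq = Solver.prove ρ s t (reflexive (≡.cong (λ p → Solver.⟦ p ⟧N ρ) eq))

  x<y⇒0<y-x : ∀ {x y} → x < y → 0# < y - x
  x<y⇒0<y-x {x} x<y = <-respˡ-≈ (-‿inverseʳ x) (+-monoˡ-< (- x) x<y)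

  0<y-x⇒x<y : ∀ {x y} → 0# < y - x → x < y
  0<y-x⇒x<y {x} {y} 0<d = <-respˡ-≈ (+-identityˡ x)
    (<-respʳ-≈ (byRing (x ∷ y ∷ []) (x₁ :- x₀ :+ x₀) x₁ ≡.refl) (+-monoˡ-< x 0<d))

  +-pos : ∀ {x y} → 0# < x → 0# < y → 0# < x + y
  +-pos {x} {y} 0<x 0<y = <-trans 0<y (<-respˡ-≈ (+-identityˡ y) (+-monoˡ-< y 0<x))

  *-monoʳ-< : ∀ {x y z} → 0# < z → x < y → x * z < y * z
  *-monoʳ-< {x} {y} {z} 0<z x<y = 0<y-x⇒x<y (<-respʳ-≈
    (byRing (x ∷ y ∷ z ∷ []) ((x₁ :- x₀) :* x₂) (x₁ :* x₂ :- x₀ :* x₂) ≡.refl)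
    (*-pos (x<y⇒0<y-x x<y) 0<z))

  neg-pos : ∀ {x} → x < 0# → 0# < - x
  neg-pos {x} x<0 = <-respʳ-≈ (+-identityˡ (- x)) (x<y⇒0<y-x x<0)

  pos-neg : ∀ {x} → 0# < - x → x < 0#
  pos-neg {x} 0<-x = 0<y-x⇒x<y (<-respʳ-≈ (sym (+-identityˡ (- x))) 0<-x)

  positive-inverse : ∀ {x y} → 0# < x → x * y ≈ 1# → 0# < y
  positive-inverse {x} {y} 0<x xy≈1 with compare 0# y
  ... | tri< 0<y _ _ = 0<y
  ... | tri≈ _ 0≈y _ = contradiction 0<1
    (<-irrefl (trans (sym (zeroʳ x)) (trans (*-congˡ 0≈y) xy≈1)))
  ... | tri> _ _ y<0 = contradiction 0<1
    (<-asym (pos-neg (<-respʳ-≈ (trans (sym (-‿distribʳ-* x y)) (-‿cong xy≈1)) (*-pos 0<x (neg-pos y<0)))))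

  recip : ∀ {x} → 0# < x → Carrier
  recip {x} 0<x = proj₁ (inverse x (λ x≈0 → <-irrefl (sym x≈0) 0<x))

  recip-inverse : ∀ {x} (0<x : 0# < x) → x * recip 0<x ≈ 1#
  recip-inverse {x} 0<x = proj₂ (inverse x (λ x≈0 → <-irrefl (sym x≈0) 0<x))

  additive-group : OrderedGroup
  additive-group = record
    { abelianGroup = +-abelianGroup
    ; Pos          = 0# <_
    ; Pos-resp     = <-respʳ-≈
    ; Pos-∙        = +-pos
    ; ¬Pos-ε       = <-irrefl refl
    ; pos?         = pos?
    ; nontrivial   = 1# , 0<1
    }
    where
    pos? : ∀ x → 0# < x ⊎ x ≈ 0# ⊎ 0# < - x
    pos? x with compare 0# x
    ... | tri< 0<x _ _ = inj₁ 0<x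
    ... | tri≈ _ 0≈x _ = inj₂ (inj₁ (sym 0≈x))
    ... | tri> _ _ x<0 = inj₂ (inj₂ (neg-pos x<0))

  Positives : Set
  Positives = ∃ (0# <_)

  x⁻¹>1 : ∀ {x} (0<x : 0# < x) → x < 1# → 1# < recip 0<x
  x⁻¹>1 0<x x<1 = <-respˡ-≈ (recip-inverse 0<x)
    (<-respʳ-≈ (*-identityˡ _) (*-monoʳ-< (positive-inverse 0<x (recip-inverse 0<x)) x<1))

  multiplicative-group : OrderedGroup
  multiplicative-group = record
    { abelianGroup = record
      { Carrier = Positives
      ; _≈_     = λ x y → proj₁ x ≈ proj₁ y
      ; _∙_     = λ (x , 0<x) (y , 0<y) → x * y , *-pos 0<x 0<y
      ; ε       = 1# , 0<1
      ; _⁻¹     = λ (x , 0<x) → recip 0<x , positive-inverse 0<x (recip-inverse 0<x)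
      ; isAbelianGroup = record
        { isGroup = record
          { isMonoid = record
            { isSemigroup = record
              { isMagma = record
                { isEquivalence = record { refl = refl ; sym = sym ; trans = trans }
                ; ∙-cong        = *-cong
                }
              ; assoc = λ x y z → *-assoc _ _ _
              }
            ; identity = (λ x → *-identityˡ _) , (λ x → *-identityʳ _)
            }
          ; inverse = (λ (x , 0<x) → trans (*-comm _ x) (recip-inverse 0<x)) , (λ (x , 0<x) → recip-inverse 0<x)
          ; ⁻¹-cong = λ {(_ , 0<x)} {(_ , 0<y)} x≈y → inverse-unique x≈y (recip-inverse 0<x) (recip-inverse 0<y)
          }
        ; comm = λ x y → *-comm _ _
        }
      }
    ; Pos        = λ x → 1# < proj₁ x
    ; Pos-resp   = <-respʳ-≈
    ; Pos-∙      = λ {_} {(y , 0<y)} 1<x 1<y → <-trans (<-respʳ-≈ (sym (*-identityˡ y)) 1<y) (*-monoʳ-< 0<y 1<x)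
    ; ¬Pos-ε     = <-irrefl refl
    ; pos?       = pos?
    ; nontrivial = (1# + 1# , +-pos 0<1 0<1) , <-respˡ-≈ (+-identityˡ 1#) (+-monoˡ-< 1# 0<1)
    }
    where
    pos? : ((x , 0<x) : Positives) → 1# < x ⊎ x ≈ 1# ⊎ 1# < recip 0<x
    pos? (x , 0<x) with compare 1# x
    ... | tri< 1<x _ _ = inj₁ 1<x
    ... | tri≈ _ 1≈x _ = inj₂ (inj₁ (sym 1≈x))
    ... | tri> _ _ x<1 = inj₂ (inj₂ (x⁻¹>1 0<x x<1))

-- Divisibility of complete ordered groups

module Multiples (G : OrderedGroup) where
  open OrderedGroup G
  open Mult commutativeMonoid public renaming (_×_ to _×ᴹ_)

  ×-Pos : ∀ n {x} → Pos x → Pos (suc n ×ᴹ x)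
  ×-Pos zero    {x} p = Pos-resp (sym (identityʳ x)) p
  ×-Pos (suc n)     p = Pos-∙ p (×-Pos n p)

  ×-mono-< : ∀ n {x y} → x < y → suc n ×ᴹ x < suc n ×ᴹ y
  ×-mono-< n x<y = Pos-resp (×-distrib-- abelianGroup (suc n) _ _) (×-Pos n x<y)

  ×-ε : ∀ n → n ×ᴹ ε ≈ ε
  ×-ε zero    = refl
  ×-ε (suc n) = trans (identityˡ _) (×-ε n)

  <-irrefl : ∀ {x} → ¬ (x < x)
  <-irrefl {x} p = ¬Pos-ε (Pos-resp (inverseʳ x) p)

  ∙-mono-< : ∀ {x y u v} → x < y → u < v → x ∙ u < y ∙ v
  ∙-mono-< {x} {y} {u} {v} p q =
    Pos-resp (abel (x ∷ y ∷ u ∷ v ∷ []) ((v₁ ⊞ neg v₀) ⊞ (v₃ ⊞ neg v₂)) ((v₁ ⊞ v₃) ⊞ neg (v₀ ⊞ v₂))) (Pos-∙ p q)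

module _ (G : OrderedGroup) where
  open OrderedGroup G
  open Multiples G

  Dense : Set
  Dense = ∀ {r} → Pos r → ∃ λ q → Pos q × q < r

  HasSuprema : Set₁
  HasSuprema = (P : Carrier → Set) → P ε → (∃ λ b → ∀ {x} → P x → ¬ (b < x)) →
               ∃ λ s → (∀ {x} → P x → ¬ (s < x)) × (∀ {y} → y < s → ∃ λ x → P x × y < x)

  Divisible : Set
  Divisible = ∀ n x → ∃ λ y → suc n ×ᴹ y ≈ x

-- The n-th part of u > 0 is the supremum of the y with n y < u.
module _ (G : OrderedGroup) (between : Dense G) (supremum : HasSuprema G) where
  open OrderedGroup G
  open Multiples G

  private
    halve : ∀ {r} → Pos r → ∃ λ q → Pos q × ¬ (r < q ∙ q)
    halve {r} r>0 with between r>0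
    ... | q , q>0 , q<r with Pos-dec (q ∙ q - r)
    ...   | no  r≮2q = q , q>0 , r≮2q
    -- If q is more than half of r, then its complement r - q is less than half.
    ...   | yes r<2q = r - q , q<r , λ r<2p → ¬Pos-ε (Pos-resp
            (abel (r ∷ q ∷ []) ((((v₀ ⊞ neg v₁) ⊞ (v₀ ⊞ neg v₁)) ⊞ neg v₀) ⊞ ((v₁ ⊞ v₁) ⊞ neg v₀)) null)
            (Pos-∙ r<2p r<2q))

    -- One halving for each summand: q < h and n q < h add up to less than 2 h, which is at most r.
    small : ∀ n {r} → Pos r → ∃ λ q → Pos q × q < r × n ×ᴹ q < r
    small zero    {r} r>0 =
      let q , q>0 , q<r = between r>0
      in q , q>0 , q<r , Pos-resp (abel (r ∷ []) v₀ (v₀ ⊞ neg null)) r>0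
    small (suc n) {r} r>0 with halve r>0
    ... | h , h>0 , r≮2h with small n h>0
    ...   | q , q>0 , q<h , nq<h =
            q , q>0 , <-≮-trans (<-trans q<h h<2h) r≮2h , <-≮-trans (∙-mono-< q<h nq<h) r≮2h
      where
      h<2h : h < h ∙ h
      h<2h = Pos-resp (abel (h ∷ []) v₀ ((v₀ ⊞ v₀) ⊞ neg v₀)) h>0

    ∙-monoʳ-< : ∀ z {x y} → x < y → z ∙ x < z ∙ y
    ∙-monoʳ-< z {x} {y} =
      Pos-resp (abel (x ∷ y ∷ z ∷ []) (v₁ ⊞ neg v₀) ((v₂ ⊞ v₁) ⊞ neg (v₂ ⊞ v₀)))

    -- The gap between n s and u has room for n q when q is small enough. This and `reduce` express
    -- the continuity of s ↦ n s and exclude both strict inequalities at the supremum.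
    enlarge : ∀ n {u s} → n ×ᴹ s < u → ∃ λ t → s < t × n ×ᴹ t < u
    enlarge n {u} {s} ns<u =
      let q , q>0 , _ , nq<e = small n ns<u
      in s ∙ q ,
         Pos-resp (abel (s ∷ q ∷ []) v₁ ((v₀ ⊞ v₁) ⊞ neg v₀)) q>0 ,
         <-resp (sym (×-distrib-+ s q n))
           (abel (n ×ᴹ s ∷ u ∷ []) (v₀ ⊞ (v₁ ⊞ neg v₀)) v₁) (∙-monoʳ-< (n ×ᴹ s) nq<e)

    reduce : ∀ n {u s} → u < n ×ᴹ s → ∃ λ t → t < s × u < n ×ᴹ t
    reduce n {u} {s} u<ns =
      let q , q>0 , _ , nq<e = small n u<ns
      in s - q ,
         Pos-resp (abel (s ∷ q ∷ []) v₁ (v₀ ⊞ neg (v₀ ⊞ neg v₁))) q>0 ,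
         <-resp refl (sym (×-distrib-- abelianGroup n s q))
           (Pos-resp (abel (n ×ᴹ s ∷ n ×ᴹ q ∷ u ∷ []) ((v₀ ⊞ neg v₂) ⊞ neg v₁) ((v₀ ⊞ neg v₁) ⊞ neg v₂)) nq<e)

    multiple≮ : ∀ n {x} → Pos x → ¬ (suc n ×ᴹ x < x)
    multiple≮ zero    {x} x>0 p = <-irrefl (<-resp (identityʳ x) refl p)
    multiple≮ (suc n) {x} x>0 p = Pos-asym (×-Pos n x>0)
      (Pos-resp (abel (x ∷ suc n ×ᴹ x ∷ []) (v₀ ⊞ neg (v₀ ⊞ v₁)) (neg v₁)) p)

    x-ε≈x : ∀ x → x - ε ≈ x
    x-ε≈x x = abel (x ∷ []) (v₀ ⊞ neg null) v₀

    bound : ∀ n {u x} → Pos u → suc n ×ᴹ x < u → ¬ (u < x)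
    bound n {u} {x} u>0 nx<u u<x = multiple≮ n (Pos-resp (x-ε≈x x) (<-trans ε<u u<x)) (<-trans nx<u u<x)
      where
      ε<u : ε < u
      ε<u = Pos-resp (sym (x-ε≈x u)) u>0

    ×-ε<u : ∀ n {u} → Pos u → n ×ᴹ ε < u
    ×-ε<u n {u} u>0 = <-resp (sym (×-ε n)) refl (Pos-resp (sym (x-ε≈x u)) u>0)

    positive-part : ∀ n {u} → Pos u → ∃ λ y → suc n ×ᴹ y ≈ u
    positive-part n {u} u>0 with supremum (λ y → suc n ×ᴹ y < u) (×-ε<u (suc n) u>0) (u , bound n u>0)
    ... | s , s-bound , s-least = s , root (pos? (u - suc n ×ᴹ s))
      where
      root : Pos (u - suc n ×ᴹ s) ⊎ u - suc n ×ᴹ s ≈ ε ⊎ Pos ((u - suc n ×ᴹ s) ⁻¹) → suc n ×ᴹ s ≈ u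
      root (inj₂ (inj₁ u≈ns)) = sym (x∙y⁻¹≈ε⇒x≈y u (suc n ×ᴹ s) u≈ns)
      root (inj₁ ns<u) =
        let t , s<t , nt<u = enlarge (suc n) ns<u
        in contradiction s<t (s-bound nt<u)
      root (inj₂ (inj₂ u<ns)) =
        let t , t<s , u<nt = reduce (suc n) (Pos-resp (⁻¹-anti-homo‿- u (suc n ×ᴹ s)) u<ns)
            y , ny<u , t<y = s-least t<s
        in contradiction (<-trans u<nt (<-trans (×-mono-< n t<y) ny<u)) <-irrefl

  complete⇒divisible : Divisible G
  complete⇒divisible n u with pos? u
  ... | inj₁ u>0        = positive-part n u>0
  ... | inj₂ (inj₁ u≈ε) = ε , trans (×-ε (suc n)) (sym u≈ε)
  ... | inj₂ (inj₂ u<0) =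
    let y , Ny≈-u = positive-part n u<0
    in y ⁻¹ , trans (×-⁻¹ abelianGroup (suc n) y) (trans (⁻¹-cong Ny≈-u) (⁻¹-involutive u))

module _ (G : OrderedGroup) (divide : Divisible G) where
  open OrderedGroup G
  open Multiples G

  integerOrderedAction : OrderedAction integers G
  integerOrderedAction = record
    { action    = integerAction abelianGroup
    ; ·-Pos     = ·-Pos
    ; divisible = divisible
    }
    where
    ·-Pos : ∀ {k x} → Coefficients.Positive integers k → Pos x → Pos (Action._·_ (integerAction abelianGroup) k x)
    ·-Pos {m , n} {x} n<m p with m ℕ.∸ n | ℕ.m<n⇒0<n∸m n<m | action-positive abelianGroup n<m x
    ... | suc d | _ | eq = Pos-resp (sym eq) (×-Pos d p)

    divisible : ∀ {k} → Coefficients.Positive integers k → ∀ x → ∃ λ y → Action._·_ (integerAction abelianGroup) k y ≈ x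
    divisible {m , n} n<m x with m ℕ.∸ n | ℕ.m<n⇒0<n∸m n<m | action-positive abelianGroup n<m
    ... | suc d | _ | eq = let y , dy≈x = divide d x in y , trans (eq y) dy≈x

module RealGroups (ℝ : CompleteOrderedField) where
  open OrderedField ℝ

  private module P = OrderedGroup multiplicative-group

  ½ : Carrier
  ½ = recip (+-pos 0<1 0<1)

  0<½ : 0# < ½
  0<½ = positive-inverse (+-pos 0<1 0<1) (recip-inverse (+-pos 0<1 0<1))

  ½+½≈1 : ½ + ½ ≈ 1#
  ½+½≈1 = trans (byRing (½ ∷ []) (x₀ :+ x₀) ((‵1 :+ ‵1) :* x₀) ≡.refl) (recip-inverse (+-pos 0<1 0<1))

  midpoint : ∀ {x y} → x < y → ∃ λ z → x < z × z < y
  midpoint {x} {y} x<y = x + d , above , below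
    where
    d = (y - x) * ½
    0<d : 0# < d
    0<d = *-pos (x<y⇒0<y-x x<y) 0<½

    above : x < x + d
    above = 0<y-x⇒x<y (<-respʳ-≈ (byRing (x ∷ d ∷ []) x₁ (x₀ :+ x₁ :- x₀) ≡.refl) 0<d)

    2d : d + d ≈ y - x
    2d = trans (sym (distribˡ (y - x) ½ ½)) (trans (*-congˡ ½+½≈1) (*-identityʳ _))

    below : x + d < y
    below = 0<y-x⇒x<y (<-respʳ-≈ (begin
      d                   ≈⟨ byRing (d ∷ x ∷ []) x₀ (x₀ :+ x₀ :- (x₁ :+ x₀) :+ x₁) ≡.refl ⟩
      d + d - (x + d) + x ≈⟨ +-congʳ (+-congʳ 2d) ⟩
      y - x - (x + d) + x ≈⟨ byRing (x ∷ y ∷ d ∷ []) (x₁ :- x₀ :- (x₀ :+ x₂) :+ x₀) (x₁ :- (x₀ :+ x₂)) ≡.refl ⟩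
      y - (x + d)         ∎) 0<d)
      where open SetoidReasoning setoid

  additive-divisible : Divisible additive-group
  additive-divisible = complete⇒divisible additive-group
    (λ 0<r → let z , 0<z , z<r = midpoint 0<r in z , 0<z , x<y⇒0<y-x z<r)
    (λ P p0 (b , bound) →
      let s , s-bound , s-least = complete P (0# , p0) (b , λ Px b<x → bound Px (x<y⇒0<y-x b<x))
      in s , (λ Px s<x → s-bound Px (0<y-x⇒x<y s<x)) ,
         λ y<s → let x , Px , y<x = s-least (0<y-x⇒x<y y<s) in x , Px , x<y⇒0<y-x y<x)

  multiplicative-<⁺ : (x y : Positives) → proj₁ x < proj₁ y → x P.< y
  multiplicative-<⁺ (x , 0<x) (y , 0<y) x<y =
    <-respˡ-≈ (recip-inverse 0<x) (*-monoʳ-< (positive-inverse 0<x (recip-inverse 0<x)) x<y)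

  multiplicative-<⁻ : (x y : Positives) → x P.< y → proj₁ x < proj₁ y
  multiplicative-<⁻ (x , 0<x) (y , 0<y) x<y =
    <-respˡ-≈ (*-identityˡ x) (<-respʳ-≈ cancel (*-monoʳ-< 0<x x<y))
    where
    cancel : y * recip 0<x * x ≈ y
    cancel = trans (byRing (x ∷ y ∷ recip 0<x ∷ []) (x₁ :* x₂ :* x₀) (x₁ :* (x₀ :* x₂)) ≡.refl)
      (trans (*-congˡ (recip-inverse 0<x)) (*-identityʳ y))

  -- Roots of positive reals come from the same supremum argument as quotients. The set contains 1,
  -- so its supremum in ℝ is at least 1 and hence again positive.
  multiplicative-divisible : Divisible multiplicative-group
  multiplicative-divisible = complete⇒divisible multiplicative-group
    (λ {(r , 0<r)} 1<r →
      let z , 1<z , z<r = midpoint 1<r ; 0<z = <-trans 0<1 1<z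
      in (z , 0<z) , 1<z , multiplicative-<⁺ (z , 0<z) (r , 0<r) z<r)
    λ P p1 ((b , 0<b) , bound) →
      let s , s-bound , s-least = complete (λ x → ∃ λ 0<x → P (x , 0<x)) (1# , 0<1 , p1)
            (b , λ {x} (0<x , Px) b<x → bound Px (multiplicative-<⁺ (b , 0<b) (x , 0<x) b<x))
          0<s = positive s (s-bound (0<1 , p1))
      in (s , 0<s) , (λ {x} Px s<x → s-bound (proj₂ x , Px) (multiplicative-<⁻ (s , 0<s) x s<x)) ,
         λ {y} y<s → let x , (0<x , Px) , y<x = s-least (multiplicative-<⁻ y (s , 0<s) y<s)
                     in (x , 0<x) , Px , multiplicative-<⁺ y (x , 0<x) y<x
    where
    positive : ∀ s → ¬ (s < 1#) → 0# < s
    positive s s≮1 with compare 0# s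
    ... | tri< 0<s _ _ = 0<s
    ... | tri≈ _ 0≈s _ = contradiction (<-respˡ-≈ 0≈s 0<1) s≮1
    ... | tri> _ _ s<0 = contradiction (<-trans s<0 0<1) s≮1

-- The countermodel

-- Finite sums Σ aᵢ t^γᵢ with real exponents and coefficients, t being
-- infinitely large.
module Series (ℝ : CompleteOrderedField) where
  open OrderedField ℝ

  Sum : Set
  Sum = List (Carrier × Carrier)

  select : ∀ {γ δ} → Dec (γ ≈ δ) → Carrier → Carrier
  select (yes _) a = a
  select (no  _) a = 0#

  coeff : Sum → Carrier → Carrier
  coeff []            δ = 0#
  coeff ((γ , a) ∷ v) δ = select (γ ≟ δ) a + coeff v δ

  select-cong : ∀ {γ γ′ δ δ′ a a′} (d : Dec (γ ≈ δ)) (d′ : Dec (γ′ ≈ δ′)) →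
                (γ ≈ δ → γ′ ≈ δ′) → (γ′ ≈ δ′ → γ ≈ δ) → a ≈ a′ → select d a ≈ select d′ a′
  select-cong (yes _) (yes _) f g a≈ = a≈
  select-cong (yes p) (no  q) f g a≈ = contradiction (f p) q
  select-cong (no  p) (yes q) f g a≈ = contradiction (g q) p
  select-cong (no  _) (no  _) f g a≈ = refl

  select-yes : ∀ {γ δ a} (d : Dec (γ ≈ δ)) → γ ≈ δ → select d a ≈ a
  select-yes (yes _) eq = refl
  select-yes (no  p) eq = contradiction eq p

  select-no : ∀ {γ δ a} (d : Dec (γ ≈ δ)) → ¬ (γ ≈ δ) → select d a ≈ 0#
  select-no (yes p) neq = contradiction p neq
  select-no (no  _) neq = refl

  coeff-cong : ∀ v {δ δ′} → δ ≈ δ′ → coeff v δ ≈ coeff v δ′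
  coeff-cong []            eq = refl
  coeff-cong ((γ , a) ∷ v) eq = +-cong
    (select-cong (γ ≟ _) (γ ≟ _) (λ p → trans p eq) (λ p → trans p (sym eq)) refl) (coeff-cong v eq)

  coeff-++ : ∀ v w δ → coeff (v ++ w) δ ≈ coeff v δ + coeff w δ
  coeff-++ []            w δ = sym (+-identityˡ _)
  coeff-++ ((γ , a) ∷ v) w δ = trans (+-congˡ (coeff-++ v w δ)) (sym (+-assoc _ _ _))

  scaleBy : Carrier → Sum → Sum
  scaleBy c = List.map (λ (γ , a) → γ , c * a)

  coeff-scaleBy : ∀ c v δ → coeff (scaleBy c v) δ ≈ c * coeff v δ
  coeff-scaleBy c []            δ = sym (zeroʳ c)
  coeff-scaleBy c ((γ , a) ∷ v) δ =
    trans (+-cong (select-* (γ ≟ δ)) (coeff-scaleBy c v δ)) (sym (distribˡ c _ _))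
    where
    select-* : (d : Dec (γ ≈ δ)) → select d (c * a) ≈ c * select d a
    select-* (yes _) = refl
    select-* (no  _) = sym (zeroʳ c)

  shift : Carrier → Sum → Sum
  shift η = List.map (λ (γ , a) → γ + η , a)

  coeff-shift : ∀ η v δ → coeff (shift η v) δ ≈ coeff v (δ - η)
  coeff-shift η []            δ = refl
  coeff-shift η ((γ , a) ∷ v) δ = +-cong
    (select-cong (γ + η ≟ δ) (γ ≟ δ - η)
      (λ eq → trans (byRing (γ ∷ η ∷ []) x₀ (x₀ :+ x₁ :- x₁) ≡.refl) (+-congʳ eq))
      (λ eq → trans (+-congʳ eq) (byRing (δ ∷ η ∷ []) (x₀ :- x₁ :+ x₁) x₀ ≡.refl))
      refl)
    (coeff-shift η v δ)

  infix 4 _≋_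

  -- A list may repeat exponents or carry zero coefficients, so lists are identified through their
  -- coefficient functions.
  record _≋_ (v w : Sum) : Set where
    constructor coefficientwise
    field at : ∀ δ → coeff v δ ≈ coeff w δ
  open _≋_ public

  record Leading (v : Sum) : Set where
    constructor leading
    field
      exponent : Carrier
      positive : 0# < coeff v exponent
      beyond   : ∀ {δ} → exponent < δ → coeff v δ ≈ 0#

  negate : Sum → Sum
  negate = scaleBy (- 1#)

  coeff-negate : ∀ v δ → coeff (negate v) δ ≈ - coeff v δ
  coeff-negate v δ = trans (coeff-scaleBy (- 1#) v δ) (-1*x≈-x _)

  coeff-minus : ∀ v w δ → coeff (v ++ negate w) δ ≈ coeff v δ - coeff w δ
  coeff-minus v w δ = trans (coeff-++ v (negate w) δ) (+-congˡ (coeff-negate w δ))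

  abelianGroup : AbelianGroup 0ℓ 0ℓ
  abelianGroup = record
    { Carrier = Sum
    ; _≈_     = _≋_
    ; _∙_     = _++_
    ; ε       = []
    ; _⁻¹     = negate
    ; isAbelianGroup = record
      { isGroup = record
        { isMonoid = record
          { isSemigroup = record
            { isMagma = record
              { isEquivalence = record
                { refl  = coefficientwise λ _ → refl
                ; sym   = λ p → coefficientwise λ δ → sym (at p δ)
                ; trans = λ p q → coefficientwise λ δ → trans (at p δ) (at q δ)
                }
              ; ∙-cong = λ {v} {v′} {w} {w′} p q → coefficientwise λ δ →
                  trans (coeff-++ v w δ) (trans (+-cong (at p δ) (at q δ)) (sym (coeff-++ v′ w′ δ)))
              }
            ; assoc = λ u v w → coefficientwise λ δ → begin
                coeff ((u ++ v) ++ w) δ             ≈⟨ trans (coeff-++ (u ++ v) w δ) (+-congʳ (coeff-++ u v δ)) ⟩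
                coeff u δ + coeff v δ + coeff w δ   ≈⟨ +-assoc _ _ _ ⟩
                coeff u δ + (coeff v δ + coeff w δ) ≈⟨ trans (coeff-++ u (v ++ w) δ) (+-congˡ (coeff-++ v w δ)) ⟨
                coeff (u ++ v ++ w) δ               ∎
            }
          ; identity = (λ v → coefficientwise λ δ → refl)
                     , (λ v → coefficientwise λ δ → trans (coeff-++ v [] δ) (+-identityʳ _))
          }
        ; inverse = (λ v → coefficientwise λ δ →
                      trans (coeff-++ (negate v) v δ) (trans (+-congʳ (coeff-negate v δ)) (-‿inverseˡ _)))
                  , (λ v → coefficientwise λ δ → trans (coeff-minus v v δ) (-‿inverseʳ _))
        ; ⁻¹-cong = λ {v} {w} p → coefficientwise λ δ →
            trans (coeff-negate v δ) (trans (-‿cong (at p δ)) (sym (coeff-negate w δ)))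
        }
      ; comm = λ v w → coefficientwise λ δ →
          trans (coeff-++ v w δ) (trans (+-comm _ _) (sym (coeff-++ w v δ)))
      }
    }
    where open SetoidReasoning setoid

  support : ∀ v δ → coeff v δ ≈ 0# ⊎ ∃ λ γ → γ ∈ˡ List.map proj₁ v × γ ≈ δ
  support []            δ = inj₁ refl
  support ((γ , a) ∷ v) δ with γ ≟ δ
  ... | yes γ≈δ = inj₂ (γ , here ≡.refl , γ≈δ)
  ... | no  _ with support v δ
  ...   | inj₁ eq             = inj₁ (trans (+-identityˡ _) eq)
  ...   | inj₂ (γ′ , γ′∈ , eq) = inj₂ (γ′ , there γ′∈ , eq)

  -- Terms with equal exponents may cancel, so the largest listed exponent need not lead; the search
  -- is for the largest one whose total coefficient is nonzero.
  greatest : ∀ v (γs : List Carrier) →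
             (∀ {δ} → δ ∈ˡ γs → coeff v δ ≈ 0#)
           ⊎ ∃ λ γ → ¬ (coeff v γ ≈ 0#) × (∀ {δ} → δ ∈ˡ γs → γ < δ → coeff v δ ≈ 0#)
  greatest v []       = inj₁ λ ()
  greatest v (η ∷ γs) with greatest v γs | coeff v η ≟ 0#
  ... | inj₁ none | yes z = inj₁ λ { (here ≡.refl) → z ; (there i) → none i }
  ... | inj₁ none | no  n = inj₂ (η , n , λ { (here ≡.refl) η<η → contradiction η<η (<-irrefl refl) ; (there i) _ → none i })
  ... | inj₂ (γ , γ≉0 , max) | yes z = inj₂ (γ , γ≉0 , λ { (here ≡.refl) _ → z ; (there i) → max i })
  ... | inj₂ (γ , γ≉0 , max) | no  n with γ <? η
  ...   | yes γ<η = inj₂ (η , n , λ { (here ≡.refl) η<η → contradiction η<η (<-irrefl refl)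
                                    ; (there i) η<δ → max i (<-trans γ<η η<δ) })
  ...   | no  γ≮η = inj₂ (γ , γ≉0 , λ { (here ≡.refl) γ<η → contradiction γ<η γ≮η ; (there i) → max i })

  leading? : ∀ v → Leading v ⊎ v ≋ [] ⊎ Leading (negate v)
  leading? v with greatest v (List.map proj₁ v)
  ... | inj₁ none = inj₂ (inj₁ (coefficientwise vanishes))
    where
    vanishes : ∀ δ → coeff v δ ≈ 0#
    vanishes δ with support v δ
    ... | inj₁ eq             = eq
    ... | inj₂ (γ , γ∈ , γ≈δ) = trans (coeff-cong v (sym γ≈δ)) (none γ∈)
  ... | inj₂ (γ , γ≉0 , max) = leads (compare 0# (coeff v γ))
    where
    beyond : ∀ {δ} → γ < δ → coeff v δ ≈ 0#
    beyond {δ} γ<δ with support v δ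
    ... | inj₁ eq              = eq
    ... | inj₂ (γ′ , γ∈ , γ′≈δ) = trans (coeff-cong v (sym γ′≈δ)) (max γ∈ (<-respʳ-≈ (sym γ′≈δ) γ<δ))

    leads : Tri (0# < coeff v γ) (0# ≈ coeff v γ) (coeff v γ < 0#) → Leading v ⊎ v ≋ [] ⊎ Leading (negate v)
    leads (tri< 0<c _ _) = inj₁ (leading γ 0<c beyond)
    leads (tri≈ _ 0≈c _) = contradiction (sym 0≈c) γ≉0
    leads (tri> _ _ c<0) = inj₂ (inj₂ (leading γ (<-respʳ-≈ (sym (coeff-negate v γ)) (neg-pos c<0))
      (λ {δ} γ<δ → trans (coeff-negate v δ) (trans (-‿cong (beyond γ<δ)) -0#≈0#))))

  orderedGroup : OrderedGroup
  orderedGroup = record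
    { abelianGroup = abelianGroup
    ; Pos          = Leading
    ; Pos-resp     = λ v≋w (leading γ 0<c beyond) →
        leading γ (<-respʳ-≈ (at v≋w γ) 0<c) (λ γ<δ → trans (sym (at v≋w _)) (beyond γ<δ))
    ; Pos-∙        = λ {v} {w} → Leading-++ v w
    ; ¬Pos-ε       = λ (leading γ 0<0 _) → <-irrefl refl 0<0
    ; pos?         = leading?
    ; nontrivial   = (0# , 1#) ∷ [] , leading 0#
        (<-respʳ-≈ (sym (trans (+-identityʳ _) (select-yes (0# ≟ 0#) refl))) 0<1)
        (λ 0<δ → trans (+-identityʳ _) (select-no (0# ≟ _) (λ 0≈δ → <-irrefl 0≈δ 0<δ)))
    }
    where
    Leading-++ : ∀ v w → Leading v → Leading w → Leading (v ++ w)
    Leading-++ v w (leading γ 0<c beyond) (leading γ′ 0<c′ beyond′) with compare γ γ′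
    ... | tri< γ<γ′ _ _ = leading γ′
      (<-respʳ-≈ (sym (trans (coeff-++ v w γ′) (trans (+-congʳ (beyond γ<γ′)) (+-identityˡ _)))) 0<c′)
      (λ {δ} γ′<δ → trans (coeff-++ v w δ) (trans (+-cong (beyond (<-trans γ<γ′ γ′<δ)) (beyond′ γ′<δ)) (+-identityˡ 0#)))
    ... | tri≈ _ γ≈γ′ _ = leading γ
      (<-respʳ-≈ (sym (coeff-++ v w γ)) (+-pos 0<c (<-respʳ-≈ (coeff-cong w (sym γ≈γ′)) 0<c′)))
      (λ {δ} γ<δ → trans (coeff-++ v w δ) (trans (+-cong (beyond γ<δ) (beyond′ (<-respˡ-≈ γ≈γ′ γ<δ))) (+-identityˡ 0#)))
    ... | tri> _ _ γ′<γ = leading γ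
      (<-respʳ-≈ (sym (trans (coeff-++ v w γ) (trans (+-congˡ (beyond′ γ′<γ)) (+-identityʳ _)))) 0<c)
      (λ {δ} γ<δ → trans (coeff-++ v w δ) (trans (+-cong (beyond γ<δ) (beyond′ (<-trans γ′<γ γ<δ))) (+-identityˡ 0#)))

-- Subgroups, lexicographic products and a concave automorphism

record Subgroup (G : OrderedGroup) : Set₁ where
  open OrderedGroup G
  field
    Member       : Carrier → Set
    ∙-closed     : ∀ {x y} → Member x → Member y → Member (x ∙ y)
    ε-closed     : Member ε
    ⁻¹-closed    : ∀ {x} → Member x → Member (x ⁻¹)
    inhabited    : ∃ λ x → Pos x × Member x

  orderedSubgroup : OrderedGroup
  orderedSubgroup = record
    { abelianGroup = record
      { Carrier = Σ Carrier Member
      ; _≈_     = λ x y → proj₁ x ≈ proj₁ y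
      ; _∙_     = λ (x , p) (y , q) → x ∙ y , ∙-closed p q
      ; ε       = ε , ε-closed
      ; _⁻¹     = λ (x , p) → x ⁻¹ , ⁻¹-closed p
      ; isAbelianGroup = record
        { isGroup = record
          { isMonoid = record
            { isSemigroup = record
              { isMagma = record
                { isEquivalence = record { refl = refl ; sym = sym ; trans = trans }
                ; ∙-cong        = ∙-cong
                }
              ; assoc = λ x y z → assoc _ _ _
              }
            ; identity = (λ x → identityˡ _) , (λ x → identityʳ _)
            }
          ; inverse = (λ x → inverseˡ _) , (λ x → inverseʳ _)
          ; ⁻¹-cong = ⁻¹-cong
          }
        ; comm = λ x y → comm _ _
        }
      }
    ; Pos        = λ x → Pos (proj₁ x)
    ; Pos-resp   = Pos-resp
    ; Pos-∙      = Pos-∙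
    ; ¬Pos-ε     = ¬Pos-ε
    ; pos?       = λ x → pos? (proj₁ x)
    ; nontrivial = let x , p , q = inhabited in (x , q) , p
    }

module _ (G H : OrderedGroup) where
  private
    module G = OrderedGroup G
    module H = OrderedGroup H
    module ×G = Multiples G
    module ×H = Multiples H

  lexicographic : OrderedGroup
  lexicographic = record
    { abelianGroup = DirectProduct.abelianGroup G.abelianGroup H.abelianGroup
    ; Pos          = λ (x , y) → G.Pos x ⊎ (x G.≈ G.ε × H.Pos y)
    ; Pos-resp     = λ { (x≈ , y≈) (inj₁ p)       → inj₁ (G.Pos-resp x≈ p)
                       ; (x≈ , y≈) (inj₂ (z , p)) → inj₂ (G.trans (G.sym x≈) z , H.Pos-resp y≈ p) }
    ; Pos-∙        = λ { (inj₁ p)       (inj₁ q)        → inj₁ (G.Pos-∙ p q)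
                       ; (inj₁ p)       (inj₂ (z , _))  → inj₁ (G.Pos-resp (G.sym (G.trans (G.∙-congˡ z) (G.identityʳ _))) p)
                       ; (inj₂ (z , _)) (inj₁ q)        → inj₁ (G.Pos-resp (G.sym (G.trans (G.∙-congʳ z) (G.identityˡ _))) q)
                       ; (inj₂ (z , p)) (inj₂ (z′ , q)) → inj₂ (G.trans (G.∙-cong z z′) (G.identityˡ _) , H.Pos-∙ p q) }
    ; ¬Pos-ε       = λ { (inj₁ p) → G.¬Pos-ε p ; (inj₂ (_ , p)) → H.¬Pos-ε p }
    ; pos?         = pos?
    ; nontrivial   = let x , p = G.nontrivial in (x , H.ε) , inj₁ p
    }
    where
    pos? : ∀ ((x , y) : G.Carrier × H.Carrier) →
           (G.Pos x ⊎ (x G.≈ G.ε × H.Pos y)) ⊎ (x G.≈ G.ε × y H.≈ H.ε) ⊎ (G.Pos (x G.⁻¹) ⊎ (x G.⁻¹ G.≈ G.ε × H.Pos (y H.⁻¹)))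
    pos? (x , y) with G.pos? x | H.pos? y
    ... | inj₁ p        | _             = inj₁ (inj₁ p)
    ... | inj₂ (inj₂ n) | _             = inj₂ (inj₂ (inj₁ n))
    ... | inj₂ (inj₁ z) | inj₁ p        = inj₁ (inj₂ (z , p))
    ... | inj₂ (inj₁ z) | inj₂ (inj₁ w) = inj₂ (inj₁ (z , w))
    ... | inj₂ (inj₁ z) | inj₂ (inj₂ n) = inj₂ (inj₂ (inj₂ (G.trans (G.⁻¹-cong z) G.ε⁻¹≈ε , n)))

  lexicographic-divisible : Divisible G → Divisible H → Divisible lexicographic
  lexicographic-divisible div-G div-H n (x , x′) =
    let y , ny≈x = div-G n x ; y′ , ny′≈x′ = div-H n x′
    in (y , y′) , G.trans (proj₁ (componentwise (suc n))) ny≈x , H.trans (proj₂ (componentwise (suc n))) ny′≈x′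
    where
    componentwise : ∀ n {y y′} →
      proj₁ (Multiples._×ᴹ_ lexicographic n (y , y′)) G.≈ n ×G.×ᴹ y × proj₂ (Multiples._×ᴹ_ lexicographic n (y , y′)) H.≈ n ×H.×ᴹ y′
    componentwise zero    = G.refl , H.refl
    componentwise (suc n) = G.∙-congˡ (proj₁ (componentwise n)) , H.∙-congˡ (proj₂ (componentwise n))

-- A concave order automorphism: its slope drops from 2 to 1 at d.
module Bend (G : OrderedGroup) (divide : Divisible G) (d : OrderedGroup.Carrier G) where
  open OrderedGroup G
  open Multiples G using (<-irrefl; ∙-mono-<)

  halve : ∀ x → ∃ λ y → y ∙ y ≈ x
  halve x = let y , y∙[y∙ε]≈x = divide 1 x in y , trans (∙-congˡ (sym (identityʳ y))) y∙[y∙ε]≈x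

  abstract
    private
      -- This is min(x, d), so that `bend x` is x + min(x, d).
      slope : ∀ {x} → Dec (d < x) → Carrier
      slope     (yes _) = d
      slope {x} (no  _) = x

    bend : Carrier → Carrier
    bend x = x ∙ slope (Pos-dec (x - d))

    private
      slope-no : ∀ {x} (p : Dec (d < x)) → ¬ (d < x) → slope p ≈ x
      slope-no (yes p) n = contradiction p n
      slope-no (no  _) n = refl

      slope-yes : ∀ {x} (p : Dec (d < x)) → d < x → slope p ≈ d
      slope-yes (yes _) p = refl
      slope-yes (no  n) p = contradiction p n

      slope-cong : ∀ {x y} (p : Dec (d < x)) (q : Dec (d < y)) → x ≈ y → slope p ≈ slope q
      slope-cong (yes _) (yes _) x≈y = refl
      slope-cong (yes p) (no  n) x≈y = contradiction (<-resp refl x≈y p) n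
      slope-cong (no  n) (yes p) x≈y = contradiction (<-resp refl (sym x≈y) p) n
      slope-cong (no  _) (no  _) x≈y = x≈y

      slope-mono : ∀ {x y} (p : Dec (d < x)) (q : Dec (d < y)) → x < y → ¬ (slope q < slope p)
      slope-mono (yes _) (yes _) x<y = <-irrefl
      slope-mono (yes d<x) (no d≮y) x<y _ = d≮y (<-trans d<x x<y)
      slope-mono (no d≮x) (yes _) x<y = d≮x
      slope-mono (no _) (no _) x<y y<x = <-irrefl (<-trans x<y y<x)

    bend-small : ∀ x → ¬ (d < x) → bend x ≈ x ∙ x
    bend-small x d≮x = ∙-congˡ (slope-no (Pos-dec (x - d)) d≮x)

    bend-large : ∀ x → d < x → bend x ≈ x ∙ d
    bend-large x d<x = ∙-congˡ (slope-yes (Pos-dec (x - d)) d<x)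

    bend-cong : ∀ {x y} → x ≈ y → bend x ≈ bend y
    bend-cong {x} {y} x≈y = ∙-cong x≈y (slope-cong (Pos-dec (x - d)) (Pos-dec (y - d)) x≈y)

    bend-mono : ∀ {x y} → x < y → bend x < bend y
    bend-mono {x} {y} x<y = add x<y (slope-mono (Pos-dec (x - d)) (Pos-dec (y - d)) x<y)
      where
      add : ∀ {a b} → x < y → ¬ (b < a) → x ∙ a < y ∙ b
      add {a} {b} x<y b≮a = <-≮-trans
        (Pos-resp (abel (x ∷ y ∷ a ∷ []) (v₁ ⊞ neg v₀) ((v₁ ⊞ v₂) ⊞ neg (v₀ ⊞ v₂))) x<y)
        (λ p → b≮a (Pos-resp (abel (y ∷ a ∷ b ∷ []) ((v₀ ⊞ v₁) ⊞ neg (v₀ ⊞ v₂)) (v₁ ⊞ neg v₂)) p))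

    bend-surjective : ∀ y → ∃ λ x → bend x ≈ y
    -- 2 d is the value of `bend` at the kink: above it `bend` is a translation by d, up to it a
    -- doubling.
    bend-surjective y with Pos-dec (y - (d ∙ d))
    ... | yes 2d<y = y - d , trans (bend-large (y - d) d<y-d) (//-rightDividesˡ d y)
      where
      d<y-d : d < y - d
      d<y-d = Pos-resp (abel (y ∷ d ∷ []) (v₀ ⊞ neg (v₁ ⊞ v₁)) ((v₀ ⊞ neg v₁) ⊞ neg v₁)) 2d<y
    ... | no  2d≮y = let x , 2x≈y = halve y in
      x , trans (bend-small x (λ d<x → 2d≮y (<-resp refl 2x≈y (∙-mono-< d<x d<x)))) 2x≈y

-- A positive series is a t^γ (1 + w) for unique γ, a > 0 and w supported
-- on negative exponents.
module PositiveCone (ℝ : CompleteOrderedField) where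
  open OrderedField ℝ
  open RealGroups ℝ
  open Series ℝ
  open SetoidReasoning setoid
  private
    module V = OrderedGroup orderedGroup
    module R× = Multiples additive-group

  Infinitesimal : Sum → Set
  Infinitesimal v = ∀ δ → ¬ (δ < 0#) → coeff v δ ≈ 0#

  -1<0 : - 1# < 0#
  -1<0 = pos-neg (<-respʳ-≈ (sym (-‿involutive 1#)) 0<1)

  t⁻¹ : Sum
  t⁻¹ = (- 1# , 1#) ∷ []

  coeff-monomial : ∀ γ a {δ} → γ ≈ δ → coeff ((γ , a) ∷ []) δ ≈ a
  coeff-monomial γ a {δ} γ≈δ = trans (+-identityʳ _) (select-yes (γ ≟ δ) γ≈δ)

  coeff-monomial-0 : ∀ γ a {δ} → ¬ (γ ≈ δ) → coeff ((γ , a) ∷ []) δ ≈ 0#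
  coeff-monomial-0 γ a {δ} γ≉δ = trans (+-identityʳ _) (select-no (γ ≟ δ) γ≉δ)

  t⁻¹-leading : Leading t⁻¹
  t⁻¹-leading = leading (- 1#) (<-respʳ-≈ (sym (coeff-monomial _ _ refl)) 0<1)
    (λ p → coeff-monomial-0 _ _ (λ eq → <-irrefl eq p))

  t⁻¹-infinitesimal : Infinitesimal t⁻¹
  t⁻¹-infinitesimal δ δ≮0 = coeff-monomial-0 _ _ (λ eq → δ≮0 (<-respˡ-≈ eq -1<0))

  infinitesimals : OrderedGroup
  infinitesimals = Subgroup.orderedSubgroup {orderedGroup} record
    { Member    = Infinitesimal
    ; ∙-closed  = λ {v} {w} p q δ δ≮0 →
        trans (coeff-++ v w δ) (trans (+-cong (p δ δ≮0) (q δ δ≮0)) (+-identityˡ 0#))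
    ; ε-closed  = λ _ _ → refl
    ; ⁻¹-closed = λ {v} p δ δ≮0 → trans (coeff-negate v δ) (trans (-‿cong (p δ δ≮0)) -0#≈0#)
    ; inhabited = t⁻¹ , t⁻¹-leading , t⁻¹-infinitesimal
    }

  private module W = OrderedGroup infinitesimals

  ×-* : ∀ n x y → n R×.×ᴹ (x * y) ≈ (n R×.×ᴹ x) * y
  ×-* zero    x y = sym (zeroˡ y)
  ×-* (suc n) x y = trans (+-congˡ (×-* n x y)) (sym (distribʳ y _ _))

  infinitesimals-divisible : Divisible infinitesimals
  infinitesimals-divisible n (v , inf) = let c , nc≈1 = additive-divisible n 1# in
    (scaleBy c v , λ δ δ≮0 → trans (coeff-scaleBy c v δ) (trans (*-congˡ (inf δ δ≮0)) (zeroʳ c))) ,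
    coefficientwise λ δ → begin
      coeff (proj₁ (Multiples._×ᴹ_ infinitesimals (suc n) (scaleBy c v , _))) δ ≈⟨ coeff-× (suc n) (scaleBy c v , _) δ ⟩
      suc n R×.×ᴹ coeff (scaleBy c v) δ  ≈⟨ +-cong (coeff-scaleBy c v δ) (R×-cong n (coeff-scaleBy c v δ)) ⟩
      suc n R×.×ᴹ (c * coeff v δ)        ≈⟨ ×-* (suc n) c (coeff v δ) ⟩
      (suc n R×.×ᴹ c) * coeff v δ        ≈⟨ *-congʳ nc≈1 ⟩
      1# * coeff v δ                     ≈⟨ *-identityˡ _ ⟩
      coeff v δ                          ∎
    where
    R×-cong : ∀ n {x y} → x ≈ y → n R×.×ᴹ x ≈ n R×.×ᴹ y
    R×-cong n = R×.×-congʳ n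

    coeff-× : ∀ n w δ → coeff (proj₁ (Multiples._×ᴹ_ infinitesimals n w)) δ ≈ n R×.×ᴹ coeff (proj₁ w) δ
    coeff-× zero    w δ = refl
    coeff-× (suc n) w δ = trans (coeff-++ (proj₁ w) _ δ) (+-congˡ (coeff-× n w δ))

  -- A kink at a positive infinitesimal leaves 0 in the part where `bend` doubles, so that 1 is not
  -- moved, and makes the concavity visible infinitely close to 1.
  d : W.Carrier
  d = t⁻¹ , t⁻¹-infinitesimal

  open Bend infinitesimals infinitesimals-divisible d

  cone : OrderedGroup
  cone = lexicographic additive-group (lexicographic multiplicative-group infinitesimals)

  private module G = OrderedGroup cone

  cone-divisible : Divisible cone
  cone-divisible = lexicographic-divisible additive-group (lexicographic multiplicative-group infinitesimals) additive-divisible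
    (lexicographic-divisible multiplicative-group infinitesimals multiplicative-divisible infinitesimals-divisible)

  1+ : Sum → Sum
  1+ v = (0# , 1#) ∷ v

  monomialTimes : Carrier → Carrier → Sum → Sum
  monomialTimes a γ v = scaleBy a (shift γ v)

  coeff-monomialTimes : ∀ a γ v δ → coeff (monomialTimes a γ v) δ ≈ a * coeff v (δ - γ)
  coeff-monomialTimes a γ v δ = trans (coeff-scaleBy a (shift γ v) δ) (*-congˡ (coeff-shift γ v δ))

  -- The product of the model is carried over along this map, so w ↦ 1 + `bend w` plays the part of
  -- an exponential from W to the series infinitely close to 1.
  embed : G.Carrier → Sum
  embed (γ , (a , _) , w) = monomialTimes a γ (1+ (proj₁ (bend w)))

  1+-leading : ∀ v → Infinitesimal v → ∀ {δ} → δ ≈ 0# → coeff (1+ v) δ ≈ 1#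
  1+-leading v inf {δ} δ≈0 =
    trans (+-cong (select-yes (0# ≟ δ) (sym δ≈0)) (inf δ (<-irrefl δ≈0))) (+-identityʳ 1#)

  1+-beyond : ∀ v → Infinitesimal v → ∀ {δ} → 0# < δ → coeff (1+ v) δ ≈ 0#
  1+-beyond v inf {δ} 0<δ =
    trans (+-cong (select-no (0# ≟ δ) (λ eq → <-irrefl eq 0<δ)) (inf δ (<-asym 0<δ))) (+-identityʳ 0#)

  embed-leading : ∀ ((γ , p , w) : G.Carrier) {δ} → δ ≈ γ → coeff (embed (γ , p , w)) δ ≈ proj₁ p
  embed-leading (γ , (a , _) , w) {δ} δ≈γ = trans (coeff-monomialTimes a γ (1+ (proj₁ (bend w))) δ)
    (trans (*-congˡ (1+-leading (proj₁ (bend w)) (proj₂ (bend w)) (x≈y⇒x∙y⁻¹≈ε δ≈γ))) (*-identityʳ a))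

  embed-beyond : ∀ ((γ , p , w) : G.Carrier) {δ} → γ < δ → coeff (embed (γ , p , w)) δ ≈ 0#
  embed-beyond (γ , (a , _) , w) {δ} γ<δ = trans (coeff-monomialTimes a γ (1+ (proj₁ (bend w))) δ)
    (trans (*-congˡ (1+-beyond (proj₁ (bend w)) (proj₂ (bend w)) (x<y⇒0<y-x γ<δ))) (zeroʳ a))

  monomialTimes-cong : ∀ {a a′ γ γ′ v v′} → a ≈ a′ → γ ≈ γ′ → v ≋ v′ → monomialTimes a γ v ≋ monomialTimes a′ γ′ v′
  monomialTimes-cong {a} {a′} {γ} {γ′} {v} {v′} a≈ γ≈ v≋ = coefficientwise λ δ → begin
    coeff (monomialTimes a γ v) δ     ≈⟨ coeff-monomialTimes a γ v δ ⟩
    a * coeff v (δ - γ)               ≈⟨ *-cong a≈ (trans (at v≋ (δ - γ)) (coeff-cong v′ (+-congˡ (-‿cong γ≈)))) ⟩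
    a′ * coeff v′ (δ - γ′)            ≈⟨ coeff-monomialTimes a′ γ′ v′ δ ⟨
    coeff (monomialTimes a′ γ′ v′) δ  ∎

  1+-cong : ∀ {v v′} → v ≋ v′ → 1+ v ≋ 1+ v′
  1+-cong v≋ = coefficientwise λ δ → +-congˡ (at v≋ δ)

  embed-cong : ∀ {g g′} → g G.≈ g′ → embed g ≋ embed g′
  embed-cong {_ , _ , w} {_ , _ , w′} (γ≈ , a≈ , w≈) = monomialTimes-cong a≈ γ≈ (1+-cong (bend-cong {w} {w′} w≈))

  embed-positive : ∀ g → Leading (embed g)
  embed-positive g@(γ , (a , 0<a) , w) =
    leading γ (<-respʳ-≈ (sym (embed-leading g {γ} refl)) 0<a) (λ {δ} → embed-beyond g {δ})

  difference-leading : ∀ u v γ → coeff u γ < coeff v γ →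
                       (∀ {δ} → γ < δ → coeff u δ ≈ coeff v δ) → u V.< v
  difference-leading u v γ u<v beyond = leading γ
    (<-respʳ-≈ (sym (coeff-minus v u γ)) (x<y⇒0<y-x u<v))
    (λ {δ} γ<δ → trans (coeff-minus v u δ) (x≈y⇒x∙y⁻¹≈ε (sym (beyond γ<δ))))

  e+x-[e+y]≈x-y : ∀ e x y → e + x - (e + y) ≈ x - y
  e+x-[e+y]≈x-y e x y = byRing (e ∷ x ∷ y ∷ []) (x₀ :+ x₁ :- (x₀ :+ x₂)) (x₁ :- x₂) ≡.refl

  x+y-y≈x : ∀ x y → x + y - y ≈ x
  x+y-y≈x x y = byRing (x ∷ y ∷ []) (x₀ :+ x₁ :- x₁) x₀ ≡.refl

  x-y+y≈x : ∀ x y → x - y + y ≈ x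
  x-y+y≈x x y = byRing (x ∷ y ∷ []) (x₀ :- x₁ :+ x₁) x₀ ≡.refl

  x+[y-x]≈y : ∀ x y → x + (y - x) ≈ y
  x+[y-x]≈y x y = byRing (x ∷ y ∷ []) (x₀ :+ (x₁ :- x₀)) x₁ ≡.refl

  1+-mono : ∀ u v → u V.< v → 1+ u V.< 1+ v
  1+-mono u v = V.Pos-resp (coefficientwise λ δ → begin
    coeff (v ++ negate u) δ                               ≈⟨ coeff-minus v u δ ⟩
    coeff v δ - coeff u δ                                 ≈⟨ e+x-[e+y]≈x-y (select (0# ≟ δ) 1#) _ _ ⟨
    coeff (1+ v) δ - coeff (1+ u) δ                       ≈⟨ coeff-minus (1+ v) (1+ u) δ ⟨
    coeff (1+ v ++ negate (1+ u)) δ                       ∎)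

  monomialTimes-mono : ∀ {a} γ u v → 0# < a → u V.< v → monomialTimes a γ u V.< monomialTimes a γ v
  monomialTimes-mono {a} γ u v 0<a (leading η 0<c beyond) = leading (η + γ)
    (<-respʳ-≈ (sym (trans (difference (η + γ)) (*-congˡ (coeff-cong (v ++ negate u) (x+y-y≈x η γ))))) (*-pos 0<a 0<c))
    (λ {δ} η+γ<δ → trans (difference δ)
      (trans (*-congˡ (beyond (<-respˡ-≈ (x+y-y≈x η γ) (+-monoˡ-< (- γ) η+γ<δ)))) (zeroʳ a)))
    where
    difference : ∀ δ → coeff (monomialTimes a γ v ++ negate (monomialTimes a γ u)) δ ≈ a * coeff (v ++ negate u) (δ - γ)
    difference δ = begin
      coeff (monomialTimes a γ v ++ negate (monomialTimes a γ u)) δ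
        ≈⟨ coeff-minus (monomialTimes a γ v) (monomialTimes a γ u) δ ⟩
      coeff (monomialTimes a γ v) δ - coeff (monomialTimes a γ u) δ
        ≈⟨ +-cong (coeff-monomialTimes a γ v δ) (-‿cong (coeff-monomialTimes a γ u δ)) ⟩
      a * coeff v (δ - γ) - a * coeff u (δ - γ)
        ≈⟨ +-congˡ (-‿distribʳ-* a _) ⟩
      a * coeff v (δ - γ) + a * - coeff u (δ - γ)
        ≈⟨ distribˡ a _ _ ⟨
      a * (coeff v (δ - γ) - coeff u (δ - γ))
        ≈⟨ *-congˡ (coeff-minus v u (δ - γ)) ⟨
      a * coeff (v ++ negate u) (δ - γ) ∎

  -- The lexicographic order of the coordinates mirrors the comparison of series: first the
  -- exponents, then the leading coefficients, then the infinitesimal tails, where monotonicity of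
  -- `bend` enters.
  embed-mono : ∀ {g g′} → g G.< g′ → embed g V.< embed g′
  embed-mono {g@(γ , (a , 0<a) , w)} {g′@(γ′ , (a′ , 0<a′) , w′)} (inj₁ 0<γ′-γ) =
    difference-leading (embed g) (embed g′) γ′
      (<-respˡ-≈ (sym (embed-beyond g γ<γ′)) (<-respʳ-≈ (sym (embed-leading g′ refl)) 0<a′))
      (λ γ′<δ → trans (embed-beyond g (<-trans γ<γ′ γ′<δ)) (sym (embed-beyond g′ γ′<δ)))
    where γ<γ′ = 0<y-x⇒x<y 0<γ′-γ
  embed-mono {g@(γ , p@(a , 0<a) , w)} {g′@(γ′ , p′@(a′ , 0<a′) , w′)} (inj₂ (γ′-γ≈0 , inj₁ a<a′)) =
    difference-leading (embed g) (embed g′) γ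
      (<-respˡ-≈ (sym (embed-leading g refl)) (<-respʳ-≈ (sym (embed-leading g′ γ≈γ′)) (multiplicative-<⁻ p p′ a<a′)))
      (λ γ<δ → trans (embed-beyond g γ<δ) (sym (embed-beyond g′ (<-respˡ-≈ γ≈γ′ γ<δ))))
    where γ≈γ′ = sym (x∙y⁻¹≈ε⇒x≈y γ′ γ γ′-γ≈0)
  embed-mono {(γ , p@(a , 0<a) , w)} {(γ′ , p′@(a′ , 0<a′) , w′)} (inj₂ (γ′-γ≈0 , inj₂ (a′/a≈1 , w<w′))) =
    V.<-resp {monomialTimes a γ (1+ k)} {monomialTimes a γ (1+ k)} {monomialTimes a γ (1+ k′)} {monomialTimes a′ γ′ (1+ k′)}
      V.refl (V.sym (monomialTimes-cong {v = 1+ k′} {1+ k′} a′≈a γ′≈γ V.refl))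
      (monomialTimes-mono γ (1+ k) (1+ k′) 0<a (1+-mono k k′ (bend-mono {w} {w′} w<w′)))
    where
    k  = proj₁ (bend w)
    k′ = proj₁ (bend w′)

    γ′≈γ : γ′ ≈ γ
    γ′≈γ = x∙y⁻¹≈ε⇒x≈y γ′ γ γ′-γ≈0

    a′≈a : a′ ≈ a
    a′≈a = OrderedGroup.x∙y⁻¹≈ε⇒x≈y multiplicative-group p′ p a′/a≈1

  -- Dividing v by its leading term and subtracting 1 leaves an infinitesimal, and `bend` attains
  -- every infinitesimal.
  embed-surjective : ∀ v → Leading v → ∃ λ g → embed g ≋ v
  embed-surjective v (leading γ 0<c beyond) =
    (γ , (c , 0<c) , proj₁ preimage) , coefficientwise λ δ → begin
      coeff (monomialTimes c γ (1+ (proj₁ (bend (proj₁ preimage))))) δ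
        ≈⟨ at (monomialTimes-cong {v′ = 1+ tail} refl refl (1+-cong (proj₂ preimage))) δ ⟩
      coeff (monomialTimes c γ (1+ tail)) δ
        ≈⟨ coeff-monomialTimes c γ (1+ tail) δ ⟩
      c * coeff (1+ tail) (δ - γ)
        ≈⟨ *-congˡ (trans (+-congˡ (trans (coeff-tail (δ - γ)) (+-congˡ (-‿cong (+-identityʳ _))))) (x+[y-x]≈y _ _)) ⟩
      c * (recip 0<c * coeff v (δ - γ + γ))
        ≈⟨ *-assoc c _ _ ⟨
      c * recip 0<c * coeff v (δ - γ + γ)
        ≈⟨ *-cong (recip-inverse 0<c) (coeff-cong v (x-y+y≈x δ γ)) ⟩
      1# * coeff v δ
        ≈⟨ *-identityˡ _ ⟩
      coeff v δ ∎
    where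
    c = coeff v γ

    tail : Sum
    tail = monomialTimes (recip 0<c) (- γ) v ++ negate (1+ [])

    coeff-tail : ∀ δ → coeff tail δ ≈ recip 0<c * coeff v (δ + γ) - coeff (1+ []) δ
    coeff-tail δ = trans (coeff-minus (monomialTimes (recip 0<c) (- γ) v) (1+ []) δ)
      (+-congʳ (trans (coeff-monomialTimes (recip 0<c) (- γ) v δ) (*-congˡ (coeff-cong v (+-congˡ (-‿involutive γ))))))

    tail-infinitesimal : Infinitesimal tail
    tail-infinitesimal δ δ≮0 = trans (coeff-tail δ) (vanish (compare 0# δ))
      where
      vanish : Tri (0# < δ) (0# ≈ δ) (δ < 0#) → recip 0<c * coeff v (δ + γ) - coeff (1+ []) δ ≈ 0#
      vanish (tri< 0<δ _ _) = x≈y⇒x∙y⁻¹≈ε (trans (trans (*-congˡ (beyond γ<δ+γ)) (zeroʳ _))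
        (sym (1+-beyond [] (λ _ _ → refl) 0<δ)))
        where
        γ<δ+γ : γ < δ + γ
        γ<δ+γ = <-respˡ-≈ (+-identityˡ γ) (+-monoˡ-< γ 0<δ)
      vanish (tri≈ _ 0≈δ _) = x≈y⇒x∙y⁻¹≈ε (trans
        (trans (*-congˡ (coeff-cong v (trans (+-congʳ (sym 0≈δ)) (+-identityˡ γ)))) (trans (*-comm _ c) (recip-inverse 0<c)))
        (sym (1+-leading [] (λ _ _ → refl) (sym 0≈δ))))
      vanish (tri> _ _ δ<0) = contradiction δ<0 δ≮0

    preimage = bend-surjective (tail , tail-infinitesimal)

  -- A constant factor changes the coefficient coordinate only, so it never meets the distortion.
  -- Therefore f_a can be multiplication by a constant in one reduct and scalar multiplication in
  -- the other.
  embed-scale : ∀ c (0<c : 0# < c) g → embed ((0# , (c , 0<c) , W.ε) G.∙ g) ≋ scaleBy c (embed g)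
  embed-scale c 0<c (γ , (a , 0<a) , w) = coefficientwise λ δ → begin
    coeff (monomialTimes (c * a) (0# + γ) (1+ (proj₁ (bend (W.ε W.∙ w))))) δ
      ≈⟨ at (embed-cong {(0# , (c , 0<c) , W.ε) G.∙ (γ , (a , 0<a) , w)} {γ , (c * a , *-pos 0<c 0<a) , w}
               (+-identityˡ γ , refl , W.identityˡ w)) δ ⟩
    coeff (monomialTimes (c * a) γ (1+ (proj₁ (bend w)))) δ
      ≈⟨ coeff-monomialTimes (c * a) γ (1+ (proj₁ (bend w))) δ ⟩
    c * a * coeff (1+ (proj₁ (bend w))) (δ - γ)
      ≈⟨ *-assoc c a _ ⟩
    c * (a * coeff (1+ (proj₁ (bend w))) (δ - γ))
      ≈⟨ *-congˡ (coeff-monomialTimes a γ (1+ (proj₁ (bend w))) δ) ⟨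
    c * coeff (embed (γ , (a , 0<a) , w)) δ
      ≈⟨ coeff-scaleBy c (embed (γ , (a , 0<a) , w)) δ ⟨
    coeff (scaleBy c (embed (γ , (a , 0<a) , w))) δ ∎

  embed-unit : ∀ w → embed (0# , (1# , 0<1) , w) ≋ 1+ (proj₁ (bend w))
  embed-unit w = coefficientwise λ δ → begin
    coeff (embed (0# , (1# , 0<1) , w)) δ      ≈⟨ coeff-monomialTimes 1# 0# (1+ (proj₁ (bend w))) δ ⟩
    1# * coeff (1+ (proj₁ (bend w))) (δ - 0#)  ≈⟨ *-identityˡ _ ⟩
    coeff (1+ (proj₁ (bend w))) (δ - 0#)       ≈⟨ coeff-cong (1+ (proj₁ (bend w))) (trans (+-congˡ -0#≈0#) (+-identityʳ δ)) ⟩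
    coeff (1+ (proj₁ (bend w))) δ              ∎

  -- `bend` fixes 0, since 0 lies below the kink; thus both reducts have the same 1.
  embed-1 : embed G.ε ≋ 1+ []
  embed-1 = V.trans (embed-unit W.ε) (1+-cong (bend-small W.ε λ d<0 → Wᴹ.<-irrefl {W.ε}
    (W.<-trans {W.ε} {d} {W.ε} (V.Pos-resp {t⁻¹} {t⁻¹ ++ negate []} (coefficientwise λ δ → refl) t⁻¹-leading) d<0)))
    where module Wᴹ = Multiples infinitesimals

  -- The point of failure, equal to 1 + 2 t⁻¹ as a series. Its infinitesimal coordinate d sits at
  -- the kink, so its square has coordinate 2 d beyond the kink and equals 1 + 3 t⁻¹, where doubling
  -- throughout would give 1 + 4 t⁻¹.
  root : G.Carrier
  root = 0# , (1# , 0<1) , d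

  embed-root : embed root ≋ 1+ (t⁻¹ ++ t⁻¹)
  embed-root = V.trans (embed-unit d) (1+-cong (bend-small d (Multiples.<-irrefl infinitesimals {d})))

  embed-root² : embed (root G.∙ root) ≋ 1+ ((t⁻¹ ++ t⁻¹) ++ t⁻¹)
  embed-root² = V.trans (embed-cong {root G.∙ root} {0# , (1# , 0<1) , d W.∙ d} (+-identityˡ 0# , *-identityˡ 1# , W.refl {d W.∙ d}))
    (V.trans (embed-unit (d W.∙ d)) (1+-cong (bend-large (d W.∙ d) d<2d)))
    where
    d<2d : d W.< d W.∙ d
    d<2d = V.Pos-resp (V.abel (t⁻¹ ∷ []) v₀ ((v₀ ⊞ v₀) ⊞ neg v₀)) t⁻¹-leading

-- Adjoining signs and a zero to an ordered group

infixl 7 _⊛_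

_⊛_ : Sign → Sign → Sign
neg ⊛ neg = pos
neg ⊛ zer = zer
neg ⊛ pos = neg
zer ⊛ _   = zer
pos ⊛ τ   = τ

⊛-zeroʳ : ∀ σ → σ ⊛ zer ≡ zer
⊛-zeroʳ neg = ≡.refl
⊛-zeroʳ zer = ≡.refl
⊛-zeroʳ pos = ≡.refl

-- How (σ , g) < (τ , h) depends on the sign ρ of g − h.
data SignedLess : Sign → Sign → Sign → Set where
  neg<zer : ∀ {ρ} → SignedLess neg zer ρ
  neg<pos : ∀ {ρ} → SignedLess neg pos ρ
  zer<pos : ∀ {ρ} → SignedLess zer pos ρ
  neg<neg : SignedLess neg neg pos
  pos<pos : SignedLess pos pos neg

SignedEqual : Sign → Sign → Sign → Set
SignedEqual σ τ ρ = σ ≡ τ × (σ ≡ zer ⊎ ρ ≡ zer)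

-- The group of elements ± g together with a zero, (zer , g) being zero for
-- every g.
module Signed (G : OrderedGroup) where
  private module G = OrderedGroup G

  Carrier : Set
  Carrier = Sign × G.Carrier

  infix 4 _≈ˢ_ _<ˢ_

  record _≈ˢ_ (x y : Carrier) : Set where
    constructor _,ˢ_
    field
      signs  : proj₁ x ≡ proj₁ y
      values : proj₁ x ≡ zer ⊎ proj₂ x G.≈ proj₂ y

  record _<ˢ_ (x y : Carrier) : Set where
    constructor lessˢ
    field
      {ρ}     : Sign
      hasSign : G.HasSign ρ (proj₂ x G.- proj₂ y)
      table   : SignedLess (proj₁ x) (proj₁ y) ρ

  setoid : Setoid 0ℓ 0ℓ
  setoid = record
    { Carrier = Carrier
    ; _≈_     = _≈ˢ_
    ; isEquivalence = record
      { refl  = ≡.refl ,ˢ inj₂ G.refl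
      ; sym   = λ { (≡.refl ,ˢ inj₁ z) → ≡.refl ,ˢ inj₁ z ; (≡.refl ,ˢ inj₂ p) → ≡.refl ,ˢ inj₂ (G.sym p) }
      ; trans = λ { (≡.refl ,ˢ inj₁ z) (≡.refl ,ˢ _)      → ≡.refl ,ˢ inj₁ z
                  ; (≡.refl ,ˢ inj₂ _) (≡.refl ,ˢ inj₁ z) → ≡.refl ,ˢ inj₁ z
                  ; (≡.refl ,ˢ inj₂ p) (≡.refl ,ˢ inj₂ q) → ≡.refl ,ˢ inj₂ (G.trans p q) }
      }
    }

  infixl 7 _*ˢ_ _÷ˢ_

  -- One sign table serves both operations: a nonzero sign is its own inverse, and a zero divisor
  -- yields zero in accordance with x ÷ 0 = 0.
  _*ˢ_ _÷ˢ_ : Carrier → Carrier → Carrier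
  (σ , g) *ˢ (τ , h) = σ ⊛ τ , g G.∙ h
  (σ , g) ÷ˢ (τ , h) = σ ⊛ τ , g G.- h

  private
    ⊛-cong : ∀ {σ τ} {x x′ y y′ : G.Carrier} (f : G.Carrier → G.Carrier → G.Carrier) →
             (x G.≈ x′ → y G.≈ y′ → f x y G.≈ f x′ y′) →
             σ ≡ zer ⊎ x G.≈ x′ → τ ≡ zer ⊎ y G.≈ y′ → σ ⊛ τ ≡ zer ⊎ f x y G.≈ f x′ y′
    ⊛-cong f f-cong (inj₁ ≡.refl) _ = inj₁ ≡.refl
    ⊛-cong {σ} f f-cong (inj₂ _) (inj₁ ≡.refl) = inj₁ (⊛-zeroʳ σ)
    ⊛-cong f f-cong (inj₂ p) (inj₂ q) = inj₂ (f-cong p q)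

  *ˢ-cong : ∀ {x x′ y y′} → x ≈ˢ x′ → y ≈ˢ y′ → x *ˢ y ≈ˢ x′ *ˢ y′
  *ˢ-cong (≡.refl ,ˢ p) (≡.refl ,ˢ q) = ≡.refl ,ˢ ⊛-cong G._∙_ G.∙-cong p q

  ÷ˢ-cong : ∀ {x x′ y y′} → x ≈ˢ x′ → y ≈ˢ y′ → x ÷ˢ y ≈ˢ x′ ÷ˢ y′
  ÷ˢ-cong (≡.refl ,ˢ p) (≡.refl ,ˢ q) = ≡.refl ,ˢ ⊛-cong G._-_ (λ p q → G.∙-cong p (G.⁻¹-cong q)) p q

  bySigns : ∀ {σ τ g h} → (∀ {ρ} → SignedLess σ τ ρ) → (σ , g) <ˢ (τ , h)
  bySigns {g = g} {h} table = let ρ , p = G.sign (g G.- h) in lessˢ {ρ = ρ} p table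

  compareˢ : ∀ x y → x <ˢ y ⊎ x ≈ˢ y ⊎ y <ˢ x
  compareˢ (neg , g) (neg , h) with G.sign (g G.- h)
  ... | neg , p = inj₂ (inj₂ (lessˢ {ρ = pos} (G.Pos-resp (G.⁻¹-anti-homo‿- g h) p) neg<neg))
  ... | zer , p = inj₂ (inj₁ (≡.refl ,ˢ inj₂ (G.x∙y⁻¹≈ε⇒x≈y g h p)))
  ... | pos , p = inj₁ (lessˢ p neg<neg)
  compareˢ (neg , g) (zer , h) = inj₁ (bySigns neg<zer)
  compareˢ (neg , g) (pos , h) = inj₁ (bySigns neg<pos)
  compareˢ (zer , g) (neg , h) = inj₂ (inj₂ (bySigns neg<zer))
  compareˢ (zer , g) (zer , h) = inj₂ (inj₁ (≡.refl ,ˢ inj₁ ≡.refl))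
  compareˢ (zer , g) (pos , h) = inj₁ (bySigns zer<pos)
  compareˢ (pos , g) (neg , h) = inj₂ (inj₂ (bySigns neg<pos))
  compareˢ (pos , g) (zer , h) = inj₂ (inj₂ (bySigns zer<pos))
  compareˢ (pos , g) (pos , h) with G.sign (g G.- h)
  ... | neg , p = inj₁ (lessˢ {ρ = neg} p pos<pos)
  ... | zer , p = inj₂ (inj₁ (≡.refl ,ˢ inj₂ (G.x∙y⁻¹≈ε⇒x≈y g h p)))
  ... | pos , p = inj₂ (inj₂ (lessˢ {ρ = neg} (G.Pos-resp (G.sym (G.⁻¹-anti-homo‿- h g)) p) pos<pos))

  ≈ˢ⇒SignedEqual : ∀ {x y ρ} → G.HasSign ρ (proj₂ x G.- proj₂ y) → x ≈ˢ y → SignedEqual (proj₁ x) (proj₁ y) ρ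
  ≈ˢ⇒SignedEqual         p (eq ,ˢ inj₁ z)   = eq , inj₁ z
  ≈ˢ⇒SignedEqual {ρ = ρ} p (eq ,ˢ inj₂ x≈y) = eq , inj₂ (G.HasSign-unique ρ zer p (G.x≈y⇒x∙y⁻¹≈ε x≈y))

  SignedEqual⇒≈ˢ : ∀ {x y ρ} → G.HasSign ρ (proj₂ x G.- proj₂ y) → SignedEqual (proj₁ x) (proj₁ y) ρ → x ≈ˢ y
  SignedEqual⇒≈ˢ p (eq , inj₁ z)      = eq ,ˢ inj₁ z
  SignedEqual⇒≈ˢ p (eq , inj₂ ≡.refl) = eq ,ˢ inj₂ (G.x∙y⁻¹≈ε⇒x≈y _ _ p)

  <ˢ⇒SignedLess : ∀ {x y ρ} → G.HasSign ρ (proj₂ x G.- proj₂ y) → x <ˢ y → SignedLess (proj₁ x) (proj₁ y) ρ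
  <ˢ⇒SignedLess {ρ = ρ} p (lessˢ {ρ = ρ′} q table) with G.HasSign-unique ρ ρ′ p q
  ... | ≡.refl = table

-- Only the orders are compared. G carries the product and H the sum, so no compatibility of the
-- group operations is asked.
record ConeEmbedding (G H : OrderedGroup) : Set where
  private
    module G = OrderedGroup G
    module H = OrderedGroup H
  field
    embedding  : G.Carrier → H.Carrier
    positive   : ∀ g → H.Pos (embedding g)
    cong       : ∀ {g g′} → g G.≈ g′ → embedding g H.≈ embedding g′
    mono       : ∀ {g g′} → g G.< g′ → embedding g H.< embedding g′
    surjective : ∀ h → H.Pos h → ∃ λ g → embedding g H.≈ h

module SignedEmbedding {G H : OrderedGroup} (E : ConeEmbedding G H) where
  private
    module G = OrderedGroup G
    module H = OrderedGroup H
  open ConeEmbedding E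
    renaming (embedding to e; positive to e-Pos; cong to e-cong; mono to e-mono; surjective to e-surjective)
  open Signed G
  open Multiples H using (<-irrefl)

  signed : Carrier → H.Carrier
  signed (neg , g) = e g H.⁻¹
  signed (zer , g) = H.ε
  signed (pos , g) = e g

  signed-cong : ∀ {x y} → x ≈ˢ y → signed x H.≈ signed y
  signed-cong {neg , _} (≡.refl ,ˢ inj₂ p) = H.⁻¹-cong (e-cong p)
  signed-cong {zer , _} (≡.refl ,ˢ _)      = H.refl
  signed-cong {pos , _} (≡.refl ,ˢ inj₂ p) = e-cong p

  signed-mono : ∀ {x y} → x <ˢ y → signed x H.< signed y
  signed-mono {_ , g} {_ , h} (lessˢ p neg<zer) = H.Pos-resp (H.abel (e g ∷ []) v₀ (null ⊞ neg (neg v₀))) (e-Pos g)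
  signed-mono {_ , g} {_ , h} (lessˢ p neg<pos) =
    H.Pos-resp (H.abel (e g ∷ e h ∷ []) (v₁ ⊞ v₀) (v₁ ⊞ neg (neg v₀))) (H.Pos-∙ (e-Pos h) (e-Pos g))
  signed-mono {_ , g} {_ , h} (lessˢ p zer<pos) = H.Pos-resp (H.abel (e h ∷ []) v₀ (v₀ ⊞ neg null)) (e-Pos h)
  signed-mono {_ , g} {_ , h} (lessˢ p neg<neg) =
    H.Pos-resp (H.abel (e g ∷ e h ∷ []) (v₀ ⊞ neg v₁) (neg v₁ ⊞ neg (neg v₀))) (e-mono p)
  signed-mono {_ , g} {_ , h} (lessˢ p pos<pos) = e-mono (G.Pos-resp (G.⁻¹-anti-homo‿- g h) p)

  private
    <⇒≉ : ∀ {x y} → x H.< y → ¬ (x H.≈ y)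
    <⇒≉ x<y x≈y = <-irrefl (H.<-resp x≈y H.refl x<y)

  -- Since the signed elements are compared by `compareˢ`, strict monotonicity alone gives
  -- injectivity, and below also the reflection of the order.
  signed-injective : ∀ {x y} → signed x H.≈ signed y → x ≈ˢ y
  signed-injective {x} {y} eq with compareˢ x y
  ... | inj₁ x<y        = contradiction eq (<⇒≉ (signed-mono x<y))
  ... | inj₂ (inj₁ x≈y) = x≈y
  ... | inj₂ (inj₂ y<x) = contradiction (H.sym eq) (<⇒≉ (signed-mono y<x))

  signed-reflects-< : ∀ {x y} → signed x H.< signed y → x <ˢ y
  signed-reflects-< {x} {y} lt with compareˢ x y
  ... | inj₁ x<y        = x<y
  ... | inj₂ (inj₁ x≈y) = contradiction (signed-cong x≈y) (<⇒≉ lt)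
  ... | inj₂ (inj₂ y<x) = contradiction (H.<-trans lt (signed-mono y<x)) <-irrefl

  signed-surjective : ∀ h → ∃ λ x → signed x H.≈ h
  signed-surjective h with H.pos? h
  ... | inj₁ p        = let g , eq = e-surjective h p in (pos , g) , eq
  ... | inj₂ (inj₁ z) = (zer , G.ε) , H.sym z
  ... | inj₂ (inj₂ n) = let g , eq = e-surjective (h H.⁻¹) n in
    (neg , g) , H.trans (H.⁻¹-cong eq) (H.⁻¹-involutive h)

-- The linear schemes and the coordinates of the reals

module Models {ℝ : CompleteOrderedField} (F : Subfield ℝ) where
  open OrderedField ℝ
  open RealGroups ℝ
  open Series ℝ
  open PositiveCone ℝ
  open Subfield F
  open SetoidReasoning setoid
  private module P = OrderedGroup multiplicative-group

  field-coefficients : Coefficients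
  field-coefficients = record
    { K            = Element
    ; _⊕_          = λ (a , p) (b , q) → a + b , +-closed p q
    ; _⊗_          = λ (a , p) (b , q) → a * b , *-closed p q
    ; ⊖_           = λ (a , p) → - a , neg-closed p
    ; 𝟘            = 0# , 0-closed
    ; 𝟙            = 1# , 1-closed
    ; Null         = λ k → value k ≈ 0#
    ; Positive     = λ k → 0# < value k
    ; null-𝟘       = refl
    ; positive-𝟙⊕𝟙 = +-pos 0<1 0<1
    ; sign?        = λ k → OrderedGroup.pos? additive-group (value k)
    }

  additive-action : OrderedAction field-coefficients additive-group
  additive-action = record
    { action = record
      { _·_        = λ k x → value k * x
      ; ·-congˡ    = *-congˡ
      ; ·-distribˡ = λ k → distribˡ (value k)
      ; ·-distribʳ = λ k l x → distribʳ x (value k) (value l)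
      ; ·-assoc    = λ k l → *-assoc (value k) (value l)
      ; ·-comm     = λ k l x → trans (sym (*-assoc _ _ x)) (trans (*-congʳ (*-comm _ _)) (*-assoc _ _ x))
      ; ⊖-·        = λ k x → sym (-‿distribˡ-* (value k) x)
      ; 𝟙-·        = *-identityˡ
      ; null-·     = λ k≈0 x → trans (*-congʳ k≈0) (zeroˡ x)
      }
    ; ·-Pos     = *-pos
    ; divisible = λ 0<k x → recip 0<k * x ,
        trans (sym (*-assoc _ _ x)) (trans (*-congʳ (recip-inverse 0<k)) (*-identityˡ x))
    }

  series-action : OrderedAction field-coefficients orderedGroup
  series-action = record
    { action = record
      { _·_        = λ k → scaleBy (value k)
      ; ·-congˡ    = λ {k} {v} {w} eq → coefficientwise λ δ →
          trans (coeff-scaleBy (value k) v δ) (trans (*-congˡ (at eq δ)) (sym (coeff-scaleBy (value k) w δ)))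
      ; ·-distribˡ = λ k v w → coefficientwise λ δ → begin
          coeff (scaleBy (value k) (v ++ w)) δ                  ≈⟨ coeff-scaleBy (value k) (v ++ w) δ ⟩
          value k * coeff (v ++ w) δ                            ≈⟨ *-congˡ (coeff-++ v w δ) ⟩
          value k * (coeff v δ + coeff w δ)                     ≈⟨ distribˡ (value k) _ _ ⟩
          value k * coeff v δ + value k * coeff w δ             ≈⟨ +-cong (coeff-scaleBy (value k) v δ) (coeff-scaleBy (value k) w δ) ⟨
          coeff (scaleBy (value k) v) δ + coeff (scaleBy (value k) w) δ ≈⟨ coeff-++ (scaleBy (value k) v) (scaleBy (value k) w) δ ⟨
          coeff (scaleBy (value k) v ++ scaleBy (value k) w) δ  ∎
      ; ·-distribʳ = λ k l v → coefficientwise λ δ → begin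
          coeff (scaleBy (value k + value l) v) δ               ≈⟨ coeff-scaleBy (value k + value l) v δ ⟩
          (value k + value l) * coeff v δ                       ≈⟨ distribʳ (coeff v δ) (value k) (value l) ⟩
          value k * coeff v δ + value l * coeff v δ             ≈⟨ +-cong (coeff-scaleBy (value k) v δ) (coeff-scaleBy (value l) v δ) ⟨
          coeff (scaleBy (value k) v) δ + coeff (scaleBy (value l) v) δ ≈⟨ coeff-++ (scaleBy (value k) v) (scaleBy (value l) v) δ ⟨
          coeff (scaleBy (value k) v ++ scaleBy (value l) v) δ  ∎
      ; ·-assoc    = λ k l v → coefficientwise λ δ → begin
          coeff (scaleBy (value k * value l) v) δ               ≈⟨ coeff-scaleBy (value k * value l) v δ ⟩
          value k * value l * coeff v δ                         ≈⟨ *-assoc _ _ _ ⟩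
          value k * (value l * coeff v δ)                       ≈⟨ scaleBy-twice (value k) (value l) v δ ⟨
          coeff (scaleBy (value k) (scaleBy (value l) v)) δ     ∎
      ; ·-comm     = λ k l v → coefficientwise λ δ → begin
          coeff (scaleBy (value k) (scaleBy (value l) v)) δ     ≈⟨ scaleBy-twice (value k) (value l) v δ ⟩
          value k * (value l * coeff v δ)                       ≈⟨ *-assoc _ _ _ ⟨
          value k * value l * coeff v δ                         ≈⟨ *-congʳ (*-comm _ _) ⟩
          value l * value k * coeff v δ                         ≈⟨ *-assoc _ _ _ ⟩
          value l * (value k * coeff v δ)                       ≈⟨ scaleBy-twice (value l) (value k) v δ ⟨
          coeff (scaleBy (value l) (scaleBy (value k) v)) δ     ∎
      ; ⊖-·        = λ k v → coefficientwise λ δ → begin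
          coeff (scaleBy (- value k) v) δ                       ≈⟨ coeff-scaleBy (- value k) v δ ⟩
          - value k * coeff v δ                                 ≈⟨ -‿distribˡ-* (value k) _ ⟨
          - (value k * coeff v δ)                               ≈⟨ -‿cong (coeff-scaleBy (value k) v δ) ⟨
          - coeff (scaleBy (value k) v) δ                       ≈⟨ coeff-negate (scaleBy (value k) v) δ ⟨
          coeff (negate (scaleBy (value k) v)) δ                ∎
      ; 𝟙-·        = λ v → coefficientwise λ δ → trans (coeff-scaleBy 1# v δ) (*-identityˡ _)
      ; null-·     = λ {k} k≈0 v → coefficientwise λ δ →
          trans (coeff-scaleBy (value k) v δ) (trans (*-congʳ k≈0) (zeroˡ _))
      }
    ; ·-Pos     = λ {k} {v} 0<k (leading γ 0<c beyond) → leading γ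
        (<-respʳ-≈ (sym (coeff-scaleBy (value k) v γ)) (*-pos 0<k 0<c))
        (λ {δ} γ<δ → trans (coeff-scaleBy (value k) v δ) (trans (*-congˡ (beyond γ<δ)) (zeroʳ _)))
    ; divisible = λ {k} 0<k v → scaleBy (recip 0<k) v , coefficientwise λ δ → begin
        coeff (scaleBy (value k) (scaleBy (recip 0<k) v)) δ     ≈⟨ scaleBy-twice (value k) (recip 0<k) v δ ⟩
        value k * (recip 0<k * coeff v δ)                       ≈⟨ *-assoc _ _ _ ⟨
        value k * recip 0<k * coeff v δ                         ≈⟨ *-congʳ (recip-inverse 0<k) ⟩
        1# * coeff v δ                                          ≈⟨ *-identityˡ _ ⟩
        coeff v δ                                               ∎
    }
    where
    scaleBy-twice : ∀ a b v δ → coeff (scaleBy a (scaleBy b v)) δ ≈ a * (b * coeff v δ)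
    scaleBy-twice a b v δ = trans (coeff-scaleBy a (scaleBy b v) δ) (*-congˡ (coeff-scaleBy b v δ))

  real : Sign → Carrier
  real neg = - 1#
  real zer = 0#
  real pos = 1#

  real-⊛ : ∀ σ τ → real (σ ⊛ τ) ≈ real σ * real τ
  real-⊛ neg neg = sym (trans (-1*x≈-x (- 1#)) (-‿involutive 1#))
  real-⊛ neg zer = sym (zeroʳ _)
  real-⊛ neg pos = sym (*-identityʳ _)
  real-⊛ zer τ   = sym (zeroˡ _)
  real-⊛ pos τ   = sym (*-identityˡ _)

  polar : ∀ x → ∃ λ σ → ∃ λ (p : Positives) → x ≈ real σ * proj₁ p
  polar x with compare 0# x
  ... | tri< 0<x _ _ = pos , (x , 0<x) , sym (*-identityˡ x)
  -- Zero gets the default magnitude 1, which its sign makes invisible.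
  ... | tri≈ _ 0≈x _ = zer , (1# , 0<1) , trans (sym 0≈x) (sym (zeroˡ _))
  ... | tri> _ _ x<0 = neg , (- x , neg-pos x<0) , sym (trans (-1*x≈-x (- x)) (-‿involutive x))

  signum : Element → Sign
  signum a = proj₁ (polar (value a))

  magnitude : Element → Positives
  magnitude a = proj₁ (proj₂ (polar (value a)))

  -- The additive structure is a single module over F with the parameter 1, so the discrete part is
  -- trivial.
  add-scheme : Scheme F
  add-scheme = record
    { Fn  = λ k → CommonFunc F k ⊎ AddFunc F k
    ; R   = field-coefficients
    ; C   = ⊤
    ; X   = ⊤
    ; opX = λ _ _ → tt
    ; opG = λ { (inj₁ zero′) []             → null
              ; (inj₁ one′) []              → constant tt
              ; (inj₁ (scale a)) (t ∷ [])   → scale a t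
              ; (inj₂ plus) (s ∷ t ∷ [])    → s ⊞ t
              ; (inj₂ minus) (s ∷ t ∷ [])   → s ⊞ neg t }
    ; EQ  = λ _ _ ρ → ρ ≡ zer
    ; LT  = λ _ _ ρ → ρ ≡ neg
    }

  -- Magnitudes are written additively as forms with integer coefficients: the product of x and y
  -- becomes a sum, and f_a becomes a translation by the parameter that names the magnitude of a.
  -- The signs form the discrete part.
  mult-scheme : Scheme F
  mult-scheme = record
    { Fn  = λ k → CommonFunc F k ⊎ MultFunc F k
    ; R   = integers
    ; C   = Element
    ; X   = Sign
    ; opX = λ { (inj₁ zero′) []             → zer
              ; (inj₁ one′) []              → pos
              ; (inj₁ (scale a)) (σ ∷ [])   → signum a ⊛ σ
              ; (inj₂ times) (σ ∷ τ ∷ [])   → σ ⊛ τ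
              ; (inj₂ div) (σ ∷ τ ∷ [])     → σ ⊛ τ }
    ; opG = λ { (inj₁ zero′) []             → null
              ; (inj₁ one′) []              → null
              ; (inj₁ (scale a)) (t ∷ [])   → constant a ⊞ t
              ; (inj₂ times) (s ∷ t ∷ [])   → s ⊞ t
              ; (inj₂ div) (s ∷ t ∷ [])     → s ⊞ neg t }
    ; EQ  = SignedEqual
    ; LT  = SignedLess
    }

  module Additive {H : OrderedGroup} (ordered : OrderedAction field-coefficients H) where
    private module H = OrderedGroup H

    zero-sign⁺ : ∀ {g h σ} → H.HasSign σ (g H.- h) → g H.≈ h → σ ≡ zer
    zero-sign⁺ {σ = σ} p g≈h = H.HasSign-unique σ zer p (H.x≈y⇒x∙y⁻¹≈ε g≈h)

    zero-sign⁻ : ∀ {g h σ} → H.HasSign σ (g H.- h) → σ ≡ zer → g H.≈ h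
    zero-sign⁻ p ≡.refl = H.x∙y⁻¹≈ε⇒x≈y _ _ p

    less-sign⁺ : ∀ {g h σ} → H.HasSign σ (g H.- h) → g H.< h → σ ≡ neg
    less-sign⁺ {g} {h} {σ} p g<h = H.HasSign-unique σ neg p (H.Pos-resp (H.sym (H.⁻¹-anti-homo‿- g h)) g<h)

    less-sign⁻ : ∀ {g h σ} → H.HasSign σ (g H.- h) → σ ≡ neg → g H.< h
    less-sign⁻ {g} {h} p ≡.refl = H.Pos-resp (H.⁻¹-anti-homo‿- g h) p

  ℝ-add-coordinates : Coordinates add-scheme (ℝ-add F)
  ℝ-add-coordinates = record
    { ordered    = additive-action
    ; ι          = λ _ → 1#
    ; point      = λ _ x → x
    ; surjective = λ x → tt , x , refl
    ; hom        = λ { (inj₁ zero′) [] [] ρ                      → refl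
                     ; (inj₁ one′) [] [] ρ                       → refl
                     ; (inj₁ (scale a)) (_ ∷ []) (t ∷ []) ρ      → refl
                     ; (inj₂ plus) (_ ∷ _ ∷ []) (s ∷ t ∷ []) ρ   → refl
                     ; (inj₂ minus) (_ ∷ _ ∷ []) (s ∷ t ∷ []) ρ  → refl }
    ; EQ⁺        = zero-sign⁺
    ; EQ⁻        = zero-sign⁻
    ; LT⁺        = λ p x<y → less-sign⁺ p (x<y⇒0<y-x x<y)
    ; LT⁻        = λ p eq → 0<y-x⇒x<y (less-sign⁻ p eq)
    }
    where open Additive additive-action

  series-cone : ConeEmbedding cone orderedGroup
  series-cone = record
    { embedding  = embed
    ; positive   = embed-positive
    ; cong       = λ {g} {g′} → embed-cong {g} {g′}
    ; mono       = λ {g} {g′} → embed-mono {g} {g′}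
    ; surjective = embed-surjective
    }

  real-cone : ConeEmbedding multiplicative-group additive-group
  real-cone = record
    { embedding  = proj₁
    ; positive   = proj₂
    ; cong       = id
    ; mono       = λ {x} {y} x<y → x<y⇒0<y-x (multiplicative-<⁻ x y x<y)
    ; surjective = λ x 0<x → (x , 0<x) , refl
    }

  module S = Signed cone
  module E = SignedEmbedding series-cone
  module S⁺ = Signed multiplicative-group
  module E⁺ = SignedEmbedding real-cone

  signed-real : ∀ σ x → E⁺.signed (σ , x) ≈ real σ * proj₁ x
  signed-real neg x = sym (-1*x≈-x (proj₁ x))
  signed-real zer x = sym (zeroˡ _)
  signed-real pos x = sym (*-identityˡ _)

  *-interchange : ∀ a b c d → (a * b) * (c * d) ≈ (a * c) * (b * d)
  *-interchange a b c d = byRing (a ∷ b ∷ c ∷ d ∷ []) ((x₀ :* x₁) :* (x₂ :* x₃)) ((x₀ :* x₂) :* (x₁ :* x₃)) ≡.refl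

  signed-* : ∀ x y → E⁺.signed x * E⁺.signed y ≈ E⁺.signed (x S⁺.*ˢ y)
  signed-* (σ , x) (τ , y) = begin
    E⁺.signed (σ , x) * E⁺.signed (τ , y)        ≈⟨ *-cong (signed-real σ x) (signed-real τ y) ⟩
    real σ * proj₁ x * (real τ * proj₁ y)        ≈⟨ *-interchange _ _ _ _ ⟩
    real σ * real τ * (proj₁ x * proj₁ y)        ≈⟨ *-congʳ (real-⊛ σ τ) ⟨
    real (σ ⊛ τ) * (proj₁ x * proj₁ y)           ≈⟨ signed-real (σ ⊛ τ) (x P.∙ y) ⟨
    E⁺.signed (σ ⊛ τ , x P.∙ y)                  ∎

  ÷-zero : ∀ x {y} → y ≈ 0# → x ÷ y ≈ 0#
  ÷-zero x {y} y≈0 with y ≟ 0#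
  ... | yes _   = refl
  ... | no  y≉0 = contradiction y≈0 y≉0

  ÷-inverse : ∀ x {y z} → y * z ≈ 1# → x ÷ y ≈ x * z
  ÷-inverse x {y} {z} yz≈1 with y ≟ 0#
  ... | yes y≈0 = contradiction (trans (sym yz≈1) (trans (*-congʳ y≈0) (zeroˡ z))) λ 1≈0 → <-irrefl (sym 1≈0) 0<1
  ... | no  y≉0 = *-congˡ (inverse-unique refl (proj₂ (inverse y y≉0)) yz≈1)

  signed-÷ : ∀ x y → E⁺.signed x ÷ E⁺.signed y ≈ E⁺.signed (x S⁺.÷ˢ y)
  signed-÷ x@(σ , _) y@(zer , v) = trans (÷-zero (E⁺.signed x) refl) (E⁺.signed-cong {zer , v} (≡.sym (⊛-zeroʳ σ) S⁺.,ˢ inj₁ ≡.refl))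
  signed-÷ x (neg , v) = trans (÷-inverse (E⁺.signed x) unit) (signed-* x (neg , v P.⁻¹))
    where
    unit : - proj₁ v * - proj₁ (v P.⁻¹) ≈ 1#
    unit = trans (signed-* (neg , v) (neg , v P.⁻¹)) (recip-inverse (proj₂ v))
  signed-÷ x (pos , v) = trans (÷-inverse (E⁺.signed x) (recip-inverse (proj₂ v))) (signed-* x (pos , v P.⁻¹))

  ℝ-mult-coordinates : Coordinates mult-scheme (ℝ-mult F)
  ℝ-mult-coordinates = record
    { ordered    = integerOrderedAction multiplicative-group multiplicative-divisible
    ; ι          = magnitude
    ; point      = λ σ x → E⁺.signed (σ , x)
    ; surjective = λ x → let (σ , p) , eq = E⁺.signed-surjective x in σ , p , eq
    ; hom        = λ { (inj₁ zero′) [] [] ρ                          → refl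
                     ; (inj₁ one′) [] [] ρ                           → refl
                     ; (inj₁ (scale a)) (σ ∷ []) (t ∷ []) ρ          →
                         trans (*-congʳ (trans (proj₂ (proj₂ (polar (value a)))) (sym (signed-real (signum a) (magnitude a)))))
                               (signed-* (signum a , magnitude a) (σ , _))
                     ; (inj₂ times) (σ ∷ τ ∷ []) (s ∷ t ∷ []) ρ      → signed-* (σ , _) (τ , _)
                     ; (inj₂ div) (σ ∷ τ ∷ []) (s ∷ t ∷ []) ρ        → signed-÷ (σ , _) (τ , _) }
    ; EQ⁺        = λ p eq → S⁺.≈ˢ⇒SignedEqual p (E⁺.signed-injective eq)
    ; EQ⁻        = λ p eq → E⁺.signed-cong (S⁺.SignedEqual⇒≈ˢ p eq)
    ; LT⁺        = λ p lt → S⁺.<ˢ⇒SignedLess p (E⁺.signed-reflects-< (x<y⇒0<y-x lt))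
    ; LT⁻        = λ p table → 0<y-x⇒x<y (E⁺.signed-mono (S⁺.lessˢ p table))
    }

module _ (G : OrderedGroup) where
  open OrderedGroup G

  negative<nonnegative : ∀ x y → Pos (x ⁻¹) → ¬ Pos (y ⁻¹) → x < y
  negative<nonnegative x y x<0 y≮0 with pos? y
  ... | inj₁ y>0        = Pos-∙ y>0 x<0
  ... | inj₂ (inj₁ y≈0) = Pos-resp (sym (trans (∙-congʳ y≈0) (identityˡ _))) x<0
  ... | inj₂ (inj₂ y<0) = contradiction y<0 y≮0

-- The structure in which the quadratic becomes negative

module Countermodel {ℝ : CompleteOrderedField} (F : Subfield ℝ) where
  open OrderedField ℝ hiding (zero)
  open Series ℝ
  open PositiveCone ℝ
  open Subfield F
  open Models F
  open SetoidReasoning setoid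
  private
    module V = OrderedGroup orderedGroup
    module G = OrderedGroup cone
    module W = OrderedGroup infinitesimals
    module P = OrderedGroup multiplicative-group

  open S using (_≈ˢ_; _<ˢ_; _,ˢ_; _*ˢ_; _÷ˢ_)
  open E using (signed; signed-cong; signed-injective; signed-mono; signed-reflects-<; signed-surjective)

  infixl 6 _+ˢ_ _-ˢ_

  abstract
    unsigned : Sum → S.Carrier
    unsigned v = proj₁ (signed-surjective v)

    signed-unsigned : ∀ v → signed (unsigned v) ≋ v
    signed-unsigned v = proj₂ (signed-surjective v)

  unsigned-signed : ∀ {x v} → signed x ≋ v → x ≈ˢ unsigned v
  unsigned-signed {x} {v} eq = signed-injective (V.trans eq (V.sym (signed-unsigned v)))

  -- The domain is the signed cone, where products are immediate; sums are formed among the series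
  -- and carried back.
  _+ˢ_ _-ˢ_ : S.Carrier → S.Carrier → S.Carrier
  x +ˢ y = unsigned (signed x V.∙ signed y)
  x -ˢ y = unsigned (signed x V.- signed y)

  -- The positive reals as constant series; this is the embedding along which T_mult is transferred.
  standard : Positives → G.Carrier
  standard p = 0# , p , W.ε

  scaleˢ : Element → S.Carrier → S.Carrier
  scaleˢ a x = (signum a , standard (magnitude a)) *ˢ x

  coeff-signed : ∀ σ g δ → coeff (signed (σ , g)) δ ≈ real σ * coeff (embed g) δ
  coeff-signed neg g δ = coeff-scaleBy (- 1#) (embed g) δ
  coeff-signed zer g δ = sym (zeroˡ _)
  coeff-signed pos g δ = sym (*-identityˡ _)

  -- In the model f_a is defined as a product with a constant. Its agreement with the scalar action
  -- on series is what allows one symbol to serve both reducts.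
  signed-scaleˢ : ∀ a x → signed (scaleˢ a x) ≋ scaleBy (value a) (signed x)
  signed-scaleˢ a (τ , g) = coefficientwise λ δ → begin
    coeff (signed (σ ⊛ τ , standard p G.∙ g)) δ        ≈⟨ coeff-signed (σ ⊛ τ) (standard p G.∙ g) δ ⟩
    real (σ ⊛ τ) * coeff (embed (standard p G.∙ g)) δ  ≈⟨ *-cong (real-⊛ σ τ)
                                                            (trans (at (embed-scale (proj₁ p) (proj₂ p) g) δ)
                                                                   (coeff-scaleBy (proj₁ p) (embed g) δ)) ⟩
    real σ * real τ * (proj₁ p * coeff (embed g) δ)    ≈⟨ *-interchange _ _ _ _ ⟩
    real σ * proj₁ p * (real τ * coeff (embed g) δ)    ≈⟨ *-cong (proj₂ (proj₂ (polar (value a)))) (coeff-signed τ g δ) ⟨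
    value a * coeff (signed (τ , g)) δ                 ≈⟨ coeff-scaleBy (value a) (signed (τ , g)) δ ⟨
    coeff (scaleBy (value a) (signed (τ , g))) δ       ∎
    where
    σ = signum a
    p = magnitude a

  +ˢ-cong : ∀ {x x′ y y′} → x ≈ˢ x′ → y ≈ˢ y′ → x +ˢ y ≈ˢ x′ +ˢ y′
  +ˢ-cong {x} {x′} {y} {y′} p q = unsigned-signed
    (V.trans (signed-unsigned (signed x V.∙ signed y)) (V.∙-cong (signed-cong p) (signed-cong q)))

  -ˢ-cong : ∀ {x x′ y y′} → x ≈ˢ x′ → y ≈ˢ y′ → x -ˢ y ≈ˢ x′ -ˢ y′
  -ˢ-cong {x} {x′} {y} {y′} p q = unsigned-signed
    (V.trans (signed-unsigned (signed x V.- signed y)) (V.∙-cong (signed-cong p) (V.⁻¹-cong (signed-cong q))))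

  <ˢ-resp : ∀ {x x′ y y′} → x ≈ˢ x′ → y ≈ˢ y′ → x <ˢ y → x′ <ˢ y′
  <ˢ-resp p q lt = signed-reflects-< (V.<-resp (signed-cong p) (signed-cong q) (signed-mono lt))

  private module ≈ˢ = Setoid S.setoid

  function : ∀ {k} → CommonFunc F k ⊎ (AddFunc F k ⊎ MultFunc F k) → Vec S.Carrier k → S.Carrier
  function (inj₁ zero′)        []           = zer , G.ε
  function (inj₁ one′)         []           = pos , G.ε
  function (inj₁ (scale a))    (x ∷ [])     = scaleˢ a x
  function (inj₂ (inj₁ plus))  (x ∷ y ∷ []) = x +ˢ y
  function (inj₂ (inj₁ minus)) (x ∷ y ∷ []) = x -ˢ y
  function (inj₂ (inj₂ times)) (x ∷ y ∷ []) = x *ˢ y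
  function (inj₂ (inj₂ div))   (x ∷ y ∷ []) = x ÷ˢ y

  function-cong : ∀ {k} (f : CommonFunc F k ⊎ (AddFunc F k ⊎ MultFunc F k)) {xs ys} →
                  Pointwise _≈ˢ_ xs ys → function f xs ≈ˢ function f ys
  function-cong (inj₁ zero′)        []           = ≈ˢ.refl
  function-cong (inj₁ one′)         []           = ≈ˢ.refl
  function-cong (inj₁ (scale a))    (p ∷ [])     = S.*ˢ-cong ≈ˢ.refl p
  function-cong (inj₂ (inj₁ plus))  (p ∷ q ∷ []) = +ˢ-cong p q
  function-cong (inj₂ (inj₁ minus)) (p ∷ q ∷ []) = -ˢ-cong p q
  function-cong (inj₂ (inj₂ times)) (p ∷ q ∷ []) = S.*ˢ-cong p q
  function-cong (inj₂ (inj₂ div))   (p ∷ q ∷ []) = S.÷ˢ-cong p q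

  relation : ∀ {k} → Order F k → Vec S.Carrier k → Set
  relation less (x ∷ y ∷ []) = x <ˢ y

  M : Structure (L F)
  M = record
    { domain = S.setoid
    ; ⟦_⟧ᶠ   = function
    ; ⟦_⟧ᵖ   = relation
    ; ᶠ-cong = function-cong
    ; ᵖ-resp = λ { less (p ∷ q ∷ []) → <ˢ-resp p q }
    }

  -- The elements are already pairs of a sign and a cone element, so the operations of this reduct
  -- match the scheme by computation.
  M-mult-coordinates : Coordinates mult-scheme (reduct (mult↪ F) M)
  M-mult-coordinates = record
    { ordered    = integerOrderedAction cone cone-divisible
    ; ι          = λ a → standard (magnitude a)
    ; point      = _,_
    ; surjective = λ (σ , g) → σ , g , ≈ˢ.refl
    ; hom        = λ { (inj₁ zero′) [] [] ρ                       → ≈ˢ.refl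
                     ; (inj₁ one′) [] [] ρ                        → ≈ˢ.refl
                     ; (inj₁ (scale a)) (σ ∷ []) (t ∷ []) ρ       → ≈ˢ.refl
                     ; (inj₂ times) (σ ∷ τ ∷ []) (s ∷ t ∷ []) ρ   → ≈ˢ.refl
                     ; (inj₂ div) (σ ∷ τ ∷ []) (s ∷ t ∷ []) ρ     → ≈ˢ.refl }
    ; EQ⁺        = S.≈ˢ⇒SignedEqual
    ; EQ⁻        = S.SignedEqual⇒≈ˢ
    ; LT⁺        = S.<ˢ⇒SignedLess
    ; LT⁻        = S.lessˢ
    }

  sum-of-unsigned : ∀ v w → signed (unsigned v +ˢ unsigned w) ≋ v ++ w
  sum-of-unsigned v w = V.trans (signed-unsigned _) (V.∙-cong (signed-unsigned v) (signed-unsigned w))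

  difference-of-unsigned : ∀ v w → signed (unsigned v -ˢ unsigned w) ≋ v ++ negate w
  difference-of-unsigned v w = V.trans (signed-unsigned _) (V.∙-cong (signed-unsigned v)
    (V.⁻¹-cong {signed (unsigned w)} {w} (signed-unsigned w)))

  multiple-of-unsigned : ∀ a v → signed (scaleˢ a (unsigned v)) ≋ scaleBy (value a) v
  multiple-of-unsigned a v = V.trans (signed-scaleˢ a (unsigned v))
    (OrderedAction.·-congˡ series-action {a} (signed-unsigned v))

  M-add-coordinates : Coordinates add-scheme (reduct (add↪ F) M)
  M-add-coordinates = record
    { ordered    = series-action
    ; ι          = λ _ → 1+ []
    ; point      = λ _ → unsigned
    ; surjective = λ x → tt , signed x , ≈ˢ.sym (unsigned-signed V.refl)
    ; hom        = λ { (inj₁ zero′) [] [] ρ                      → unsigned-signed V.refl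
                     ; (inj₁ one′) [] [] ρ                       → unsigned-signed embed-1
                     ; (inj₁ (scale a)) (_ ∷ []) (t ∷ []) ρ      → unsigned-signed
                         (multiple-of-unsigned a _)
                     ; (inj₂ plus) (_ ∷ _ ∷ []) (s ∷ t ∷ []) ρ   → unsigned-signed
                         (sum-of-unsigned _ _)
                     ; (inj₂ minus) (_ ∷ _ ∷ []) (s ∷ t ∷ []) ρ  → unsigned-signed
                         (difference-of-unsigned _ _) }
    ; EQ⁺        = λ {_} {_} {g} {h} {σ} p eq → zero-sign⁺ {g} {h} {σ} p
        (V.trans {g} (V.sym {signed (unsigned g)} (signed-unsigned g)) (V.trans (signed-cong eq) (signed-unsigned h)))
    ; EQ⁻        = λ {_} {_} {g} {h} {σ} p eq → unsigned-signed {unsigned g} {h}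
        (V.trans (signed-unsigned g) (zero-sign⁻ {g} {h} {σ} p eq))
    ; LT⁺        = λ {_} {_} {g} {h} {σ} p lt → less-sign⁺ {g} {h} {σ} p
        (V.<-resp {signed (unsigned g)} {g} {signed (unsigned h)} {h} (signed-unsigned g) (signed-unsigned h) (signed-mono lt))
    ; LT⁻        = λ {_} {_} {g} {h} {σ} p eq → signed-reflects-<
        (V.<-resp {g} {signed (unsigned g)} {h} {signed (unsigned h)}
          (V.sym (signed-unsigned g)) (V.sym (signed-unsigned h)) (less-sign⁻ {g} {h} {σ} p eq))
    }
    where open Additive series-action

  M⊨T-mult : ∀ φ → φ ∈ T-mult F → Satisfies (reduct (mult↪ F) M) [] φ
  M⊨T-mult = Transfer.elementary ℝ-mult-coordinates M-mult-coordinates standard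
    (λ {x} {y} → standard-cong {x} {y}) standard-∙
    (GroupHomomorphism.e-· P.abelianGroup G.abelianGroup standard (λ {x} {y} → standard-cong {x} {y}) standard-∙)
    (λ a → G.refl {standard (magnitude a)})
    (λ 1<x → inj₂ (refl , inj₁ 1<x))
    where
    standard-cong : ∀ {x y} → x P.≈ y → standard x G.≈ standard y
    standard-cong x≈y = refl , x≈y , W.refl {W.ε}

    standard-∙ : ∀ x y → standard (x P.∙ y) G.≈ standard x G.∙ standard y
    standard-∙ x y = sym (+-identityˡ 0#) , refl , W.sym {W.ε W.∙ W.ε} {W.ε} (W.identityˡ W.ε)

  M⊨T-add : ∀ φ → φ ∈ T-add F → Satisfies (reduct (add↪ F) M) [] φ
  M⊨T-add = Transfer.elementary ℝ-add-coordinates M-add-coordinates constantSeries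
    (λ x≈y → coefficientwise λ δ → +-congʳ (select-cong (0# ≟ δ) (0# ≟ δ) id id x≈y))
    (λ x y → coefficientwise λ δ → trans (+-congʳ (select-+ (0# ≟ δ))) (+-assoc _ _ _))
    (λ k x → V.refl)
    (λ _ → V.refl)
    (λ 0<x → leading 0# (<-respʳ-≈ (sym (coeff-monomial 0# _ refl)) 0<x)
      (λ 0<δ → coeff-monomial-0 0# _ (λ 0≈δ → <-irrefl 0≈δ 0<δ)))
    where
    constantSeries : Carrier → Sum
    constantSeries x = (0# , x) ∷ []

    select-+ : ∀ {γ δ x y} (p : Dec (γ ≈ δ)) → select p (x + y) ≈ select p x + select p y
    select-+ (yes _) = refl
    select-+ (no  _) = sym (+-identityˡ 0#)

  M⊨T : ∀ {φ} → φ ∈ T[ F ] → φ ∈ Th M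
  M⊨T (inj₁ (ψ , ψ∈T , ≡.refl)) = proj₂ (translate-satisfies (add↪ F) M [] ψ) (M⊨T-add ψ ψ∈T)
  M⊨T (inj₂ (ψ , ψ∈T , ≡.refl)) = proj₂ (translate-satisfies (mult↪ F) M [] ψ) (M⊨T-mult ψ ψ∈T)

  <⇒≉ˢ : ∀ {x y} → x <ˢ y → ¬ (y ≈ˢ x)
  <⇒≉ˢ {x} {y} x<y y≈x = Multiples.<-irrefl orderedGroup {signed x}
    (V.<-resp {signed x} {signed x} {signed y} {signed x} V.refl (signed-cong y≈x) (signed-mono x<y))

  <⇒≯ˢ : ∀ {x y} → x <ˢ y → ¬ (y <ˢ x)
  <⇒≯ˢ {x} {y} x<y y<x = Multiples.<-irrefl orderedGroup {signed x}
    (V.<-trans {signed x} {signed y} {signed x} (signed-mono x<y) (signed-mono y<x))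

  quadratic : S.Carrier → S.Carrier
  quadratic x = x *ˢ x -ˢ scaleˢ two x +ˢ (pos , G.ε)

  -- The computation is (1 + 3 t⁻¹) - 2 (1 + 2 t⁻¹) + 1 = -t⁻¹.
  quadratic-root : signed (quadratic (pos , root)) ≋ negate t⁻¹
  quadratic-root = V.trans (signed-unsigned _) (V.trans (V.∙-cong difference embed-1) collect)
    where
    twice : ∀ v → scaleBy (1# + 1#) v ≋ v ++ v
    twice v = V.trans (A.·-distribʳ C.𝟙 C.𝟙 v) (V.∙-cong (A.𝟙-· v) (A.𝟙-· v))
      where
      module A = OrderedAction series-action
      module C = Coefficients field-coefficients

    2root : signed (scaleˢ two (pos , root)) ≋ 1+ (t⁻¹ ++ t⁻¹) ++ 1+ (t⁻¹ ++ t⁻¹)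
    2root = V.trans (signed-scaleˢ two (pos , root)) (V.trans (twice (embed root)) (V.∙-cong embed-root embed-root))

    difference : signed ((pos , root) *ˢ (pos , root) -ˢ scaleˢ two (pos , root)) ≋
                 1+ ((t⁻¹ ++ t⁻¹) ++ t⁻¹) V.- (1+ (t⁻¹ ++ t⁻¹) ++ 1+ (t⁻¹ ++ t⁻¹))
    difference = V.trans (signed-unsigned _) (V.∙-cong embed-root²
      (V.⁻¹-cong {signed (scaleˢ two (pos , root))} {1+ (t⁻¹ ++ t⁻¹) ++ 1+ (t⁻¹ ++ t⁻¹)} 2root))

    collect : (1+ ((t⁻¹ ++ t⁻¹) ++ t⁻¹) V.- (1+ (t⁻¹ ++ t⁻¹) ++ 1+ (t⁻¹ ++ t⁻¹))) ++ 1+ [] ≋ negate t⁻¹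
    collect = V.abel (1+ [] ∷ t⁻¹ ∷ [])
      (((v₀ ⊞ ((v₁ ⊞ v₁) ⊞ v₁)) ⊞ neg ((v₀ ⊞ (v₁ ⊞ v₁)) ⊞ (v₀ ⊞ (v₁ ⊞ v₁)))) ⊞ v₀) (neg v₁)

  quadratic<nonnegative : ∀ y → ¬ Leading (negate (signed y)) → signed (quadratic (pos , root)) V.< signed y
  quadratic<nonnegative y = negative<nonnegative orderedGroup (signed (quadratic (pos , root))) (signed y)
    (V.Pos-resp (V.trans (V.sym (V.⁻¹-involutive t⁻¹)) (V.⁻¹-cong {negate t⁻¹} {signed (quadratic (pos , root))} (V.sym quadratic-root)))
      t⁻¹-leading)

  -- The refuted implication is what the formula `s ≥̇ t` unfolds to in the model, its disjunction
  -- being encoded by a negation and an implication.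
  not-above-nonnegative : ∀ y → ¬ Leading (negate (signed y)) →
                          ¬ (¬ (y <ˢ quadratic (pos , root)) → y ≈ˢ quadratic (pos , root))
  not-above-nonnegative y y≮0 holds = <⇒≉ˢ x<y (holds (<⇒≯ˢ x<y))
    where
    x<y : quadratic (pos , root) <ˢ y
    x<y = signed-reflects-< (quadratic<nonnegative y y≮0)

  open Soundness excludedMiddle M using (sound)

  unprovable : ∀ (t : Term (L F) 1) → ¬ Leading (negate (signed (evalTerm M ((pos , root) ∷ []) t))) →
               ¬ (T[ F ] ⊢ all̇ (var zero ẋ var zero -̇ f two (var zero) +̇ 1̇ ≥̇ t))
  unprovable t t≮0 d = not-above-nonnegative _ t≮0 (sound M⊨T d [] [] (pos , root))

  -- The constant ε denotes a series concentrated at exponent 0, so it can be negative in the model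
  -- only if ε < 0 in ℝ.
  unprovable-const : ∀ ε → ¬ (value ε < 0#) → ¬ (T[ F ] ⊢ all̇ (var zero ẋ var zero -̇ f two (var zero) +̇ 1̇ ≥̇ Defs.const ε))
  unprovable-const ε ε≮0 = unprovable (Defs.const ε) λ (leading γ 0<c _) → ε≮0 (negative (0# ≟ γ) (<-respʳ-≈ (at coefficients γ) 0<c))
    where
    coefficients : negate (signed (scaleˢ ε (pos , G.ε))) ≋ (0# , - 1# * (value ε * 1#)) ∷ []
    coefficients = V.⁻¹-cong {signed (scaleˢ ε (pos , G.ε))} {scaleBy (value ε) (1+ [])}
      (V.trans (signed-scaleˢ ε (pos , G.ε)) (OrderedAction.·-congˡ series-action {ε} embed-1))

    negative : ∀ {γ} (p : Dec (0# ≈ γ)) → 0# < select p (- 1# * (value ε * 1#)) + 0# → value ε < 0#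
    negative (yes _) 0<-ε = pos-neg (<-respʳ-≈ (trans (+-identityʳ _) (trans (-1*x≈-x _) (-‿cong (*-identityʳ _)))) 0<-ε)
    negative (no  _) 0<0  = contradiction 0<0 (<-irrefl (sym (+-identityʳ 0#)))

  unprovable-0 : ¬ (T[ F ] ⊢ all̇ (var zero ẋ var zero -̇ f two (var zero) +̇ 1̇ ≥̇ 0̇))
  unprovable-0 = unprovable 0̇ λ (leading _ 0<0 _) → <-irrefl refl 0<0

-- The derivation for ε < 0

module Inequalities (ℝ : CompleteOrderedField) where
  open OrderedField ℝ

  NonNegative : Carrier → Set
  NonNegative x = ¬ (x < 0#)

  pos+nonneg : ∀ {x y} → 0# < x → NonNegative y → 0# < x + y
  pos+nonneg {x} {y} 0<x y≮0 with compare 0# y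
  ... | tri< 0<y _ _ = +-pos 0<x 0<y
  ... | tri≈ _ 0≈y _ = <-respʳ-≈ (trans (sym (+-identityʳ x)) (+-congˡ 0≈y)) 0<x
  ... | tri> _ _ y<0 = contradiction y<0 y≮0

  nonneg-+ : ∀ {x y} → NonNegative x → NonNegative y → NonNegative (x + y)
  nonneg-+ {x} {y} x≮0 y≮0 x+y<0 with compare 0# x
  ... | tri< 0<x _ _ = <-asym x+y<0 (pos+nonneg 0<x y≮0)
  ... | tri≈ _ 0≈x _ = y≮0 (<-respˡ-≈ (trans (+-congʳ (sym 0≈x)) (+-identityˡ y)) x+y<0)
  ... | tri> _ _ x<0 = x≮0 x<0

  nonneg-* : ∀ {x y} → NonNegative x → NonNegative y → NonNegative (x * y)
  nonneg-* {x} {y} x≮0 y≮0 xy<0 with compare 0# x | compare 0# y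
  ... | tri< 0<x _ _ | tri< 0<y _ _ = <-asym xy<0 (*-pos 0<x 0<y)
  ... | tri> _ _ x<0 | _            = x≮0 x<0
  ... | _            | tri> _ _ y<0 = y≮0 y<0
  ... | tri≈ _ 0≈x _ | _            = <-irrefl (trans (*-congʳ (sym 0≈x)) (zeroˡ y)) xy<0
  ... | _            | tri≈ _ 0≈y _ = <-irrefl (trans (*-congˡ (sym 0≈y)) (zeroʳ x)) xy<0

  pos⇒nonneg : ∀ {x} → 0# < x → NonNegative x
  pos⇒nonneg = <-asym

  square-nonneg : ∀ x → NonNegative (x * x)
  square-nonneg x with compare 0# x
  ... | tri< 0<x _ _ = pos⇒nonneg (*-pos 0<x 0<x)
  ... | tri≈ _ 0≈x _ = <-irrefl (trans (*-congʳ (sym 0≈x)) (zeroˡ x))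
  ... | tri> _ _ x<0 = pos⇒nonneg (<-respʳ-≈ (byRing (x ∷ []) (:- x₀ :* :- x₀) (x₀ :* x₀) ≡.refl)
                         (*-pos (neg-pos x<0) (neg-pos x<0)))

  ≮⇒nonneg : ∀ {x y} → ¬ (x < y) → NonNegative (x - y)
  ≮⇒nonneg {x} {y} x≮y x-y<0 = x≮y (0<y-x⇒x<y (<-respʳ-≈ (byRing (x ∷ y ∷ []) (:- (x₀ :- x₁)) (x₁ :- x₀) ≡.refl) (neg-pos x-y<0)))

  <-from-difference : ∀ {x y d} → 0# < d → d ≈ y - x → x < y
  <-from-difference 0<d eq = 0<y-x⇒x<y (<-respʳ-≈ eq 0<d)

  -- With x = c + u and 0 < u ≤ δ, the line c x through the parabola lies
  -- above 2 x − 1 − 2 δ because c x − 2 x + 1 + 2 δ = (c − 1)² + c u + 2 (δ − u).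
  advance : ∀ {c δ x y} → NonNegative c → c < x → c * x < y →
            y - (1# + 1#) * x + 1# < - (δ + δ) → c + δ < x
  advance {c} {δ} {x} {y} 0≤c c<x cx<y below with c + δ <? x
  ... | yes c+δ<x = c+δ<x
  ... | no  c+δ≮x = contradiction below (<-asym above)
    where
    above : - (δ + δ) < y - (1# + 1#) * x + 1#
    above = <-from-difference
      (pos+nonneg (x<y⇒0<y-x cx<y)
        (nonneg-+ (nonneg-+ (square-nonneg (c - 1#)) (nonneg-* 0≤c (pos⇒nonneg (x<y⇒0<y-x c<x))))
                  (nonneg-+ (≮⇒nonneg c+δ≮x) (≮⇒nonneg c+δ≮x))))
      (identity c δ x y)
      where
      identity : ∀ c δ x y →
        (y - c * x) + (((c - 1#) * (c - 1#) + c * (x - c)) + ((c + δ - x) + (c + δ - x)))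
          ≈ (y - (1# + 1#) * x + 1#) - - (δ + δ)
      identity c δ x y = byRing (c ∷ δ ∷ x ∷ y ∷ [])
        ((x₃ :- x₀ :* x₂) :+ (((x₀ :- ‵1) :* (x₀ :- ‵1) :+ x₀ :* (x₂ :- x₀)) :+ ((x₀ :+ x₁ :- x₂) :+ (x₀ :+ x₁ :- x₂))))
        ((x₃ :- (‵1 :+ ‵1) :* x₂ :+ ‵1) :- :- (x₁ :+ x₁)) ≡.refl

  -- y - 2 x + 1 is the sum of y - c x > 0, (c - 2) x ≥ 0 and 1; here x is positive because it
  -- exceeds c ≥ 2.
  arrive : ∀ {c x y} → ¬ (c < 1# + 1#) → c < x → c * x < y → ¬ (y - (1# + 1#) * x + 1# < 0#)
  arrive {c} {x} {y} c≮2 c<x cx<y = <-asym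
    (<-respʳ-≈ (byRing (c ∷ x ∷ y ∷ []) ((x₂ :- x₀ :* x₁) :+ ((x₀ :- (‵1 :+ ‵1)) :* x₁ :+ ‵1)) (x₂ :- (‵1 :+ ‵1) :* x₁ :+ ‵1) ≡.refl)
      (pos+nonneg (x<y⇒0<y-x cx<y)
        (nonneg-+ (nonneg-* (≮⇒nonneg c≮2) (pos⇒nonneg 0<x)) (pos⇒nonneg 0<1))))
    where
    0<x : 0# < x
    0<x with x <? 1# + 1#
    ... | yes x<2 = contradiction (<-trans c<x x<2) c≮2
    ... | no  x≮2 = <-from-difference (pos+nonneg (+-pos 0<1 0<1) (≮⇒nonneg x≮2))
                      (byRing (x ∷ []) ((‵1 :+ ‵1) :+ (x₀ :- (‵1 :+ ‵1))) (x₀ :- ‵0) ≡.refl)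

  -- For x ≤ 0 the terms y and -2 x are nonnegative, so adding 1 gives a positive value.
  depart : ∀ {x y} → NonNegative y → y - (1# + 1#) * x + 1# < 0# → 0# < x
  depart {x} {y} 0≤y below with compare 0# x
  ... | tri< 0<x _ _ = 0<x
  ... | tri≈ _ 0≈x _ = contradiction below (<-asym (<-respʳ-≈
          (trans (byRing (y ∷ []) (‵1 :+ x₀) (x₀ :- (‵1 :+ ‵1) :* ‵0 :+ ‵1) ≡.refl) (+-congʳ (+-congˡ (-‿cong (*-congˡ 0≈x)))))
          (pos+nonneg 0<1 0≤y)))
  ... | tri> _ _ x<0 = contradiction below (<-asym (<-respʳ-≈
          (byRing (x ∷ y ∷ []) (‵1 :+ (x₁ :+ (:- x₀ :+ :- x₀))) (x₁ :- (‵1 :+ ‵1) :* x₀ :+ ‵1) ≡.refl)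
          (pos+nonneg 0<1 (nonneg-+ 0≤y (pos⇒nonneg (+-pos (neg-pos x<0) (neg-pos x<0)))))))

  -- If all terms stayed below b they would have a supremum t; some term exceeds t - δ, and the next
  -- one exceeds t.
  archimedean : ∀ {δ} b (s : ℕ → Carrier) → 0# < δ → (∀ n → s (suc n) ≈ s n + δ) → ∃ λ n → ¬ (s n < b)
  archimedean {δ} b s 0<δ step with excludedMiddle {∃ λ n → ¬ (s n < b)}
  ... | yes p = p
  ... | no  p = ⊥-elim (unbounded (complete (λ x → ∃ λ n → x ≈ s n) (s 0 , 0 , refl) (b , bounded)))
    where
    bounded : ∀ {x} → (∃ λ n → x ≈ s n) → ¬ (b < x)
    bounded {x} (n , x≈sn) b<x with s n <? b
    ... | yes sn<b = <-asym b<x (<-respˡ-≈ (sym x≈sn) sn<b)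
    ... | no  sn≮b = p (n , sn≮b)

    unbounded : ¬ ∃ (IsSupremum (λ x → ∃ λ n → x ≈ s n))
    unbounded (t , upper , least) with least {t - δ} (<-from-difference 0<δ (byRing (δ ∷ t ∷ []) x₀ (x₁ :- (x₁ :- x₀)) ≡.refl))
    ... | x , (n , x≈sn) , t-δ<x = upper (suc n , refl) (<-respʳ-≈ (trans (+-congʳ x≈sn) (sym (step n)))
            (<-respˡ-≈ (byRing (t ∷ δ ∷ []) (x₀ :- x₁ :+ x₁) x₀ ≡.refl) (+-monoˡ-< δ t-δ<x)))

module Provability {ℝ : CompleteOrderedField} (F : Subfield ℝ) where
  open OrderedField ℝ hiding (zero)
  open RealGroups ℝ using (½; 0<½; ½+½≈1)
  open Inequalities ℝ
  open Subfield F

  private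
    module _ {n : ℕ} where
      scaleᵃ : Element → Term (L-add F) n → Term (L-add F) n
      scaleᵃ a t = fn (inj₁ (scale a)) (t ∷ [])

      1ᵃ : Term (L-add F) n
      1ᵃ = fn (inj₁ one′) []

      constᵃ : Element → Term (L-add F) n
      constᵃ c = scaleᵃ c 1ᵃ

      _<ᵃ_ : Term (L-add F) n → Term (L-add F) n → Formula (L-add F) n
      s <ᵃ t = pr less (s ∷ t ∷ [])

      -- y − 2 x + 1 ≥ ε, where y will be x².
      aboveᵃ : Element → Term (L-add F) n → Term (L-add F) n → Formula (L-add F) n
      aboveᵃ ε x y = constᵃ ε <ᵃ s ∨̇ constᵃ ε ≐ s
        where s = fn (inj₂ plus) (fn (inj₂ minus) (y ∷ scaleᵃ two x ∷ []) ∷ 1ᵃ ∷ [])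

      scaleᵐ : Element → Term (L-mult F) n → Term (L-mult F) n
      scaleᵐ a t = fn (inj₁ (scale a)) (t ∷ [])

      constᵐ : Element → Term (L-mult F) n
      constᵐ c = scaleᵐ c (fn (inj₁ one′) [])

      squareᵐ : Term (L-mult F) n → Term (L-mult F) n
      squareᵐ t = fn (inj₂ times) (t ∷ t ∷ [])

      _<ᵐ_ : Term (L-mult F) n → Term (L-mult F) n → Formula (L-mult F) n
      s <ᵐ t = pr less (s ∷ t ∷ [])

    y₀ x₁′ : Term (L-add F) 2
    y₀ = var zero
    x₁′ = var (suc zero)

  -- T_add cannot speak of squares, so a second quantified variable y takes the place of x². This
  -- sentence opens the chain of lower bounds for x at c = 0, `advances` lengthens it, and `arrives`
  -- closes it at some c ≥ 2.
  departs : Element → Element → Sentence (L-add F)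
  departs ε 0′ = all̇ (all̇ (¬̇ aboveᵃ ε x₁′ y₀ ⇒ ¬̇ (y₀ <ᵃ fn (inj₁ zero′) []) ⇒ constᵃ 0′ <ᵃ x₁′))

  advances : Element → Element → Element → Sentence (L-add F)
  advances ε c c′ = all̇ (all̇ (¬̇ aboveᵃ ε x₁′ y₀ ⇒ constᵃ c <ᵃ x₁′ ⇒ scaleᵃ c x₁′ <ᵃ y₀ ⇒ constᵃ c′ <ᵃ x₁′))

  arrives : Element → Element → Sentence (L-add F)
  arrives ε c = all̇ (all̇ (¬̇ aboveᵃ ε x₁′ y₀ ⇒ constᵃ c <ᵃ x₁′ ⇒ scaleᵃ c x₁′ <ᵃ y₀ ⇒ ⊥̇))

  squareNonNegative : Sentence (L-mult F)
  squareNonNegative = all̇ (¬̇ (squareᵐ (var zero) <ᵐ fn (inj₁ zero′) []))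

  -- The contribution of T_mult to each round: it turns a constant lower bound for x into a line
  -- below x², which linear arithmetic can use.
  squareAbove : Element → Sentence (L-mult F)
  squareAbove c = all̇ (constᵐ c <ᵐ var zero ⇒ scaleᵐ c (var zero) <ᵐ squareᵐ (var zero))

  private
    -- The first hypothesis is the negated `≥̇` with its disjunction unfolded; trichotomy leaves
    -- only the strict inequality.
    below : ∀ ε x y → ¬ (¬ (value ε * 1# < y - (1# + 1#) * x + 1#) → value ε * 1# ≈ y - (1# + 1#) * x + 1#) →
            y - (1# + 1#) * x + 1# < value ε
    below ε x y ¬above with compare (value ε * 1#) (y - (1# + 1#) * x + 1#)
    ... | tri< lt _ _ = contradiction (λ ¬lt → contradiction lt ¬lt) ¬above
    ... | tri≈ _ eq _ = contradiction (λ _ → eq) ¬above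
    ... | tri> _ _ gt = <-respʳ-≈ (*-identityʳ _) gt

    strip : ∀ c {x} → value c * 1# < x → value c < x
    strip c = <-respˡ-≈ (*-identityʳ _)

    wrap : ∀ c {x} → value c < x → value c * 1# < x
    wrap c = <-respˡ-≈ (sym (*-identityʳ _))

  departs-true : ∀ ε 0′ → value ε < 0# → value 0′ ≈ 0# → departs ε 0′ ∈ T-add F
  departs-true ε 0′ ε<0 0′≈0 x y ¬above 0≤y =
    wrap 0′ (<-respˡ-≈ (sym 0′≈0) (depart 0≤y (<-trans (below ε x y ¬above) ε<0)))

  advances-true : ∀ ε c c′ δ → value ε ≈ - (δ + δ) → NonNegative (value c) → value c′ ≈ value c + δ →
                  advances ε c c′ ∈ T-add F
  advances-true ε c c′ δ ε≈ 0≤c c′≈ x y ¬above c<x cx<y =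
    wrap c′ (<-respˡ-≈ (sym c′≈) (advance 0≤c (strip c c<x) cx<y (<-respʳ-≈ ε≈ (below ε x y ¬above))))

  arrives-true : ∀ ε c → value ε < 0# → ¬ (value c < 1# + 1#) → arrives ε c ∈ T-add F
  arrives-true ε c ε<0 c≮2 x y ¬above c<x cx<y =
    arrive c≮2 (strip c c<x) cx<y (<-trans (below ε x y ¬above) ε<0)

  squareNonNegative-true : squareNonNegative ∈ T-mult F
  squareNonNegative-true = square-nonneg

  squareAbove-true : ∀ c → NonNegative (value c) → squareAbove c ∈ T-mult F
  squareAbove-true c 0≤c x c<x = *-monoʳ-< 0<x (strip c c<x)
    where
    0<x : 0# < x
    0<x with compare 0# (value c)
    ... | tri< 0<c _ _ = <-trans 0<c (strip c c<x)
    ... | tri≈ _ 0≈c _ = <-respˡ-≈ (sym 0≈c) (strip c c<x)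
    ... | tri> _ _ c<0 = contradiction c<0 0≤c

  module _ (ε : Element) (ε<0 : value ε < 0#) where

    goal : Formula (L F) 1
    goal = var zero ẋ var zero -̇ f two (var zero) +̇ 1̇ ≥̇ const ε

    private
      Γ : List (Formula (L F) 1)
      Γ = ¬̇ goal ∷ []

      Proof : Formula (L F) 1 → Set
      Proof = Derivation T[ F ] Γ

      axiomᵃ : ∀ ψ → ψ ∈ T-add F → Proof (closed (translate (add↪ F) ψ))
      axiomᵃ ψ ψ∈T = axiom (inj₁ (ψ , ψ∈T , ≡.refl))

      axiomᵐ : ∀ ψ → ψ ∈ T-mult F → Proof (closed (translate (mult↪ F) ψ))
      axiomᵐ ψ ψ∈T = axiom (inj₂ (ψ , ψ∈T , ≡.refl))

      -- The outer variable is x and the inner one y. Only in the joint language can y be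
      -- instantiated by x².
      at-point : ∀ {φ} → Proof (all̇ (all̇ φ)) → Proof (substFormula (lift (instantiate (var zero))) φ [ var zero ẋ var zero ])
      at-point d = ∀-elim (∀-elim d (var zero)) (var zero ẋ var zero)

      half : ½ ∈ member
      half = inv-closed (+-closed 1-closed 1-closed) (recip-inverse (+-pos 0<1 0<1))

      -- Half of -ε, because moving x by at most δ changes the term -2 x by at most 2 δ.
      δ : Element
      δ = - value ε * ½ , *-closed (neg-closed (proj₂ ε)) half

      0<δ : 0# < value δ
      0<δ = *-pos (neg-pos ε<0) 0<½

      ε≈-2δ : value ε ≈ - (value δ + value δ)
      ε≈-2δ = trans (sym (-‿involutive _)) (-‿cong (trans (sym (*-identityʳ _))
        (trans (*-congˡ (sym ½+½≈1)) (distribˡ _ ½ ½))))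

      grid : ℕ → Element
      grid zero    = 0# , 0-closed
      grid (suc n) = value (grid n) + value δ , +-closed (proj₂ (grid n)) (proj₂ δ)

      grid-nonneg : ∀ n → NonNegative (value (grid n))
      grid-nonneg zero    = <-irrefl refl
      grid-nonneg (suc n) = nonneg-+ (grid-nonneg n) (pos⇒nonneg 0<δ)

      above-line : ∀ n → Proof (const (grid n) <̇ var zero) → Proof (f (grid n) (var zero) <̇ var zero ẋ var zero)
      above-line n = ⇒-elim (∀-elim (axiomᵐ (squareAbove (grid n)) (squareAbove-true (grid n) (grid-nonneg n))) (var zero))

      -- The induction takes place in the metatheory: every n has its own derivation, in which each
      -- round spends one axiom of T_mult and one of T_add.
      beyond : ∀ n → Proof (const (grid n) <̇ var zero)
      beyond zero    = ⇒-elim (⇒-elim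
        (at-point (axiomᵃ (departs ε (grid 0)) (departs-true ε (grid 0) ε<0 refl)))
        (hyp (here ≡.refl)))
        (∀-elim (axiomᵐ squareNonNegative squareNonNegative-true) (var zero))
      beyond (suc n) = ⇒-elim (⇒-elim (⇒-elim
        (at-point (axiomᵃ (advances ε (grid n) (grid (suc n)))
          (advances-true ε (grid n) (grid (suc n)) (value δ) ε≈-2δ (grid-nonneg n) refl)))
        (hyp (here ≡.refl))) (beyond n)) (above-line n (beyond n))

      absurd : ∀ n → ¬ (value (grid n) < 1# + 1#) → Proof ⊥̇
      absurd n c≮2 = ⇒-elim (⇒-elim (⇒-elim
        (at-point (axiomᵃ (arrives ε (grid n)) (arrives-true ε (grid n) ε<0 c≮2)))
        (hyp (here ≡.refl))) (beyond n)) (above-line n (beyond n))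

    provable : T[ F ] ⊢ all̇ goal
    provable = let n , c≮2 = archimedean (1# + 1#) (λ n → value (grid n)) 0<δ (λ n → refl)
               in ∀-intro (raa (absurd n c≮2))

open CompleteOrderedField using (_<_; 0#)
open Subfield using (Element; value; two)

theorem5p2 : (ℝ : CompleteOrderedField) (F : Subfield ℝ) →
    ((ε : Element F) →
    (T[ F ] ⊢ all̇ (var zero ẋ var zero -̇ f (two F) (var zero) +̇ 1̇ ≥̇ const ε))
    ⇔ (_<_ ℝ (value F ε) (0# ℝ)))
    × ¬ (T[ F ] ⊢ all̇ (var zero ẋ var zero -̇ f (two F) (var zero) +̇ 1̇ ≥̇ 0̇))
theorem5p2 ℝ F = (λ ε → mk⇔ (negative ε) (Provability.provable F ε)) , Countermodel.unprovable-0 F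
  where
  negative : ∀ ε → T[ F ] ⊢ all̇ (var zero ẋ var zero -̇ f (two F) (var zero) +̇ 1̇ ≥̇ const ε) →
             _<_ ℝ (value F ε) (0# ℝ)
  negative ε proof with CompleteOrderedField._<?_ ℝ (value F ε) (0# ℝ)
  ... | yes ε<0 = ε<0
  ... | no  ε≮0 = contradiction proof (Countermodel.unprovable-const F ε ε≮0)
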